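{- Let $G$ be a finite simple graph. If $G$ contains $K_{3,4}$ as an induced minor, then $G$ contains a triangle or a theta as an induced subgraph.
   Context: $K_{a,b}$ is the complete bipartite graph with sides of sizes $a$ and $b$. A graph $H$ is an induced minor of $G$ if $H$ can be obtained from $G$ by repeatedly deleting vertices and contracting edges. A theta is a graph made of three internally vertex-disjoint chordless paths $P_1=a\dots b$, $P_2=a\dots b$, $P_3=a\dots b$, each of length (number of edges) at least two, such that no edges exist between the paths except the three edges incident to $a$ and the three edges incident to $b$. -}

module Defs where

open import Data.Nat using (ℕ; suc)
open import Data.Fin using (Fin; punchIn; _≟_; toℕ)
open import Data.Bool using (Bool; true; false; _∧_; _∨_; not; _xor_)
open import Data.List using (List; []; _∷_; _++_; [_])
open import Data.List.Relation.Unary.Unique.Propositional using (Unique)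
open import Data.List.Membership.Propositional using (_∈_)
open import Data.Product using (Σ; _×_; ∃; ∃-syntax)
open import Data.Sum using (_⊎_)
open import Relation.Nullary using (¬_)
open import Relation.Nullary.Decidable using (⌊_⌋)
open import Relation.Binary.PropositionalEquality using (_≡_)
open import Function.Bundles using (_↔_; Inverse)
open import Data.Nat using (_<ᵇ_)

record Graph : Set where
  constructor mkGraph
  field
    size : ℕ
    adj  : Fin size → Fin size → Bool
open Graph public

record SimpleGraph : Set where
  field
    graph  : Graph
    sym    : ∀ i j → adj graph i j ≡ adj graph j i
    irrefl : ∀ i → adj graph i i ≡ false
open SimpleGraph public

deleteVertex : (m : ℕ) → (Fin (suc m) → Fin (suc m) → Bool) → Fin (suc m) → Graph
deleteVertex m A v = mkGraph m (λ i j → A (punchIn v i) (punchIn v j))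

-- Contracting the edge uv (u ≠ v, u ~ v): v is merged into u. Remaining
-- vertices are indexed by Fin m via punchIn v; the merged vertex (image of u)
-- is adjacent to every neighbour of u or of v; no loops are created.
contractEdge : (m : ℕ) → (Fin (suc m) → Fin (suc m) → Bool) → Fin (suc m) → Fin (suc m) → Graph
contractEdge m A u v = mkGraph m adj'
  where
  isU : Fin (suc m) → Bool
  isU x = ⌊ x ≟ u ⌋
  adj' : Fin m → Fin m → Bool
  adj' i j = not ⌊ i ≟ j ⌋ ∧
             (A (punchIn v i) (punchIn v j)
              ∨ (isU (punchIn v i) ∧ A v (punchIn v j))
              ∨ (isU (punchIn v j) ∧ A (punchIn v i) v))

data _≼_ (H : Graph) : Graph → Set where
  done : H ≼ H
  del  : ∀ {m} {A : Fin (suc m) → Fin (suc m) → Bool} (v : Fin (suc m)) →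
         H ≼ deleteVertex m A v → H ≼ mkGraph (suc m) A
  con  : ∀ {m} {A : Fin (suc m) → Fin (suc m) → Bool} (u v : Fin (suc m)) →
         ¬ (u ≡ v) → A u v ≡ true →
         H ≼ contractEdge m A u v → H ≼ mkGraph (suc m) A

_≅_ : Graph → Graph → Set
G ≅ H = Σ (Fin (size G) ↔ Fin (size H)) λ f →
          ∀ i j → adj H (Inverse.to f i) (Inverse.to f j) ≡ adj G i j

K : ℕ → ℕ → Graph
K a b = mkGraph (a Data.Nat.+ b) (λ i j → (toℕ i <ᵇ a) xor (toℕ j <ᵇ a))

InducedMinor : Graph → Graph → Set
InducedMinor H G = ∃[ H' ] (H' ≼ G × H' ≅ H)

HasTriangle : SimpleGraph → Set
HasTriangle G = ∃[ x ] ∃[ y ] ∃[ z ]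
  (¬ x ≡ y × ¬ y ≡ z × ¬ x ≡ z ×
   adj (graph G) x y ≡ true × adj (graph G) y z ≡ true × adj (graph G) x z ≡ true)

data Consecutive {A : Set} (x y : A) : List A → Set where
  here-xy : ∀ {l} → Consecutive x y (x ∷ y ∷ l)
  here-yx : ∀ {l} → Consecutive x y (y ∷ x ∷ l)
  there   : ∀ {z l} → Consecutive x y l → Consecutive x y (z ∷ l)

NonEmpty : {A : Set} → List A → Set
NonEmpty l = ∃[ x ] ∃[ l' ] (l ≡ x ∷ l')

-- Theta as induced subgraph: distinct ends a, b and three nonempty lists of
-- internal vertices p, q, r (so each path a-p-b has length ≥ 2); all vertices
-- pairwise distinct; among these vertices, two are adjacent in G iff they are
-- consecutive on one of the three paths  a ∷ p ++ [ b ]  etc.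
HasTheta : SimpleGraph → Set
HasTheta G = ∃[ a ] ∃[ b ] ∃[ p ] ∃[ q ] ∃[ r ]
  (NonEmpty p × NonEmpty q × NonEmpty r ×
   Unique (a ∷ b ∷ p ++ q ++ r) ×
   (∀ x y → x ∈ (a ∷ b ∷ p ++ q ++ r) → y ∈ (a ∷ b ∷ p ++ q ++ r) →
      (adj (graph G) x y ≡ true →
         Consecutive x y (a ∷ p ++ [ b ]) ⊎ Consecutive x y (a ∷ q ++ [ b ])
           ⊎ Consecutive x y (a ∷ r ++ [ b ]))
      × (Consecutive x y (a ∷ p ++ [ b ]) ⊎ Consecutive x y (a ∷ q ++ [ b ])
           ⊎ Consecutive x y (a ∷ r ++ [ b ]) → adj (graph G) x y ≡ true)))

{-# OPTIONS --safe #-}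
-- Suppose that G has neither a triangle nor a theta.  A model of K₃,₄ consists of three connected
-- rows and four connected columns.  Almost every theta comes from one construction: if two
-- separated connected sets are joined by three pairwise separated paths, each set together with its
-- ends of the paths contains a subdivided claw with these ends, and the two centres of the claws are
-- the ends of a theta, unless they are equal or adjacent.
--
-- Shrink a column to a minimal connected set seeing all rows.  Removing a non-cut vertex must lose a
-- row, so a non-cut vertex is the unique contact of some row; taking two of them, the column is
-- either small (at most two vertices, adjacent) or far: two rows have unique, nonadjacent contacts,
-- and the column is an induced path between them or has a unique contact with the third row as well.
-- Two small columns contradict the construction above, because the centres fall into the columns.
-- Two far columns with the same third row and a further far column give a theta, through the hubs of
-- the two other rows.  Hence one column D is small and the others are paths, one for each third row.
-- Then row i has exactly one vertex seeing both D and column i, for otherwise two such vertices are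
-- joined by a theta going through D, through column i, and around the other columns.  So the rows can
-- be trimmed until each has a single neighbour of D, and the previous argument applies, with D
-- playing the part of a far column.

module Submission where

open import Defs hiding (sym)
open import Data.Bool using (Bool; true; false; _∧_; _∨_; not; _xor_)
open import Data.Bool.Properties using (⇔→≡; ∨-zeroʳ)
open import Data.Empty using (⊥; ⊥-elim)
open import Data.Fin using (Fin; zero; suc; _≟_; punchIn; punchOut; _↑ˡ_; _↑ʳ_; toℕ)
open import Data.Fin.Patterns using (0F; 1F; 2F)
open import Data.Fin.Properties using (any?; all?; injective⇒≤; ¬∀⟶∃¬; pigeonhole; punchInᵢ≢i; punchIn-injective; <⇒≢; punchIn-punchOut; punchOut-punchIn; punchOut-cong; ↑ˡ-injective; ↑ʳ-injective)
open import Data.Fin.Subset using (Subset; ⁅_⁆; inside; outside) renaming (_∈_ to _∈ₛ_; _∉_ to _∉ₛ_; _∪_ to _∪ₛ_; _-_ to _-ₛ_; _⊂_ to _⊂ₛ_; _⊃_ to _⊃ₛ_)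
open import Data.Fin.Subset.Induction using (⊂-wellFounded; ⊃-wellFounded; Acc; acc)
open import Data.Fin.Subset.Properties using (x∈p∪q⁺; x∈p∪q⁻; x∈⁅x⁆; x∈⁅y⁆⇒x≡y; x∈p∧x≢y⇒x∈p-y; x∈p⇒p-x⊂p; p─q⊆p) renaming (_∈?_ to _∈ₛ?_)
open import Data.List using (List; []; _∷_; _++_; [_]; length; lookup; concatMap; map; allFin)
open import Data.List.Membership.Propositional using (_∈_; _∉_; find; lose)
open import Data.List.Membership.Propositional.Properties using (∈-++⁺ˡ; ∈-++⁺ʳ; ∈-++⁻; ∈-allFin; ∈-map⁺; ∈-concatMap⁺; ∈-lookup; ∈-∃++)
open import Data.List.Properties using (++-assoc; length-++)
open import Data.List.Relation.Unary.All using (All; []; _∷_; tabulate)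
open import Data.List.Relation.Unary.AllPairs using ([]; _∷_)
open import Data.List.Relation.Unary.Any using (here; there)
open import Data.List.Relation.Unary.Unique.Propositional using (Unique)
open import Data.List.Relation.Unary.Unique.Propositional.Properties using (++⁺)
open import Data.Maybe using (Maybe; just; nothing)
open import Data.Maybe.Properties using (just-injective; ≡-dec)
open import Data.Nat using (ℕ; suc; zero; _≤_; z≤n; s≤s; _<ᵇ_)
open import Data.Nat.Properties using (≤-trans; m≤m+n; m≤n+m; ≤-reflexive)
open import Data.Product using (Σ; _×_; _,_; proj₁; proj₂; ∃-syntax)
open import Data.Sum using (_⊎_; inj₁; inj₂; [_,_]′)
open import Data.Vec.Properties using (lookup⇒[]=; []=⇒lookup; lookup∘tabulate)
open import Function using (_∘_; id)
open import Function.Bundles using (mk⇔; Inverse)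
open import Relation.Binary.PropositionalEquality using (_≡_; _≢_; refl; sym; trans; cong; cong₂; subst)
open import Relation.Nullary using (¬_; Dec; yes; no; ¬?; does)
open import Relation.Nullary.Decidable using (_×-dec_; _⊎-dec_; _→-dec_; map′; decidable-stable; dec-true; toWitness; ⌊_⌋)
import Data.Bool as Bool
import Data.List.Membership.DecPropositional as DecMem
import Data.List.Relation.Unary.All as All
import Data.List.Relation.Unary.Any as Any
import Data.List.Relation.Unary.Unique.DecPropositional as DecUnique
import Data.Vec as Vec

-- The claw construction can fail only if a centre is not inside its connected set but is itself an
-- end of one of the three paths, because centres inside two separated sets are neither equal nor
-- adjacent. An end that is a centre has two nonadjacent neighbours in the set. Most of the work
-- excludes such vertices or, where they cannot be excluded, exploits them. Triangle-freeness enters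
-- mainly through claws: a vertex whose only contacts with an induced path are two adjacent ones
-- gives no claw, whereas a single contact or two nonadjacent ones do. Four is the number of columns
-- that the pigeonhole principle asks for: among four far columns two share one of the three
-- possible third rows and a further far column remains, while beside a small column the other three
-- have to use each third row once. Triangles and thetas in a finite graph are decidable, so an
-- indirect proof is legitimate, and inside it cases may be split that are never decided.

third : ∀ {α β : Fin 3} → α ≢ β → ∃[ γ ] (γ ≢ α × γ ≢ β)
third {α} {β} _ = table α β
  where
  opaque
    table : ∀ (α β : Fin 3) → ∃[ γ ] (γ ≢ α × γ ≢ β)
    table = toWitness {a? = all? λ α → all? λ β → any? λ γ → ¬? (γ ≟ α) ×-dec ¬? (γ ≟ β)} _

comprehend : ∀ {n} {P : Fin n → Set} → (∀ v → Dec (P v)) → Subset n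
comprehend P? = Vec.tabulate (λ v → does (P? v))

∈-comprehend⁺ : ∀ {n} {P : Fin n → Set} (P? : ∀ v → Dec (P v)) {v} → P v → v ∈ₛ comprehend P?
∈-comprehend⁺ P? {v} p = lookup⇒[]= v _ (trans (lookup∘tabulate _ v) (dec-true (P? v) p))

∈-comprehend⁻ : ∀ {n} {P : Fin n → Set} (P? : ∀ v → Dec (P v)) {v} → v ∈ₛ comprehend P? → P v
∈-comprehend⁻ P? {v} m with P? v | trans (sym (lookup∘tabulate (λ v → does (P? v)) v)) ([]=⇒lookup m)
... | yes p | _ = p
... | no _ | ()

opaque
  cover : ∀ {α β γ : Fin 3} → α ≢ β → γ ≢ α → γ ≢ β → ∀ i → i ≡ α ⊎ i ≡ β ⊎ i ≡ γ
  cover {α} {β} {γ} αβ γα γβ i = table α β γ i αβ γα γβ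
    where
    table : ∀ (α β γ i : Fin 3) → α ≢ β → γ ≢ α → γ ≢ β → i ≡ α ⊎ i ≡ β ⊎ i ≡ γ
    table = toWitness {a? = all? λ α → all? λ β → all? λ γ → all? λ i →
      ¬? (α ≟ β) →-dec (¬? (γ ≟ α) →-dec (¬? (γ ≟ β) →-dec ((i ≟ α) ⊎-dec ((i ≟ β) ⊎-dec (i ≟ γ)))))} _

opaque
  -- Translates between rows and the positions of a claw built on a path, where 0 is the first end,
  -- 1 the attached vertex and 2 the last end.
  numbering : ∀ {a b c : Fin 3} → a ≢ b → c ≢ a → c ≢ b →
    Σ (Fin 3 → Fin 3) λ σ → (∀ {j k} → σ j ≡ σ k → j ≡ k) × σ a ≡ 0F × σ b ≡ 1F × σ c ≡ 2F
  numbering {a} {b} {c} ab ca cb = σ , inj , σa , σb , σc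
    where
    σ : Fin 3 → Fin 3
    σ r = [ (λ _ → 0F) , [ (λ _ → 1F) , (λ _ → 2F) ]′ ]′ (cover ab ca cb r)
    inj : ∀ {j k} → σ j ≡ σ k → j ≡ k
    inj {j} {k} q with cover ab ca cb j | cover ab ca cb k | q
    ... | inj₁ refl | inj₁ refl | _ = refl
    ... | inj₁ _ | inj₂ (inj₁ _) | ()
    ... | inj₁ _ | inj₂ (inj₂ _) | ()
    ... | inj₂ (inj₁ _) | inj₁ _ | ()
    ... | inj₂ (inj₁ refl) | inj₂ (inj₁ refl) | _ = refl
    ... | inj₂ (inj₁ _) | inj₂ (inj₂ _) | ()
    ... | inj₂ (inj₂ _) | inj₁ _ | ()
    ... | inj₂ (inj₂ _) | inj₂ (inj₁ _) | ()
    ... | inj₂ (inj₂ refl) | inj₂ (inj₂ refl) | _ = refl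
    σa : σ a ≡ 0F
    σa with cover ab ca cb a
    ... | inj₁ _ = refl
    ... | inj₂ (inj₁ q) = ⊥-elim (ab q)
    ... | inj₂ (inj₂ q) = ⊥-elim (ca (sym q))
    σb : σ b ≡ 1F
    σb with cover ab ca cb b
    ... | inj₁ q = ⊥-elim (ab (sym q))
    ... | inj₂ (inj₁ _) = refl
    ... | inj₂ (inj₂ q) = ⊥-elim (cb (sym q))
    σc : σ c ≡ 2F
    σc with cover ab ca cb c
    ... | inj₁ q = ⊥-elim (ca q)
    ... | inj₂ (inj₁ q) = ⊥-elim (cb q)
    ... | inj₂ (inj₂ _) = refl

-- Since the goal is empty, a proposition can be split on without being decided. Reachability in
-- `no-seat` is of this kind.
by-cases : ∀ {A : Set} → (A → ⊥) → (¬ A → ⊥) → ⊥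
by-cases f g = g f

-- Walks and induced paths

module Core (G : SimpleGraph) where

  V : Set
  V = Fin (size (graph G))

  E : V → V → Bool
  E = adj (graph G)

  infix 4 _~_
  _~_ : V → V → Set
  u ~ v = E u v ≡ true

  ~-sym : ∀ {u v} → u ~ v → v ~ u
  ~-sym {u} {v} p = trans (SimpleGraph.sym G v u) p

  ~-irr : ∀ {u} → ¬ (u ~ u)
  ~-irr {u} p with trans (sym p) (irrefl G u)
  ... | ()

  ~⇒≢ : ∀ {u v} → u ~ v → u ≢ v
  ~⇒≢ p refl = ~-irr p

  _~?_ : ∀ u v → Dec (u ~ v)
  u ~? v = E u v Bool.≟ true

  Sp : V → V → Set
  Sp u v = u ≢ v × ¬ (u ~ v)

  Sp-sym : ∀ {u v} → Sp u v → Sp v u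
  Sp-sym (a , b) = a ∘ sym , b ∘ ~-sym

  Sp? : ∀ u v → Sp u v ⊎ (u ≡ v ⊎ u ~ v)
  Sp? u v with u ≟ v | u ~? v
  ... | yes p | _ = inj₂ (inj₁ p)
  ... | no _ | yes q = inj₂ (inj₂ q)
  ... | no p | no q = inj₁ (p , q)

  equal-or-Sp : ∀ {a v z} → a ≢ v → (a ~ v → v ≡ z) → v ≡ z ⊎ Sp a v
  equal-or-Sp {a} {v} n f with a ~? v
  ... | yes e = inj₁ (f e)
  ... | no e = inj₂ (n , e)

  Pred : Set₁
  Pred = V → Set

  Sep : Pred → Pred → Set
  Sep P Q = ∀ {u v} → P u → Q v → Sp u v

  infixr 6 _∪_
  _∪_ : Pred → Pred → Pred
  (P ∪ Q) v = P v ⊎ Q v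

  -- vertices after the first one lie in S
  data Walk (S : Pred) : V → V → Set where
    nil  : ∀ {a} → Walk S a a
    step : ∀ {a b c} → a ~ b → S b → Walk S b c → Walk S a c

  infixr 5 _+w_
  _+w_ : ∀ {S a b c} → Walk S a b → Walk S b c → Walk S a c
  nil +w w = w
  step e s v +w w = step e s (v +w w)

  mapW : ∀ {S T : Pred} {a b} → (∀ {v} → S v → T v) → Walk S a b → Walk T a b
  mapW f nil = nil
  mapW f (step e s w) = step e (f s) (mapW f w)

  edge : ∀ {S : Pred} {a b} → a ~ b → S b → Walk S a b
  edge e s = step e s nil

  revW : ∀ {S : Pred} {a b} → Walk S a b → S a → Walk S b a
  revW nil s = nil
  revW (step e sb w) sa = revW w sb +w edge (~-sym e) sa

  endW : ∀ {S : Pred} {a b} → Walk S a b → a ≢ b → S b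
  endW nil n = ⊥-elim (n refl)
  endW (step e s nil) _ = s
  endW (step e s w@(step {a = a} e' s' _)) _ = endW′ s w
    where
    endW′ : ∀ {S : Pred} {a b} → S a → Walk S a b → S b
    endW′ s nil = s
    endW′ s (step _ t w) = endW′ t w

  endIn : ∀ {S : Pred} {a b} → S a → Walk S a b → S b
  endIn s nil = s
  endIn s (step _ t w) = endIn t w

  firstStep : ∀ {S : Pred} {a b} → Walk S a b → a ≢ b → ∃[ t ] (a ~ t × S t)
  firstStep nil n = ⊥-elim (n refl)
  firstStep (step e s _) _ = _ , e , s

  Conn : Pred → Set
  Conn S = ∀ {a b} → S a → S b → Walk S a b

  -- The walk is cut at its first arrival at `b`.
  avoid : ∀ {S : Pred} {a b} → Walk S a b → a ≢ b →
          ∃[ t ] (Walk (λ v → S v × v ≢ b) a t × t ~ b × (t ≡ a ⊎ (S t × t ≢ b)))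
  avoid nil n = ⊥-elim (n refl)
  avoid {b = b} (step {a = a} {b = x} e s w) n with x ≟ b
  ... | yes refl = a , nil , e , inj₁ refl
  ... | no x≢b with avoid w x≢b
  ...   | t , w' , e' , inj₁ refl = t , edge e (s , x≢b) , e' , inj₂ (s , x≢b)
  ...   | t , w' , e' , inj₂ q = t , step e (s , x≢b) w' , e' , inj₂ q

  firstHit : ∀ {S : Pred} (T : Pred) → (∀ v → Dec (T v)) → ∀ {a b} → S a → T b → Walk S a b →
             ∃[ t ] (S t × T t ×
               (t ≡ a ⊎ (¬ T a × ∃[ p ] (Walk (λ v → S v × ¬ T v) a p × p ~ t × S p × ¬ T p))))
  firstHit T T? {a} sa tb w with T? a
  firstHit T T? {a} sa tb w | yes ta = a , sa , ta , inj₁ refl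
  firstHit T T? {a} sa tb nil | no na = ⊥-elim (na tb)
  firstHit T T? {a} sa tb (step e s w) | no na with firstHit T T? s tb w
  ... | t , st , tt , inj₁ refl = t , st , tt , inj₂ (na , a , nil , e , sa , na)
  ... | t , st , tt , inj₂ (nx , p , u , e' , sp , np) =
        t , st , tt , inj₂ (na , p , step e (s , nx) u , e' , sp , np)

  end : V → List V → V
  end a [] = a
  end a (x ∷ l) = end x l

  end-++ : ∀ a xs y ys → end a (xs ++ y ∷ ys) ≡ end y ys
  end-++ a [] y ys = refl
  end-++ a (x ∷ xs) y ys = end-++ x xs y ys

  end∈ : ∀ a l → end a l ∈ a ∷ l
  end∈ a [] = here refl
  end∈ a (x ∷ l) = there (end∈ x l)

  -- A chordless path as the list of its vertices. Comparing each vertex with all later ones beyond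
  -- its successor rules out chords and repetitions at once.
  data Ind : List V → Set where
    one  : ∀ {x} → Ind [ x ]
    cons : ∀ {x y l} → x ~ y → (∀ {z} → z ∈ l → Sp x z) → Ind (y ∷ l) → Ind (x ∷ y ∷ l)

  Touch-or-path : V → V → List V → Set
  Touch-or-path a y l = (∀ {z} → z ∈ y ∷ l → Sp a z) ⊎
    ∃[ l' ] (Ind (a ∷ l') × end a l' ≡ end y l × (∀ {z} → z ∈ l' → z ∈ y ∷ l))

  -- The recursion looks at the far end first: the contact of `a` deepest in the list is taken and
  -- everything before it is cut off, so no chord from `a` can remain.
  shortcut : ∀ a y l → Ind (y ∷ l) → Touch-or-path a y l
  shortcut a y l i with Sp? a y
  shortcut a y [] i | inj₁ s = inj₁ λ { (here refl) → s }
  shortcut a y [] i | inj₂ (inj₁ refl) = inj₂ ([] , one , refl , λ ())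
  shortcut a y [] i | inj₂ (inj₂ e) = inj₂ ([ y ] , cons e (λ ()) one , refl , id)
  shortcut a y (x ∷ l) (cons e f i) | r with shortcut a x l i
  ... | inj₂ (l' , j , q , sub) = inj₂ (l' , j , q , there ∘ sub)
  shortcut a y (x ∷ l) (cons e f i) | inj₁ s | inj₁ g = inj₁ λ { (here refl) → s ; (there z) → g z }
  shortcut a y (x ∷ l) (cons e f i) | inj₂ (inj₁ refl) | inj₁ g = inj₂ (x ∷ l , cons e f i , refl , there)
  shortcut a y (x ∷ l) (cons e f i) | inj₂ (inj₂ h) | inj₁ g =
    inj₂ (y ∷ x ∷ l , cons h g (cons e f i) , refl , id)

  record IPath (S : Pred) (a b : V) : Set where
    constructor ipath
    field
      verts : List V
      ind   : Ind (a ∷ verts)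
      ends  : end a verts ≡ b
      inS   : ∀ {z} → z ∈ verts → S z

  extract : ∀ {S a b} → Walk S a b → IPath S a b
  extract nil = ipath [] one refl (λ ())
  extract {S} {a} (step {b = b} e s w) with extract w
  ... | ipath l i q sub with shortcut a b l i
  ...   | inj₁ g = ⊥-elim (proj₂ (g (here refl)) e)
  ...   | inj₂ (l' , j , q' , sub') = ipath l' j (trans q' q) λ z → g (sub' z)
    where
    g : ∀ {z} → z ∈ b ∷ l → S z
    g (here refl) = s
    g (there z) = sub z

  headSp : ∀ {x l} → Ind (x ∷ l) → ∀ {z} → z ∈ l → x ≢ z
  headSp (cons e f i) (here refl) = ~⇒≢ e
  headSp (cons e f i) (there z) = proj₁ (f z)

  Ind-prefix : ∀ xs {y ys} → Ind (xs ++ y ∷ ys) → Ind (xs ++ [ y ])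
  Ind-prefix [] i = one
  Ind-prefix (x ∷ []) (cons e f i) = cons e (λ ()) one
  Ind-prefix (x ∷ x' ∷ xs) {y} {ys} (cons e f i) = cons e g (Ind-prefix (x' ∷ xs) i)
    where
    g : ∀ {z} → z ∈ xs ++ [ y ] → Sp x z
    g z with ∈-++⁻ xs z
    ... | inj₁ p = f (∈-++⁺ˡ p)
    ... | inj₂ (here refl) = f (∈-++⁺ʳ xs (here refl))

  Ind-suffix : ∀ xs {y ys} → Ind (xs ++ y ∷ ys) → Ind (y ∷ ys)
  Ind-suffix [] i = i
  Ind-suffix (x ∷ []) (cons e f i) = i
  Ind-suffix (x ∷ x' ∷ xs) (cons e f i) = Ind-suffix (x' ∷ xs) i

  Ind-gap : ∀ xs {y zs} → Ind (xs ++ y ∷ zs) → Sep (_∈ xs) (_∈ zs)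
  Ind-gap (x ∷ []) (cons e f i) (here refl) z = f z
  Ind-gap (x ∷ x' ∷ xs) (cons e f i) (here refl) z = f (∈-++⁺ʳ xs (there z))
  Ind-gap (x ∷ x' ∷ xs) (cons e f i) (there u) z = Ind-gap (x' ∷ xs) i u z

  Ind-conn : ∀ {l} → Ind l → Conn (_∈ l)
  Ind-conn one (here refl) (here refl) = nil
  Ind-conn (cons e f i) (here refl) (here refl) = nil
  Ind-conn (cons e f i) (here refl) (there b) = step e (there (here refl)) (mapW there (Ind-conn i (here refl) b))
  Ind-conn (cons e f i) (there a) (here refl) = mapW there (Ind-conn i a (here refl)) +w edge (~-sym e) (here refl)
  Ind-conn (cons e f i) (there a) (there b) = mapW there (Ind-conn i a b)

  Ind-∉ : ∀ xs {y ys} → Ind (xs ++ y ∷ ys) → y ∉ xs × y ∉ ys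
  Ind-∉ [] i = (λ ()) , λ z → headSp i z refl
  Ind-∉ (x ∷ []) (cons e f i) = (λ { (here refl) → ~-irr e }) , proj₂ (Ind-∉ [] i)
  Ind-∉ (x ∷ x' ∷ xs) (cons e f i) =
    (λ { (here refl) → proj₁ (f (∈-++⁺ʳ xs (here refl))) refl ; (there p) → proj₁ (Ind-∉ (x' ∷ xs) i) p }) ,
    proj₂ (Ind-∉ (x' ∷ xs) i)

  Ind-adj : ∀ xs {y z zs} → Ind (xs ++ y ∷ z ∷ zs) → y ~ z
  Ind-adj xs i with Ind-suffix xs i
  ... | cons e _ _ = e

  -- in the last case a and b are the first and the last element of C; mid may contain others
  data Contacts (C : Pred) : List V → Set where
    none : ∀ {l} → (∀ {z} → z ∈ l → ¬ C z) → Contacts C l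
    one  : ∀ pre a post → C a → (∀ {z} → z ∈ pre → ¬ C z) → (∀ {z} → z ∈ post → ¬ C z) →
           Contacts C (pre ++ a ∷ post)
    two  : ∀ pre a mid b post → C a → C b → (∀ {z} → z ∈ pre → ¬ C z) → (∀ {z} → z ∈ post → ¬ C z) →
           Contacts C (pre ++ a ∷ mid ++ b ∷ post)

  contacts : ∀ {C : Pred} → (∀ v → Dec (C v)) → ∀ l → Contacts C l
  contacts C? [] = none λ ()
  contacts {C} C? (x ∷ l) with contacts C? l | C? x
  ... | none n | no q = none λ { (here refl) → q ; (there z) → n z }
  ... | none n | yes c = one [] x l c (λ ()) n
  ... | one pre a post ca n m | no q = one (x ∷ pre) a post ca (λ { (here refl) → q ; (there z) → n z }) m
  ... | one pre a post ca n m | yes c = two [] x pre a post c ca (λ ()) m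
  ... | two pre a mid b post ca cb n m | no q =
        two (x ∷ pre) a mid b post ca cb (λ { (here refl) → q ; (there z) → n z }) m
  ... | two pre a mid b post ca cb n m | yes c =
        subst (Contacts C) (cong (x ∷_) (++-assoc pre (a ∷ mid) (b ∷ post)))
          (two [] x (pre ++ a ∷ mid) b post c cb (λ ()) m)

-- Branch sets of an induced minor

-- a branch-set decomposition: lab v is the vertex of H into which v is contracted, if any
record Model (H : Graph) (G : SimpleGraph) : Set where
  open Core G
  field
    lab      : V → Maybe (Fin (size H))
    nonempty : ∀ a → ∃[ v ] (lab v ≡ just a)
    conn     : ∀ a → Conn (λ v → lab v ≡ just a)
    edge⁺    : ∀ {a b} → adj H a b ≡ true → ∃[ u ] ∃[ v ] (lab u ≡ just a × lab v ≡ just b × u ~ v)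
    edge⁻    : ∀ {a b u v} → lab u ≡ just a → lab v ≡ just b → a ≢ b → u ~ v → adj H a b ≡ true

∨-split : ∀ {x y} → x ∨ y ≡ true → x ≡ true ⊎ y ≡ true
∨-split {true} _ = inj₁ refl
∨-split {false} q = inj₂ q

∧-split : ∀ {x y} → x ∧ y ≡ true → x ≡ true × y ≡ true
∧-split {true} q = refl , q

∧-false : ∀ {x y} → x ≡ false → x ∧ y ≡ false
∧-false refl = refl

trivial-model : (G : SimpleGraph) → Model (graph G) G
trivial-model G = record
  { lab = just ; nonempty = λ a → a , refl ; conn = λ { a refl refl → nil }
  ; edge⁺ = λ e → _ , _ , refl , refl , e ; edge⁻ = λ { refl refl _ e → e } }
  where open Core G

module _ {m} (A : Fin (suc m) → Fin (suc m) → Bool) (A-sym : ∀ i j → A i j ≡ A j i) (A-irr : ∀ i → A i i ≡ false) where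

  whole : SimpleGraph
  whole = record { graph = mkGraph (suc m) A ; sym = A-sym ; irrefl = A-irr }

  private module G = Core whole

  module _ (v : Fin (suc m)) where

    deleted : SimpleGraph
    deleted = record { graph = deleteVertex m A v ; sym = λ _ _ → A-sym _ _ ; irrefl = λ _ → A-irr _ }

    module _ {H} (M : Model H deleted) where
      open Model M
      private
        lab' : Fin (suc m) → Maybe (Fin (size H))
        lab' x with v ≟ x
        ... | yes _ = nothing
        ... | no n = lab (punchOut n)

        lab'-in : ∀ i → lab' (punchIn v i) ≡ lab i
        lab'-in i with v ≟ punchIn v i
        ... | yes q = ⊥-elim (punchInᵢ≢i v i (sym q))
        ... | no n = cong lab (trans (punchOut-cong v refl) (punchOut-punchIn v))

        pre : ∀ {x a} → lab' x ≡ just a → ∃[ i ] (punchIn v i ≡ x × lab i ≡ just a)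
        pre {x} q with v ≟ x
        ... | no n = punchOut n , punchIn-punchOut n , q

        lift : ∀ {a i j} → Core.Walk deleted (λ i → lab i ≡ just a) i j → G.Walk (λ x → lab' x ≡ just a) (punchIn v i) (punchIn v j)
        lift Core.nil = G.nil
        lift (Core.step e s w) = G.step e (trans (lab'-in _) s) (lift w)

      undelete : Model H whole
      undelete = record
        { lab = lab'
        ; nonempty = λ a → punchIn v (proj₁ (nonempty a)) , trans (lab'-in _) (proj₂ (nonempty a))
        ; conn = λ a p q → conn' a (pre p) (pre q)
        ; edge⁺ = λ e → let (i , j , p , q , f) = edge⁺ e in punchIn v i , punchIn v j , trans (lab'-in i) p , trans (lab'-in j) q , f
        ; edge⁻ = λ p q → edge' (pre p) (pre q) }
        where
        conn' : ∀ a {x y} → ∃[ i ] (punchIn v i ≡ x × lab i ≡ just a) → ∃[ i ] (punchIn v i ≡ y × lab i ≡ just a) →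
                G.Walk (λ x → lab' x ≡ just a) x y
        conn' a (i , refl , p) (j , refl , q) = lift (conn a p q)
        edge' : ∀ {a b x y} → ∃[ i ] (punchIn v i ≡ x × lab i ≡ just a) → ∃[ i ] (punchIn v i ≡ y × lab i ≡ just b) →
                a ≢ b → A x y ≡ true → adj H a b ≡ true
        edge' (i , refl , p) (j , refl , q) n e = edge⁻ p q n e

  module _ (u v : Fin (suc m)) (u≢v : ¬ u ≡ v) (u~v : A u v ≡ true) where

    private
      A' : Fin m → Fin m → Bool
      A' = adj (contractEdge m A u v)

      -- The quotient map of the contraction, which sends `v` to the image of `u`.
      π : Fin (suc m) → Fin m
      π x with v ≟ x
      ... | yes _ = punchOut {i = v} {j = u} (u≢v ∘ sym)
      ... | no n = punchOut n

      π-in : ∀ i → π (punchIn v i) ≡ i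
      π-in i with v ≟ punchIn v i
      ... | yes q = ⊥-elim (punchInᵢ≢i v i (sym q))
      ... | no n = trans (punchOut-cong v refl) (punchOut-punchIn v)

      in-π : ∀ x → (x ≡ v × punchIn v (π x) ≡ u) ⊎ punchIn v (π x) ≡ x
      in-π x with v ≟ x
      ... | yes q = inj₁ (sym q , punchIn-punchOut _)
      ... | no n = inj₂ (punchIn-punchOut n)

      πv : π v ≡ π u
      πv with in-π v | in-π u
      ... | inj₁ (_ , q) | inj₂ r = punchIn-injective v _ _ (trans q (sym r))
      ... | inj₁ (_ , q) | inj₁ (r , _) = ⊥-elim (u≢v r)
      ... | inj₂ q | _ = ⊥-elim (punchInᵢ≢i v _ q)

      -- Only `u` and `v` share an image, and they are adjacent. Hence fibres are connected, and so
      -- are preimages of connected sets.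
      fibre : ∀ {x y} → π x ≡ π y → x ≡ y ⊎ A x y ≡ true
      fibre {x} {y} q with in-π x | in-π y
      ... | inj₁ (refl , _) | inj₁ (refl , _) = inj₁ refl
      ... | inj₁ (refl , r) | inj₂ s = inj₂ (subst (λ z → A v z ≡ true) (trans (sym r) (trans (cong (punchIn v) q) s)) (trans (A-sym v u) u~v))
      ... | inj₂ r | inj₁ (refl , s) = inj₂ (subst (λ z → A z v ≡ true) (trans (sym s) (trans (cong (punchIn v) (sym q)) r)) u~v)
      ... | inj₂ r | inj₂ s = inj₁ (trans (sym r) (trans (cong (punchIn v) q) s))

      is? : ∀ {n} {x y : Fin n} → ⌊ x ≟ y ⌋ ≡ true → x ≡ y
      is? {x = x} {y} q with x ≟ y
      ... | yes r = r

      is : ∀ {n} {x y : Fin n} → x ≡ y → ⌊ x ≟ y ⌋ ≡ true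
      is {x = x} refl with x ≟ x
      ... | yes _ = refl
      ... | no n = ⊥-elim (n refl)

      isn't : ∀ {n} {x y : Fin n} → x ≢ y → not ⌊ x ≟ y ⌋ ≡ true
      isn't {x = x} {y} n with x ≟ y
      ... | yes r = ⊥-elim (n r)
      ... | no _ = refl

      isn't? : ∀ {n} {x y : Fin n} → not ⌊ x ≟ y ⌋ ≡ true → x ≢ y
      isn't? {x = x} {y} q r with x ≟ y
      ... | no n = n r

      from-contracted : ∀ {i j} → A' i j ≡ true → i ≢ j × ∃[ x ] ∃[ y ] (π x ≡ i × π y ≡ j × A x y ≡ true)
      from-contracted {i} {j} e with ∧-split e
      ... | n , f = isn't? n , go (∨-split f)
        where
        πuv : ∀ {k} → punchIn v k ≡ u → π v ≡ k
        πuv q = trans πv (trans (cong π (sym q)) (π-in _))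
        go : _ → ∃[ x ] ∃[ y ] (π x ≡ i × π y ≡ j × A x y ≡ true)
        go (inj₁ f) = punchIn v i , punchIn v j , π-in i , π-in j , f
        go (inj₂ f) with ∨-split f
        ... | inj₁ g = v , punchIn v j , πuv (is? (proj₁ (∧-split g))) , π-in j , proj₂ (∧-split g)
        ... | inj₂ g = punchIn v i , v , π-in i , πuv (is? (proj₁ (∧-split g))) , proj₂ (∧-split g)

      to-contracted : ∀ {x y} → π x ≢ π y → A x y ≡ true → A' (π x) (π y) ≡ true
      to-contracted {x} {y} n e = cong₂ _∧_ (isn't n) (go (in-π x) (in-π y))
        where
        px = punchIn v (π x)
        py = punchIn v (π y)
        go : (x ≡ v × px ≡ u) ⊎ px ≡ x → (y ≡ v × py ≡ u) ⊎ py ≡ y →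
             A px py ∨ (⌊ px ≟ u ⌋ ∧ A v py) ∨ (⌊ py ≟ u ⌋ ∧ A px v) ≡ true
        go (inj₁ (_ , p)) (inj₁ (_ , q)) = ⊥-elim (n (punchIn-injective v _ _ (trans p (sym q))))
        go (inj₂ p) (inj₂ q) = cong₂ _∨_ (trans (cong₂ A p q) e) refl
        go (inj₁ (r , p)) (inj₂ q) = trans (cong (A px py ∨_) (cong (_∨ (⌊ py ≟ u ⌋ ∧ A px v))
          (cong₂ _∧_ (is p) (trans (cong₂ A (sym r) q) e)))) (∨-zeroʳ (A px py))
        go (inj₂ p) (inj₁ (r , q)) = trans (cong (A px py ∨_) (trans (cong ((⌊ px ≟ u ⌋ ∧ A v py) ∨_)
          (cong₂ _∧_ (is q) (trans (cong₂ A p (sym r)) e))) (∨-zeroʳ _))) (∨-zeroʳ (A px py))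

      flip : ∀ {i j} → A' i j ≡ true → A' j i ≡ true
      flip e with from-contracted e
      ... | n , x , y , refl , refl , f = to-contracted (n ∘ sym) (trans (A-sym y x) f)

    contracted : SimpleGraph
    contracted = record
      { graph = contractEdge m A u v ; sym = λ i j → ⇔→≡ (mk⇔ flip flip)
      ; irrefl = λ i → ∧-false (cong not (is {x = i} refl)) }

    module _ {H} (M : Model H contracted) where
      open Model M

      private
        In : Fin (size H) → Fin (suc m) → Set
        In a x = lab (π x) ≡ just a

        across : ∀ {a x y} → π x ≡ π y → In a y → G.Walk (In a) x y
        across q s with fibre q
        ... | inj₁ refl = G.nil
        ... | inj₂ e = G.edge e s

        -- An edge of the contracted graph comes from some edge above, whose first end may differ
        -- from the vertex reached so far. Both lie in one fibre, and `across` closes the gap.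
        lift : ∀ {a i j x y} → π x ≡ i → π y ≡ j → lab i ≡ just a → lab j ≡ just a →
               Core.Walk contracted (λ i → lab i ≡ just a) i j → G.Walk (In a) x y
        lift p q si sj Core.nil = across (trans p (sym q)) (trans (cong lab q) sj)
        lift p q si sj (Core.step e s w) with from-contracted e
        ... | _ , x' , y' , refl , refl , f = across p si G.+w G.step f s (lift refl q s sj w)

      uncontract : Model H whole
      uncontract = record
        { lab = lab ∘ π
        ; nonempty = λ a → punchIn v (proj₁ (nonempty a)) , trans (cong lab (π-in _)) (proj₂ (nonempty a))
        ; conn = λ a p q → lift refl refl p q (conn a p q)
        ; edge⁺ = λ e → edge' (edge⁺ e)
        ; edge⁻ = λ p q n e → edge⁻ p q n (to-contracted (λ r → n (just-injective (trans (sym p) (trans (cong lab r) q)))) e) }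
        where
        edge' : ∀ {a b} → ∃[ i ] ∃[ j ] (lab i ≡ just a × lab j ≡ just b × A' i j ≡ true) →
                ∃[ x ] ∃[ y ] (In a x × In b y × A x y ≡ true)
        edge' (i , j , p , q , e) with from-contracted e
        ... | _ , x , y , refl , refl , f = x , y , p , q , f

-- The operations are undone one at a time, starting from singleton branch sets of the minor itself.
-- Symmetry and irreflexivity are passed along because every intermediate graph has to be simple.
model : ∀ {H g} (s : ∀ i j → adj g i j ≡ adj g j i) (r : ∀ i → adj g i i ≡ false) → H ≼ g →
        Model H (record { graph = g ; sym = s ; irrefl = r })
model s r done = trivial-model _
model s r (del {A = A} v p) = undelete A s r v (model _ _ p)
model s r (con {A = A} u v n e p) = uncontract A s r u v n e (model _ _ p)

-- Decidability of triangles and thetas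

module _ (G : SimpleGraph) where

  open Core G
  open DecMem (_≟_ {size (graph G)}) using (_∈?_)

  -- A finite search space for the paths of a theta: they repeat no vertex, so their length is
  -- bounded by the size of the graph.
  lists : ℕ → List (List V)
  lists zero = [ [] ]
  lists (suc k) = [] ∷ concatMap (λ x → map (x ∷_) (lists k)) (allFin _)

  lists-complete : ∀ k (l : List V) → length l ≤ k → l ∈ lists k
  lists-complete zero [] _ = here refl
  lists-complete (suc k) [] _ = here refl
  lists-complete (suc k) (x ∷ l) (s≤s p) =
    there (∈-concatMap⁺ (λ x → map (x ∷_) (lists k))
      (lose (∈-allFin x) (∈-map⁺ (x ∷_) (lists-complete k l p))))

  lookup-injective : ∀ {l : List V} → Unique l → ∀ {i j} → lookup l i ≡ lookup l j → i ≡ j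
  lookup-injective (a ∷ u) {zero} {zero} p = refl
  lookup-injective (a ∷ u) {zero} {suc j} p = ⊥-elim (All.lookup a (∈-lookup j) p)
  lookup-injective (a ∷ u) {suc i} {zero} p = ⊥-elim (All.lookup a (∈-lookup i) (sym p))
  lookup-injective (a ∷ u) {suc i} {suc j} p = cong suc (lookup-injective u p)

  Unique⇒short : ∀ {l : List V} → Unique l → length l ≤ size (graph G)
  Unique⇒short u = injective⇒≤ (lookup-injective u)

  Consecutive? : ∀ (x y : V) l → Dec (Consecutive x y l)
  Consecutive? x y [] = no λ ()
  Consecutive? x y (z ∷ []) = no λ { (there ()) }
  Consecutive? x y (z ∷ w ∷ l) =
    map′ (λ { (inj₁ (refl , refl)) → here-xy ; (inj₂ (inj₁ (refl , refl))) → here-yx ; (inj₂ (inj₂ c)) → there c })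
         (λ { here-xy → inj₁ (refl , refl) ; here-yx → inj₂ (inj₁ (refl , refl)) ; (there c) → inj₂ (inj₂ c) })
         (((x ≟ z) ×-dec (y ≟ w)) ⊎-dec (((x ≟ w) ×-dec (y ≟ z)) ⊎-dec Consecutive? x y (w ∷ l)))

  NonEmpty? : ∀ (l : List V) → Dec (NonEmpty l)
  NonEmpty? [] = no λ ()
  NonEmpty? (x ∷ l) = yes (x , l , refl)

  HasTriangle? : Dec (HasTriangle G)
  HasTriangle? = any? λ x → any? λ y → any? λ z →
    ¬? (x ≟ y) ×-dec ¬? (y ≟ z) ×-dec ¬? (x ≟ z) ×-dec
    (_ Bool.≟ _) ×-dec (_ Bool.≟ _) ×-dec (_ Bool.≟ _)

  any-list? : ∀ {P : List V → Set} → (∀ l → Dec (P l)) → (∀ {l} → P l → length l ≤ size (graph G)) → Dec (∃[ l ] P l)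
  any-list? {P} P? b =
    map′ (λ a → proj₁ (find a) , proj₂ (proj₂ (find a)))
         (λ (l , p) → lose (lists-complete _ l (b p)) p)
         (Any.any? P? (lists (size (graph G))))

  private
    open DecUnique (_≟_ {size (graph G)}) using (unique?)

    suffix-unique : ∀ (xs : List V) {ys} → Unique (xs ++ ys) → Unique ys
    suffix-unique [] u = u
    suffix-unique (x ∷ xs) (_ ∷ u) = suffix-unique xs u

    part : ∀ (xs ys zs : List V) → Unique (xs ++ ys ++ zs) → length ys ≤ size (graph G)
    part xs ys zs u = ≤-trans (m≤m+n _ (length zs))
      (≤-trans (≤-reflexive (sym (length-++ ys))) (Unique⇒short (suffix-unique xs u)))

  HasTheta? : Dec (HasTheta G)
  HasTheta? = any? λ a → any? λ b → any-list? (P? a b) (λ {p} (q , r , _ , _ , _ , u , _) → part (a ∷ b ∷ []) p (q ++ r) u)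
    where
    D? : ∀ a b p q r x y → Dec (Consecutive x y (a ∷ p ++ [ b ]) ⊎ Consecutive x y (a ∷ q ++ [ b ])
           ⊎ Consecutive x y (a ∷ r ++ [ b ]))
    D? a b p q r x y = Consecutive? x y _ ⊎-dec (Consecutive? x y _ ⊎-dec Consecutive? x y _)
    R? : ∀ a b p q r → Dec _
    R? a b p q r =
      NonEmpty? p ×-dec NonEmpty? q ×-dec NonEmpty? r ×-dec unique? (a ∷ b ∷ p ++ q ++ r) ×-dec
      all? λ x → all? λ y → (x ∈? (a ∷ b ∷ p ++ q ++ r)) →-dec ((y ∈? (a ∷ b ∷ p ++ q ++ r)) →-dec
        (((adj (graph G) x y Bool.≟ true) →-dec D? a b p q r x y) ×-dec
         (D? a b p q r x y →-dec (adj (graph G) x y Bool.≟ true))))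
    last-short : ∀ a b p q r → Unique (a ∷ b ∷ p ++ q ++ r) → length r ≤ size (graph G)
    last-short a b p q r u = ≤-trans (m≤n+m _ (length q)) (≤-trans (≤-reflexive (sym (length-++ q)))
      (Unique⇒short (suffix-unique (a ∷ b ∷ p) u)))
    Q? : ∀ a b p q → Dec _
    Q? a b p q = any-list? (R? a b p q) (λ {r} (_ , _ , _ , u , _) → last-short a b p q r u)
    P? : ∀ a b p → Dec _
    P? a b p = any-list? (Q? a b p) (λ {q} (r , _ , _ , _ , u , _) → part (a ∷ b ∷ p) q r u)

  -- A decidable disjunction is stable under double negation.
  by-contradiction : (¬ HasTriangle G → ¬ HasTheta G → ⊥) → HasTriangle G ⊎ HasTheta G
  by-contradiction f = decidable-stable (HasTriangle? ⊎-dec HasTheta?)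
    λ n → f (n ∘ inj₁) (n ∘ inj₂)

  -- Thetas from three walks in separated sets

  module Thetas where

    Ind⇒Consecutive : ∀ {l x y} → Ind l → x ∈ l → y ∈ l → x ~ y → Consecutive x y l
    Ind⇒Consecutive one (here refl) (here refl) e = ⊥-elim (~-irr e)
    Ind⇒Consecutive (cons _ f i) (here refl) (here refl) e = ⊥-elim (~-irr e)
    Ind⇒Consecutive (cons _ f i) (here refl) (there (here refl)) e = here-xy
    Ind⇒Consecutive (cons _ f i) (here refl) (there (there p)) e = ⊥-elim (proj₂ (f p) e)
    Ind⇒Consecutive (cons _ f i) (there (here refl)) (here refl) e = here-yx
    Ind⇒Consecutive (cons _ f i) (there (there p)) (here refl) e = ⊥-elim (proj₂ (f p) (~-sym e))
    Ind⇒Consecutive (cons _ f i) (there p) (there q) e = there (Ind⇒Consecutive i p q e)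

    Consecutive⇒~ : ∀ {l x y} → Ind l → Consecutive x y l → x ~ y
    Consecutive⇒~ (cons e _ _) here-xy = e
    Consecutive⇒~ (cons e _ _) here-yx = ~-sym e
    Consecutive⇒~ (cons _ _ i) (there c) = Consecutive⇒~ i c

    Ind⇒Unique : ∀ {l} → Ind l → Unique l
    Ind⇒Unique one = [] ∷ []
    Ind⇒Unique i@(cons e f j) = tabulate (headSp i) ∷ Ind⇒Unique j

    Consecutive-∈ : ∀ {l : List V} {x y} → Consecutive x y l → x ∈ l × y ∈ l
    Consecutive-∈ here-xy = here refl , there (here refl)
    Consecutive-∈ here-yx = there (here refl) , here refl
    Consecutive-∈ (there c) = there (proj₁ (Consecutive-∈ c)) , there (proj₂ (Consecutive-∈ c))

    unsnoc : ∀ a x l → ∃[ i ] (x ∷ l ≡ i ++ [ end a (x ∷ l) ])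
    unsnoc a x [] = [] , refl
    unsnoc a x (y ∷ l) with unsnoc x y l
    ... | i , q = x ∷ i , cong (x ∷_) q

    record IPath⁺ (S : Pred) (a b : V) : Set where
      field
        inner   : List V
        ind⁺    : Ind (a ∷ inner ++ [ b ])
        nonempty : NonEmpty inner
        sub⁺    : ∀ {z} → z ∈ inner → S z × z ≢ a × z ≢ b
    open IPath⁺

    -- Separated ends force an inner vertex, which is the length condition in the definition of a
    -- theta.
    extract⁺ : ∀ {S a b} → Sp a b → Walk S a b → IPath⁺ S a b
    extract⁺ {S} {a} sp w with extract w
    ... | ipath [] i refl s = ⊥-elim (proj₁ sp refl)
    ... | ipath (x ∷ l) i refl s with unsnoc a x l
    ...   | [] , q = ⊥-elim (proj₂ sp (subst (a ~_) (hd q) (Ind-adj [] i)))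
      where
      hd : ∀ {y z : V} {l} → y ∷ l ≡ [ z ] → y ≡ z
      hd refl = refl
    ...   | y ∷ j , q = record
      { inner = y ∷ j ; ind⁺ = i' ; nonempty = y , j , refl
      ; sub⁺ = λ {z} m → s (subst (z ∈_) (sym q) (∈-++⁺ˡ m)) , headSp i' (∈-++⁺ˡ m) ∘ sym ,
                   λ { refl → proj₁ (Ind-∉ (a ∷ y ∷ j) {ys = []} i') (there m) } }
      where
      i' : Ind (a ∷ (y ∷ j) ++ [ end x l ])
      i' = subst (λ z → Ind (a ∷ z)) q i

    Disj-++ : ∀ {xs ys : List V} → (∀ {u v} → u ∈ xs → v ∈ ys → u ≢ v) → Unique xs → Unique ys → Unique (xs ++ ys)
    Disj-++ d p q = ++⁺ p q (λ (a , b) → d a b refl)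

    -- The walks may be arbitrary: each is shortened to an induced path within its own set, which
    -- removes chords along a path, and the separation of the sets excludes edges between paths. The
    -- ends are exempted from the separation so that the sets may contain them.
    theta : ∀ {c c'} → Sp c c' → (S : Fin 3 → Pred) → (∀ j → Walk (S j) c c') →
            (∀ {j k} → j ≢ k → ∀ {u v} → S j u → S k v → u ≢ c → u ≢ c' → v ≢ c → v ≢ c' → Sp u v) →
            HasTheta G
    theta {c} {c'} sp S W sep =
      c , c' , ℓ 0F , ℓ 1F , ℓ 2F , nonempty (P 0F) , nonempty (P 1F) , nonempty (P 2F) , uniq ,
      λ x y x∈ y∈ → adj⇒ x y (locate x∈) (locate y∈) , ⇒adj x y
      where
      P : ∀ j → IPath⁺ (S j) c c'
      P j = extract⁺ sp (W j)
      ℓ : Fin 3 → List V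
      ℓ j = inner (P j)
      T : Fin 3 → List V
      T j = c ∷ ℓ j ++ [ c' ]
      cross : ∀ {j k} → j ≢ k → Sep (_∈ ℓ j) (_∈ ℓ k)
      cross n u v with sub⁺ (P _) u | sub⁺ (P _) v
      ... | a , b , d | a' , b' , d' = sep n a a' b d b' d'
      inner-uniq : ∀ j → Unique (ℓ j)
      inner-uniq j with Ind⇒Unique (ind⁺ (P j))
      ... | _ ∷ u = front u
        where
        front : ∀ {xs z} → Unique (xs ++ [ z ]) → Unique xs
        front {[]} u = []
        front {x ∷ xs} (a ∷ u) = tabulate (λ {v} m → lookup' a (∈-++⁺ˡ m)) ∷ front u
          where
          open import Data.List.Relation.Unary.All using () renaming (lookup to lookup')
      uniq : Unique (c ∷ c' ∷ ℓ 0F ++ ℓ 1F ++ ℓ 2F)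
      uniq = tabulate (λ { (here refl) → proj₁ sp ; (there m) → proj₁ (away m) ∘ sym }) ∷
             tabulate (λ m → proj₂ (away m) ∘ sym) ∷
             Disj-++ (λ u v → proj₁ ([ (λ m → cross (λ ()) u m) , (λ m → cross (λ ()) u m) ]′ (∈-++⁻ (ℓ 1F) v)))
               (inner-uniq 0F)
               (Disj-++ (λ u v → proj₁ (cross (λ ()) u v)) (inner-uniq 1F) (inner-uniq 2F))
        where
        away : ∀ {v} → v ∈ ℓ 0F ++ ℓ 1F ++ ℓ 2F → v ≢ c × v ≢ c'
        away m with ∈-++⁻ (ℓ 0F) m
        ... | inj₁ p = proj₂ (sub⁺ (P 0F) p)
        ... | inj₂ q with ∈-++⁻ (ℓ 1F) q
        ...   | inj₁ p = proj₂ (sub⁺ (P 1F) p)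
        ...   | inj₂ p = proj₂ (sub⁺ (P 2F) p)
      -- The two ends lie on all three paths and an inner vertex on one of them. An edge from an end
      -- to an inner vertex can thus be judged on the path of the latter.
      Loc : V → Set
      Loc x = (∀ j → x ∈ T j) ⊎ ∃[ j ] (x ∈ ℓ j)
      locate : ∀ {x} → x ∈ c ∷ c' ∷ ℓ 0F ++ ℓ 1F ++ ℓ 2F → Loc x
      locate (here refl) = inj₁ λ j → here refl
      locate (there (here refl)) = inj₁ λ j → there (∈-++⁺ʳ (ℓ j) (here refl))
      locate (there (there m)) with ∈-++⁻ (ℓ 0F) m
      ... | inj₁ p = inj₂ (0F , p)
      ... | inj₂ q with ∈-++⁻ (ℓ 1F) q
      ...   | inj₁ p = inj₂ (1F , p)
      ...   | inj₂ p = inj₂ (2F , p)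
      D : V → V → Set
      D x y = Consecutive x y (T 0F) ⊎ Consecutive x y (T 1F) ⊎ Consecutive x y (T 2F)
      pick : ∀ {x y} j → Consecutive x y (T j) → D x y
      pick 0F = inj₁
      pick 1F = inj₂ ∘ inj₁
      pick 2F = inj₂ ∘ inj₂
      on : ∀ {x y} j → x ∈ T j → y ∈ T j → x ~ y → D x y
      on j p q e = pick j (Ind⇒Consecutive (ind⁺ (P j)) p q e)
      inT : ∀ {x} j → x ∈ ℓ j → x ∈ T j
      inT j m = there (∈-++⁺ˡ m)
      adj⇒ : ∀ x y → Loc x → Loc y → x ~ y → D x y
      adj⇒ x y (inj₁ f) (inj₁ g) e = on 0F (f 0F) (g 0F) e
      adj⇒ x y (inj₁ f) (inj₂ (j , m)) e = on j (f j) (inT j m) e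
      adj⇒ x y (inj₂ (j , m)) (inj₁ g) e = on j (inT j m) (g j) e
      adj⇒ x y (inj₂ (j , m)) (inj₂ (k , m')) e with j ≟ k
      ... | yes refl = on j (inT j m) (inT j m') e
      ... | no n = ⊥-elim (proj₂ (cross n m m') e)
      ⇒adj : ∀ x y → D x y → x ~ y
      ⇒adj x y (inj₁ d) = Consecutive⇒~ (ind⁺ (P 0F)) d
      ⇒adj x y (inj₂ (inj₁ d)) = Consecutive⇒~ (ind⁺ (P 1F)) d
      ⇒adj x y (inj₂ (inj₂ d)) = Consecutive⇒~ (ind⁺ (P 2F)) d

  open Thetas using (theta)

  -- Paths with a single contact at either end

  Nb : Pred → Pred
  Nb S v = ∃[ s ] (S s × s ~ v)

  Nb? : ∀ {S : Pred} → (∀ v → Dec (S v)) → ∀ v → Dec (Nb S v)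
  Nb? S? v = any? λ s → S? s ×-dec (s ~? v)

  -- With `F` and `L` the neighbourhoods of two sets, uniqueness makes `x` and `y` the only contacts
  -- of `Q` with these sets, as a linkage demands.
  record Link (S F L : Pred) : Set₁ where
    field
      x y    : V
      Q      : Pred
      Q⊂     : ∀ {v} → Q v → S v
      x∈     : Q x
      y∈     : Q y
      Fx     : F x
      Ly     : L y
      only-x : ∀ {v} → Q v → F v → v ≡ x
      only-y : ∀ {v} → Q v → L v → v ≡ y
      conn   : Conn Q

    walk : Walk Q x y
    walk = conn x∈ y∈

  trivial-link : ∀ {S F L : Pred} {v} → S v → F v → L v → Link S F L
  trivial-link {v = v} s f l = record
    { x = v ; y = v ; Q = v ≡_ ; Q⊂ = λ { refl → s } ; x∈ = refl ; y∈ = refl ; Fx = f ; Ly = l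
    ; only-x = λ { refl _ → refl } ; only-y = λ { refl _ → refl } ; conn = λ { refl refl → nil } }

  -- One pass is not enough, because a walk may return to `F` before it reaches `L`. So the walk is
  -- followed to its first vertex `t` in `L`, and then back from `t` to the first vertex in `F`.
  link : ∀ {S F L : Pred} → (∀ v → Dec (F v)) → (∀ v → Dec (L v)) → ∀ {f l} → S f → F f → L l → Walk S f l → Link S F L
  link {S} {F} {L} F? L? {f} Sf Ff Ll w with firstHit L L? Sf Ll w
  ... | t , St , Lt , inj₁ refl = trivial-link Sf Ff Lt
  ... | t , St , Lt , inj₂ (¬Lf , p , u , e , Sp' , ¬Lp) =
        back (firstHit F F? {a = t} {b = f} (inj₂ refl) Ff
          (step (~-sym e) (inj₁ (Sp' , ¬Lp)) (revW (mapW inj₁ u) (inj₁ (Sf , ¬Lf)))))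
    where
    S₁ : Pred
    S₁ v = (S v × ¬ L v) ⊎ v ≡ t
    back : ∃[ t' ] (S₁ t' × F t' × (t' ≡ t ⊎ (¬ F t × ∃[ p ] (Walk (λ v → S₁ v × ¬ F v) t p × p ~ t' × S₁ p × ¬ F p)))) →
           Link S F L
    back (t' , S₁t' , Ft' , inj₁ refl) = trivial-link St Ft' Lt
    back (t' , inj₂ refl , Ft' , inj₂ (¬Ft , _)) = ⊥-elim (¬Ft Ft')
    back (t' , inj₁ (St' , ¬Lt') , Ft' , inj₂ (¬Ft , p' , u' , e' , S₁p' , ¬Fp')) = along
      (extract (step (~-sym e') (inQ (S₁p' , ¬Fp')) (revW (mapW inQ u') (inj₁ refl))))
      where
      Q : Pred
      Q v = v ≡ t ⊎ v ≡ t' ⊎ (S v × ¬ L v × ¬ F v)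
      inQ : ∀ {v} → S₁ v × ¬ F v → Q v
      inQ (inj₁ (s , n) , m) = inj₂ (inj₂ (s , n , m))
      inQ (inj₂ q , m) = inj₁ q
      along : IPath Q t' t → Link S F L
      along (ipath l i q sub) = record
        { x = t' ; y = t ; Q = _∈ t' ∷ l ; Q⊂ = [ (λ { refl → St }) , [ (λ { refl → St' }) , proj₁ ]′ ]′ ∘ sub'
        ; x∈ = here refl ; y∈ = subst (_∈ t' ∷ l) q (end∈ t' l) ; Fx = Ft' ; Ly = Lt
        ; only-x = λ m → fx (sub' m) ; only-y = λ m → ly (sub' m) ; conn = Ind-conn i }
        where
        sub' : ∀ {v} → v ∈ t' ∷ l → Q v
        sub' (here refl) = inj₂ (inj₁ refl)
        sub' (there m) = sub m
        fx : ∀ {v} → Q v → F v → v ≡ t'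
        fx (inj₁ refl) Fv = ⊥-elim (¬Ft Fv)
        fx (inj₂ (inj₁ q)) _ = q
        fx (inj₂ (inj₂ (_ , _ , n))) Fv = ⊥-elim (n Fv)
        ly : ∀ {v} → Q v → L v → v ≡ t
        ly (inj₁ q) _ = q
        ly (inj₂ (inj₁ refl)) Lv = ⊥-elim (¬Lt' Lv)
        ly (inj₂ (inj₂ (_ , n , _))) Lv = ⊥-elim (n Lv)

  module _ (noTri : ¬ HasTriangle G) where

    -- Claws inside connected sets

    no-triangle : ∀ {x y z} → x ~ y → y ~ z → x ~ z → ⊥
    no-triangle p q r = noTri (_ , _ , _ , ~⇒≢ p , ~⇒≢ q , ~⇒≢ r , p , q , r)

    ⟨_,_,_⟩ : ∀ {ℓ} {A : Set ℓ} → A → A → A → Fin 3 → A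
    ⟨ a , b , c ⟩ 0F = a
    ⟨ a , b , c ⟩ 1F = b
    ⟨ a , b , c ⟩ 2F = c

    sep3 : {R : Fin 3 → Pred} → Sep (R 0F) (R 1F) → Sep (R 0F) (R 2F) → Sep (R 1F) (R 2F) →
           ∀ {j k} → j ≢ k → Sep (R j) (R k)
    sep3 a b c {0F} {0F} n = ⊥-elim (n refl)
    sep3 a b c {0F} {1F} n = a
    sep3 a b c {0F} {2F} n = b
    sep3 a b c {1F} {0F} n = λ x y → Sp-sym (a y x)
    sep3 a b c {1F} {1F} n = ⊥-elim (n refl)
    sep3 a b c {1F} {2F} n = c
    sep3 a b c {2F} {0F} n = λ x y → Sp-sym (b y x)
    sep3 a b c {2F} {1F} n = λ x y → Sp-sym (c y x)
    sep3 a b c {2F} {2F} n = ⊥-elim (n refl)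

    all3 : ∀ {ℓ} {P : Fin 3 → Set ℓ} → P 0F → P 1F → P 2F → ∀ j → P j
    all3 a b c 0F = a
    all3 a b c 1F = b
    all3 a b c 2F = c

    -- a subdivided claw (legs may be trivial) with the given ends inside W
    record Center (W : Pred) (p : Fin 3 → V) : Set₁ where
      field
        c     : V
        c∈    : W c
        L     : Fin 3 → Pred
        L⊂    : ∀ j {v} → L j v → W v
        c∉L   : ∀ j → ¬ L j c
        L-sep : ∀ {j k} → j ≢ k → Sep (L j) (L k)
        leg   : ∀ j → Walk (L j) c (p j)

      end∈L : ∀ j → c ≢ p j → L j (p j)
      end∈L j n = endW (leg j) n

      -- The vertex `p k` is the centre or lies on leg `k`, and both are disjoint from leg `j`.
      L-other : ∀ {j k} → j ≢ k → ¬ L j (p k)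
      L-other {j} {k} n l with c ≟ p k
      ... | yes q = c∉L j (subst (L j) (sym q) l)
      ... | no q = proj₁ (L-sep n l (end∈L k q)) refl

    data Head (x : V) : List V → Set where
      head : ∀ {l} → Head x (x ∷ l)

    data Last (x : V) : List V → Set where
      last : Last x [ x ]
      skip : ∀ {y l} → Last x l → Last x (y ∷ l)

    end-Last : ∀ a l → Last (end a l) (a ∷ l)
    end-Last a [] = last
    end-Last a (x ∷ l) = skip (end-Last x l)

    Head-∈ : ∀ {p} pre {a post} → Head p (pre ++ a ∷ post) → p ∈ pre ++ [ a ]
    Head-∈ [] head = here refl
    Head-∈ (x ∷ pre) head = here refl

    Last-∈ : ∀ {p} pre {a post} → Last p (pre ++ a ∷ post) → p ∈ a ∷ post
    Last-∈ [] last = here refl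
    Last-∈ [] (skip l) = there (g l)
      where
      g : ∀ {p l} → Last p l → p ∈ l
      g last = here refl
      g (skip l) = there (g l)
    Last-∈ (x ∷ []) (skip l) = Last-∈ [] l
    Last-∈ (x ∷ y ∷ pre) (skip l) = Last-∈ (y ∷ pre) l

    walkPost : ∀ {a post p} → Ind (a ∷ post) → p ∈ post → Walk (_∈ post) a p
    walkPost (cons e f i) m = step e (here refl) (Ind-conn i (here refl) m)

    walkPre : ∀ pre {a post p} → Ind (pre ++ a ∷ post) → p ∈ pre → Walk (_∈ pre) a p
    walkPre (x ∷ []) (cons e f i) (here refl) = edge (~-sym e) (here refl)
    walkPre (x ∷ x' ∷ pre) (cons e f i) (here refl) =
      mapW there (walkPre (x' ∷ pre) i (here refl)) +w edge (~-sym e) (here refl)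
    walkPre (x ∷ x' ∷ pre) (cons e f i) (there m) = mapW there (walkPre (x' ∷ pre) i m)

    module _ {W : Pred} {p₀ p₁ p₂ : V} where

      onPath : ∀ pre {post} → Ind (pre ++ p₁ ∷ post) → (∀ {z} → z ∈ pre ++ p₁ ∷ post → W z) →
               Head p₀ (pre ++ p₁ ∷ post) → Last p₂ (pre ++ p₁ ∷ post) → Center W ⟨ p₀ , p₁ , p₂ ⟩
      onPath pre {post} i w h l = record
        { c = p₁ ; c∈ = w (∈-++⁺ʳ pre (here refl)) ; L = ⟨ _∈ pre , (λ _ → ⊥) , _∈ post ⟩
        ; L⊂ = all3 (λ m → w (∈-++⁺ˡ m)) (λ ()) (λ m → w (∈-++⁺ʳ pre (there m)))
        ; c∉L = all3 (proj₁ (Ind-∉ pre i)) (λ ()) (proj₂ (Ind-∉ pre i))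
        ; L-sep = sep3 (λ _ ()) (Ind-gap pre i) (λ ())
        ; leg = all3 (a (∈-++⁻ pre (Head-∈ pre h))) nil (b (Last-∈ pre l)) }
        where
        a : p₀ ∈ pre ⊎ p₀ ∈ [ p₁ ] → Walk (_∈ pre) p₁ p₀
        a (inj₁ m) = walkPre pre i m
        a (inj₂ (here refl)) = nil
        b : p₂ ∈ p₁ ∷ post → Walk (_∈ post) p₁ p₂
        b (here refl) = nil
        b (there m) = walkPost (Ind-suffix pre i) m

      module _ {d : V} {T : Pred} (Wd : W d) (T⊂ : ∀ {v} → T v → W v) (d∉T : ¬ T d) (t : Walk T d p₁) where

        -- The legs enter the path at the first contact `a` and the last contact `b`, and the part
        -- between them is dropped. That part is not empty, since otherwise `d`, `a` and `b` form a
        -- triangle; hence the two remaining pieces are separated.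
        viaTwo : ∀ pre {a} mid {b post} → let l = pre ++ a ∷ mid ++ b ∷ post in
                 Ind l → (∀ {z} → z ∈ l → W z) → d ∉ l → Sep T (_∈ l) → Head p₀ l → Last p₂ l →
                 d ~ a → d ~ b → (∀ {z} → z ∈ pre → ¬ (d ~ z)) → (∀ {z} → z ∈ post → ¬ (d ~ z)) →
                 Center W ⟨ p₀ , p₁ , p₂ ⟩
        viaTwo pre [] i w d∉ s h l da db n m = ⊥-elim (no-triangle da (Ind-adj pre i) db)
        viaTwo pre {a} (x ∷ mid) {b} {post} i w d∉ s h l da db n m = record
          { c = d ; c∈ = Wd ; L = ⟨ _∈ pre ++ [ a ] , T , _∈ b ∷ post ⟩
          ; L⊂ = all3 (λ z → w (inl z)) T⊂ (λ z → w (inr z))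
          ; c∉L = all3 (d∉ ∘ inl) d∉T (d∉ ∘ inr)
          ; L-sep = sep3 (λ u v → Sp-sym (s v (inl u))) (λ u v → Ind-gap (pre ++ [ a ]) i' u (∈-++⁺ʳ mid v)) (λ u v → s u (inr v))
          ; leg = all3 (step da (∈-++⁺ʳ pre (here refl)) (Ind-conn (Ind-prefix pre i) (∈-++⁺ʳ pre (here refl)) (Head-∈ pre h)))
                       t
                       (step db (here refl) (Ind-conn (Ind-suffix (pre ++ a ∷ x ∷ mid) i'') (here refl) (Last-∈ (pre ++ a ∷ x ∷ mid) l''))) }
          where
          eq'' : pre ++ a ∷ (x ∷ mid) ++ b ∷ post ≡ (pre ++ a ∷ x ∷ mid) ++ b ∷ post
          eq'' = sym (++-assoc pre (a ∷ x ∷ mid) (b ∷ post))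
          i'' = subst Ind eq'' i
          l'' = subst (Last p₂) eq'' l
          i' : Ind ((pre ++ [ a ]) ++ x ∷ (mid ++ b ∷ post))
          i' = subst Ind (sym (++-assoc pre [ a ] (x ∷ mid ++ b ∷ post))) i
          inl : ∀ {z} → z ∈ pre ++ [ a ] → z ∈ pre ++ a ∷ (x ∷ mid) ++ b ∷ post
          inl {z} m with ∈-++⁻ pre m
          ... | inj₁ q = ∈-++⁺ˡ q
          ... | inj₂ (here refl) = ∈-++⁺ʳ pre (here refl)
          inr : ∀ {z} → z ∈ b ∷ post → z ∈ pre ++ a ∷ (x ∷ mid) ++ b ∷ post
          inr m = ∈-++⁺ʳ pre (there (∈-++⁺ʳ (x ∷ mid) m))

        -- The contact `a` becomes the centre and `d` is absorbed by the middle leg.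
        viaOne : ∀ pre {a post} → let l = pre ++ a ∷ post in
                 Ind l → (∀ {z} → z ∈ l → W z) → d ∉ l → Sep T (_∈ l) → Head p₀ l → Last p₂ l →
                 d ~ a → (∀ {z} → z ∈ pre → ¬ (d ~ z)) → (∀ {z} → z ∈ post → ¬ (d ~ z)) →
                 Center W ⟨ p₀ , p₁ , p₂ ⟩
        viaOne pre {a} {post} i w d∉ s h l da n m = record
          { c = a ; c∈ = w here-a ; L = ⟨ _∈ pre , (T ∪ (d ≡_)) , _∈ post ⟩
          ; L⊂ = all3 (w ∘ inl) [ T⊂ , (λ { refl → Wd }) ]′ (w ∘ inr)
          ; c∉L = all3 (proj₁ (Ind-∉ pre i))
                       (λ { (inj₁ x) → proj₁ (s x here-a) refl ; (inj₂ refl) → d∉ here-a })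
                       (proj₂ (Ind-∉ pre i))
          ; L-sep = sep3 (λ { u (inj₁ x) → Sp-sym (s x (inl u)) ; u (inj₂ refl) → (λ { refl → d∉ (inl u) }) , n u ∘ ~-sym })
                         (Ind-gap pre i)
                         (λ { (inj₁ x) v → s x (inr v) ; (inj₂ refl) v → (λ { refl → d∉ (inr v) }) , m v })
          ; leg = all3 (x (∈-++⁻ pre (Head-∈ pre h))) (step (~-sym da) (inj₂ refl) (mapW inj₁ t)) (y (Last-∈ pre l)) }
          where
          here-a : a ∈ pre ++ a ∷ post
          here-a = ∈-++⁺ʳ pre (here refl)
          inl : ∀ {z} → z ∈ pre → z ∈ pre ++ a ∷ post
          inl = ∈-++⁺ˡ
          inr : ∀ {z} → z ∈ post → z ∈ pre ++ a ∷ post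
          inr = ∈-++⁺ʳ pre ∘ there
          x : p₀ ∈ pre ⊎ p₀ ∈ [ a ] → Walk (_∈ pre) a p₀
          x (inj₁ q) = walkPre pre i q
          x (inj₂ (here refl)) = nil
          y : p₂ ∈ a ∷ post → Walk (_∈ post) a p₂
          y (here refl) = nil
          y (there q) = walkPost (Ind-suffix pre i) q

    -- Here `d` stands for the first vertex touching the path on a walk from `v` towards it, and `T`
    -- for the vertices passed before `d`.
    record Attach (W : Pred) (l : List V) (v : V) : Set₁ where
      field
        d    : V
        d∉   : d ∉ l
        d∈   : W d
        z    : V
        z∈   : z ∈ l
        d~z  : d ~ z
        T    : Pred
        T⊂   : ∀ {u} → T u → W u
        far  : Sep T (_∈ l)
        path : Walk T d v

    attach : ∀ {W : Pred} {l v p} → p ∈ l → v ∉ l → W v → Walk W v p → Attach W l v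
    attach p∈ v∉ Wv nil = ⊥-elim (v∉ p∈)
    attach {W} {l} {v} p∈ v∉ Wv (step {b = b} e s w) with contacts (λ u → v ~? u) l
    ... | one pre a post c _ _ = record
      { d = v ; d∉ = v∉ ; d∈ = Wv ; z = a ; z∈ = ∈-++⁺ʳ pre (here refl) ; d~z = c
      ; T = λ _ → ⊥ ; T⊂ = λ () ; far = λ () ; path = nil }
    ... | two pre a _ _ _ c _ _ _ = record
      { d = v ; d∉ = v∉ ; d∈ = Wv ; z = a ; z∈ = ∈-++⁺ʳ pre (here refl) ; d~z = c
      ; T = λ _ → ⊥ ; T⊂ = λ () ; far = λ () ; path = nil }
    ... | none n = record
      { d = d ; d∉ = d∉ ; d∈ = d∈ ; z = z ; z∈ = z∈ ; d~z = d~z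
      ; T = T ∪ (v ≡_) ; T⊂ = [ T⊂ , (λ { refl → Wv }) ]′
      ; far = λ { (inj₁ t) m → far t m ; (inj₂ refl) m → (λ { refl → v∉ m }) , n m }
      ; path = mapW inj₁ path +w edge (~-sym e) (inj₂ refl) }
      where open Attach (attach p∈ (λ b∈ → n b∈ e) s w)

    -- An induced path joins `p₀` to `p₂`. Either `p₁` is on it and is the centre, or `p₁` is led
    -- towards it and the first vertex touching the path has one contact or several.
    center : ∀ {W : Pred} {p₀ p₁ p₂} → W p₀ → W p₁ → Walk W p₀ p₂ → Walk W p₁ p₀ → Center W ⟨ p₀ , p₁ , p₂ ⟩
    center {W} {p₀} {p₁} W₀ W₁ w u with extract w
    ... | ipath l i refl s with p₁ ∈? (p₀ ∷ l)
    ...   | no p₁∉ with attach (here refl) p₁∉ W₁ u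
    ...     | at = go (p₀ ∷ l) i inW d∉ (far) head (end-Last p₀ l) z∈ (contacts (λ v → d ~? v) (p₀ ∷ l))
      where
      open Attach at
      inW : ∀ {z} → z ∈ p₀ ∷ l → W z
      inW (here refl) = W₀
      inW (there m) = s m
      d∉T : ¬ T d
      d∉T t = proj₂ (far t z∈) d~z
      go : ∀ l' → Ind l' → (∀ {z} → z ∈ l' → W z) → d ∉ l' → Sep T (_∈ l') → Head p₀ l' → Last (end p₀ l) l' →
           z ∈ l' → Contacts (d ~_) l' → Center W ⟨ p₀ , p₁ , end p₀ l ⟩
      go l' i w d∉ f h e z∈ (none n) = ⊥-elim (n z∈ d~z)
      go _ i w d∉ f h e z∈ (one pre a post c n m) = viaOne d∈ T⊂ d∉T path pre i w d∉ f h e c n m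
      go _ i w d∉ f h e z∈ (two pre a mid b post c c' n m) = viaTwo d∈ T⊂ d∉T path pre mid i w d∉ f h e c c' n m
    center {W} {p₀} {p₁} W₀ W₁ w u | ipath l i refl s | yes p₁∈ with ∈-∃++ p₁∈
    ... | pre , post , q = onPath pre (subst Ind q i) (λ {z} m → inW (subst (z ∈_) (sym q) m))
                             (subst (Head p₀) q head) (subst (Last _) q (end-Last p₀ l))
      where
      inW : ∀ {z} → z ∈ p₀ ∷ l → W z
      inW (here refl) = W₀
      inW (there m) = s m

    connected-center : ∀ {W : Pred} → Conn W → (p : Fin 3 → V) → (∀ j → W (p j)) → Center W p
    connected-center cn p Wp = record
      { c = c ; c∈ = c∈ ; L = L ; L⊂ = L⊂ ; c∉L = c∉L ; L-sep = L-sep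
      ; leg = all3 (leg 0F) (leg 1F) (leg 2F) }
      where open Center (center (Wp 0F) (Wp 1F) (cn (Wp 0F) (Wp 2F)) (cn (Wp 1F) (Wp 0F)))

    permute : ∀ {W p} → Center W p → (σ : Fin 3 → Fin 3) → (∀ {j k} → σ j ≡ σ k → j ≡ k) → Center W (p ∘ σ)
    permute C σ inj = record
      { c = c ; c∈ = c∈ ; L = L ∘ σ ; L⊂ = L⊂ ∘ σ ; c∉L = c∉L ∘ σ ; L-sep = λ n → L-sep (n ∘ inj) ; leg = leg ∘ σ }
      where open Center C

    -- either the end is kept, or the leg is prolonged by a vertex outside W
    extend : ∀ {W W' : Pred} {p x : Fin 3 → V} → (∀ {v} → W v → W' v) → (∀ j → W' (x j)) →
             (∀ {j k} → j ≢ k → Sp (x j) (x k)) →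
             (∀ j → x j ≡ p j ⊎ (¬ W (x j) × p j ~ x j × (∀ {w} → W w → w ~ x j → w ≡ p j))) →
             Center W p → Center W' x
    extend {W} {W'} {p} {x} W⊂ x∈ xx att C = record
      { c = c ; c∈ = W⊂ c∈ ; L = L' ; L⊂ = λ j → [ W⊂ ∘ L⊂ j , (λ { (refl , _) → x∈ j }) ]′
      ; c∉L = λ j → [ c∉L j , (λ (_ , n) → n refl) ]′ ; L-sep = sep ; leg = leg' }
      where
      open Center C
      L' : Fin 3 → Pred
      L' j v = L j v ⊎ (v ≡ x j × v ≢ c)
      Lx : ∀ {j k} → j ≢ k → ∀ {u v} → L j u → v ≡ x k × v ≢ c → Sp u v
      Lx {j} {k} n {u} l (refl , nc) with att k
      ... | inj₁ e = L-sep n l (subst (L k) (sym e) (end∈L k (λ q → nc (trans e (sym q)))))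
      ... | inj₂ (∉ , e , only) = (λ { refl → ∉ (L⊂ j l) }) , λ a → L-other n (subst (L j) (only (L⊂ j l) a) l)
      sep : ∀ {j k} → j ≢ k → Sep (L' j) (L' k)
      sep n (inj₁ l) (inj₁ m) = L-sep n l m
      sep n (inj₁ l) (inj₂ q) = Lx n l q
      sep n (inj₂ q) (inj₁ m) = Sp-sym (Lx (n ∘ sym) m q)
      sep n (inj₂ (refl , _)) (inj₂ (refl , _)) = xx n
      leg' : ∀ j → Walk (L' j) c (x j)
      leg' j with att j
      ... | inj₁ e = mapW inj₁ (subst (Walk (L j) c) (sym e) (leg j))
      ... | inj₂ (∉ , e , _) = mapW inj₁ (leg j) +w edge e (inj₂ (refl , λ { refl → ∉ c∈ }))

    module _ {W : Pred} {p₀ d p₂ : V} (l : List V) (i : Ind l) (w : ∀ {z} → z ∈ l → W z) (Wd : W d) (d∉ : d ∉ l)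
             (h : Head p₀ l) (e : Last p₂ l) where

      -- The position of the centre is recorded because later arguments exclude one of the
      -- alternatives: `d` itself, which then has two nonadjacent contacts, or the only contact of
      -- `d`.
      path-center : ∀ {z} → z ∈ l → d ~ z → Σ (Center W ⟨ p₀ , d , p₂ ⟩) λ C →
        (Center.c C ≡ d × ∃[ a ] ∃[ b ] (a ∈ l × b ∈ l × Sp a b × d ~ a × d ~ b)) ⊎
        (Center.c C ∈ l × (∀ {v} → v ∈ l → d ~ v → v ≡ Center.c C))
      path-center z∈ d~z = go l i w d∉ h e z∈ (contacts (λ v → d ~? v) l)
        where
        go : ∀ l → Ind l → (∀ {z} → z ∈ l → W z) → d ∉ l → Head p₀ l → Last p₂ l → _ ∈ l → Contacts (d ~_) l →
             Σ (Center W ⟨ p₀ , d , p₂ ⟩) λ C →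
             (Center.c C ≡ d × ∃[ a ] ∃[ b ] (a ∈ l × b ∈ l × Sp a b × d ~ a × d ~ b)) ⊎
             (Center.c C ∈ l × (∀ {v} → v ∈ l → d ~ v → v ≡ Center.c C))
        go l i w d∉ h e z∈ (none n) = ⊥-elim (n z∈ d~z)
        go _ i w d∉ h e z∈ (one pre a post c n m) =
          viaOne {T = λ _ → ⊥} Wd (λ ()) (λ ()) nil pre i w d∉ (λ ()) h e c n m ,
          inj₂ (∈-++⁺ʳ pre (here refl) , only)
          where
          only : ∀ {v} → v ∈ pre ++ a ∷ post → d ~ v → v ≡ a
          only v∈ e with ∈-++⁻ pre v∈
          ... | inj₁ q = ⊥-elim (n q e)
          ... | inj₂ (here q) = q
          ... | inj₂ (there q) = ⊥-elim (m q e)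
        go _ i w d∉ h e z∈ (two pre a [] b post c c' n m) = ⊥-elim (no-triangle c (Ind-adj pre i) c')
        go _ i w d∉ h e z∈ (two pre a (x ∷ mid) b post c c' n m) =
          viaTwo {T = λ _ → ⊥} Wd (λ ()) (λ ()) nil pre (x ∷ mid) i w d∉ (λ ()) h e c c' n m ,
          inj₁ (refl , a , b , ∈-++⁺ʳ pre (here refl) , ∈-++⁺ʳ pre (there (∈-++⁺ʳ (x ∷ mid) (here refl))) ,
                (a≢b , λ x → no-triangle c x c') , c , c')
          where
          a≢b : a ≢ b
          a≢b refl = proj₂ (Ind-∉ pre i) (∈-++⁺ʳ (x ∷ mid) (here refl))

    -- the terminals p lie outside A
    _⊕_ : Pred → (Fin 3 → V) → Pred
    (A ⊕ p) v = A v ⊎ ∃[ j ] (v ≡ p j)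

    module _ {A : Pred} {p : Fin 3 → V} (C : Center (A ⊕ p) p) where
      open Center C

      L-inside : ∀ {j v} → L j v → A v ⊎ v ≡ p j
      L-inside {j} l with L⊂ j l
      ... | inj₁ a = inj₁ a
      ... | inj₂ (k , refl) with j ≟ k
      ...   | yes refl = inj₂ refl
      ...   | no n = ⊥-elim (L-other n l)

      -- The other two legs start at `p j`. As the terminals are pairwise separated, the first steps
      -- of these legs lead into `A`, and the legs are separated from each other.
      two-neighbours : (∀ {j k} → j ≢ k → Sp (p j) (p k)) → ∀ j → c ≡ p j →
        ∃[ a ] ∃[ b ] (A a × A b × Sp a b × p j ~ a × p j ~ b)
      two-neighbours ind j q = go (others j)
        where
        others : ∀ j → ∃[ k ] ∃[ l ] (k ≢ j × l ≢ j × k ≢ l)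
        others 0F = 1F , 2F , (λ ()) , (λ ()) , (λ ())
        others 1F = 0F , 2F , (λ ()) , (λ ()) , (λ ())
        others 2F = 0F , 1F , (λ ()) , (λ ()) , (λ ())
        nbr : ∀ k → k ≢ j → ∃[ a ] (A a × L k a × p j ~ a)
        nbr k n with firstStep (leg k) (λ r → proj₁ (ind n) (trans (sym r) q))
        ... | a , e , l with L-inside l
        ...   | inj₁ x = a , x , l , subst (_~ a) q e
        ...   | inj₂ refl = ⊥-elim (proj₂ (ind (n ∘ sym)) (subst (_~ a) q e))
        go : (∃[ k ] ∃[ l ] (k ≢ j × l ≢ j × k ≢ l)) → _
        go (k , l , nk , nl , n) with nbr k nk | nbr l nl
        ... | a , Aa , la , ea | b , Ab , lb , eb = a , b , Aa , Ab , L-sep n la lb , ea , eb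

    -- Minimal columns

    private
      Sub = Subset (size (graph G))

    ∈-remove⁻ : ∀ {B : Sub} {y v} → v ∈ₛ B -ₛ y → v ∈ₛ B
    ∈-remove⁻ {B} {y} = p─q⊆p B ⁅ y ⁆

    ∈-remove-≢ : ∀ {B : Sub} {y v} → v ∈ₛ B -ₛ y → v ≢ y
    ∈-remove-≢ {B} {y} m refl = proj₂ (x∈p─q⁻ B m)
      where
      open import Data.Fin.Subset using (_─_)
      x∈p─q⁻ : ∀ (B : Sub) → y ∈ₛ B ─ ⁅ y ⁆ → y ∈ₛ B × ⊥
      x∈p─q⁻ B m = p─q⊆p B ⁅ y ⁆ m , g B y m
        where
        g : ∀ {n} (B : Subset n) (y : Fin n) → y ∈ₛ B ─ ⁅ y ⁆ → ⊥
        g (inside Vec.∷ B) zero ()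
        g (outside Vec.∷ B) zero ()
        g (b Vec.∷ B) (suc y) (Vec.there m) = g B y m

    crossing : ∀ {B : Pred} (S : Sub) {a b} → Walk B a b → a ∈ₛ S → b ∉ₛ S → ∃[ p ] ∃[ t ] (p ∈ₛ S × p ~ t × B t × t ∉ₛ S)
    crossing S nil a b = ⊥-elim (b a)
    crossing S (step {b = x} e s w) a b with x ∈ₛ? S
    ... | yes m = crossing S w m b
    ... | no m = _ , x , a , e , s , m

    -- grow a connected subset until only one vertex is missing
    non-cut : ∀ (B S : Sub) → Acc _⊃ₛ_ S → Conn (_∈ₛ B) → Conn (_∈ₛ S) → (∀ {v} → v ∈ₛ S → v ∈ₛ B) →
              ∀ {s b} → s ∈ₛ S → b ∈ₛ B → b ∉ₛ S → ∃[ z ] (z ∈ₛ B × z ∉ₛ S × Conn (_∈ₛ B -ₛ z))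
    non-cut B S (acc rec) cB cS S⊆B {s} s∈ b∈ b∉ with crossing S (cB (S⊆B s∈) b∈) s∈ b∉
    ... | p , t , p∈ , e , t∈ , t∉ with any? (λ x → (x ∈ₛ? B) ×-dec ¬? (x ∈ₛ? (S ∪ₛ ⁅ t ⁆)))
    ...   | no empty = t , t∈ , t∉ , λ a b → mapW back (cS (inS a) (inS b))
      where
      back : ∀ {v} → v ∈ₛ S → v ∈ₛ B -ₛ t
      back m = x∈p∧x≢y⇒x∈p-y (S⊆B m) λ { refl → t∉ m }
      inS : ∀ {v} → v ∈ₛ B -ₛ t → v ∈ₛ S
      inS {v} m with v ∈ₛ? (S ∪ₛ ⁅ t ⁆)
      ... | no n = ⊥-elim (empty (v , ∈-remove⁻ m , n))
      ... | yes q with x∈p∪q⁻ S ⁅ t ⁆ q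
      ...   | inj₁ r = r
      ...   | inj₂ r = ⊥-elim (∈-remove-≢ m (x∈⁅y⁆⇒x≡y t r))
    ...   | yes (x , x∈ , x∉) with non-cut B (S ∪ₛ ⁅ t ⁆) (rec ((λ m → old m) , t , new , t∉)) cB conn' sub' (old s∈) x∈ x∉
      where
      old : ∀ {v} → v ∈ₛ S → v ∈ₛ S ∪ₛ ⁅ t ⁆
      old m = x∈p∪q⁺ (inj₁ m)
      new : t ∈ₛ S ∪ₛ ⁅ t ⁆
      new = x∈p∪q⁺ {p = S} (inj₂ (x∈⁅x⁆ t))
      sub' : ∀ {v} → v ∈ₛ S ∪ₛ ⁅ t ⁆ → v ∈ₛ B
      sub' m with x∈p∪q⁻ S ⁅ t ⁆ m
      ... | inj₁ r = S⊆B r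
      ... | inj₂ r = subst (_∈ₛ B) (sym (x∈⁅y⁆⇒x≡y t r)) t∈
      conn' : Conn (_∈ₛ S ∪ₛ ⁅ t ⁆)
      conn' a b with x∈p∪q⁻ S ⁅ t ⁆ a | x∈p∪q⁻ S ⁅ t ⁆ b
      ... | inj₁ a' | inj₁ b' = mapW old (cS a' b')
      ... | inj₁ a' | inj₂ b' with x∈⁅y⁆⇒x≡y t b'
      ...   | refl = mapW old (cS a' p∈) +w edge e new
      conn' a b | inj₂ a' | inj₁ b' with x∈⁅y⁆⇒x≡y t a'
      ...   | refl = step (~-sym e) (old p∈) (mapW old (cS p∈ b'))
      conn' a b | inj₂ a' | inj₂ b' with x∈⁅y⁆⇒x≡y t a' | x∈⁅y⁆⇒x≡y t b'
      ...   | refl | refl = nil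
    ...     | z , z∈ , z∉ , c = z , z∈ , (λ m → z∉ (x∈p∪q⁺ (inj₁ m))) , c

    Small : Pred → Set
    Small S = ∀ {u v} → S u → S v → u ≡ v ⊎ u ~ v

    record Shape (S : Pred) (Rγ : Pred) (a b : V) : Set where
      constructor path
      field
        ℓ    : List V
        indℓ : Ind (a ∷ ℓ)
        endℓ : end a ℓ ≡ b
        S⇒ℓ  : ∀ {v} → S v → v ∈ a ∷ ℓ
        ℓ⇒S  : ∀ {v} → v ∈ a ∷ ℓ → S v

    -- The outcome of shrinking: `a` and `b` are the single contacts of rows `α` and `β`, while `g`
    -- is some contact of the remaining row `γ`. The second alternative of `kind` describes a far
    -- column, which is an induced path or has `g` as its only contact with `γ`.
    record Column (R : Fin 3 → Pred) (B : Pred) : Set₁ where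
      field
        S      : Pred
        S?     : ∀ v → Dec (S v)
        S⊂     : ∀ {v} → S v → B v
        conn   : Conn S
        α β γ  : Fin 3
        α≢β    : α ≢ β
        γ≢α    : γ ≢ α
        γ≢β    : γ ≢ β
        a b g  : V
        Sa     : S a
        Sb     : S b
        Sg     : S g
        Ra     : R α a
        Rb     : R β b
        Rg     : R γ g
        only-a : ∀ {v} → S v → R α v → v ≡ a
        only-b : ∀ {v} → S v → R β v → v ≡ b
        kind   : Small S ⊎ (Sp a b × (Shape S (R γ) a b ⊎ (∀ {v} → S v → R γ v → v ≡ g)))

    module _ {R : Fin 3 → Pred} (R? : ∀ i v → Dec (R i v)) where

      single : ∀ {B : Sub} {y} → y ∈ₛ B → (∀ i → R i y) → Column R (_∈ₛ B)
      single {B} {y} y∈ r = record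
        { S = _≡ y ; S? = _≟ y ; S⊂ = λ { refl → y∈ } ; conn = λ { refl refl → nil }
        ; α = zero ; β = suc zero ; γ = suc (suc zero) ; α≢β = λ () ; γ≢α = λ () ; γ≢β = λ ()
        ; a = y ; b = y ; g = y ; Sa = refl ; Sb = refl ; Sg = refl ; Ra = r _ ; Rb = r _ ; Rg = r _
        ; only-a = λ q _ → q ; only-b = λ q _ → q ; kind = inj₁ λ { refl refl → inj₁ refl } }

      Sees : Sub → Set
      Sees B = ∀ i → ∃[ v ] (v ∈ₛ B × R i v)

      sees? : ∀ B → Dec (Sees B)
      sees? B = all? λ i → any? λ v → (v ∈ₛ? B) ×-dec R? i v

      -- A row that disappears with `y` had no contact other than `y`.
      private-row : ∀ {B : Sub} {y} → Sees B → ¬ Sees (B -ₛ y) →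
                    ∃[ α ] (R α y × (∀ {v} → v ∈ₛ B → R α v → v ≡ y))
      private-row {B} {y} s n with ¬∀⟶∃¬ 3 _ (λ i → any? λ v → (v ∈ₛ? (B -ₛ y)) ×-dec R? i v) n
      ... | α , m = α , subst (R α) (only (proj₁ (proj₂ (s α))) (proj₂ (proj₂ (s α)))) (proj₂ (proj₂ (s α))) , only
        where
        only : ∀ {v} → v ∈ₛ B → R α v → v ≡ y
        only {v} v∈ r with v ≟ y
        ... | yes q = q
        ... | no q = ⊥-elim (m (v , x∈p∧x≢y⇒x∈p-y v∈ q , r))

      weaken : ∀ {B B' : Sub} → (∀ {v} → v ∈ₛ B' → v ∈ₛ B) → Column R (_∈ₛ B') → Column R (_∈ₛ B)
      weaken f c = record { Column c ; S⊂ = f ∘ Column.S⊂ c }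

      -- y is the centre of a star containing B, hence B = {y, v}
      star : ∀ {B : Sub} {y v α} → y ∈ₛ B → v ∈ₛ B → v ≢ y → Conn (_∈ₛ B) → Conn (_∈ₛ B -ₛ y) → Sees B →
             R α y → (∀ {u} → u ∈ₛ B → R α u → u ≡ y) → (∀ {u} → u ∈ₛ B → u ≢ y → u ~ y) → Column R (_∈ₛ B)
      star {B} {y} {v} {α} y∈ v∈ v≢y cB c s rα only adjy with all? (λ i → R? i y)
      ... | yes r = single y∈ r
      ... | no n with ¬∀⟶∃¬ 3 _ (λ i → R? i y) n
      ...   | β , nβ = record
        { S = _∈ₛ B ; S? = _∈ₛ? B ; S⊂ = id ; conn = cB
        ; α = α ; β = β ; γ = proj₁ γ' ; α≢β = α≢β ; γ≢α = proj₁ (proj₂ γ') ; γ≢β = proj₂ (proj₂ γ')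
        ; a = y ; b = v ; g = proj₁ (s _) ; Sa = y∈ ; Sb = v∈ ; Sg = proj₁ (proj₂ (s _))
        ; Ra = rα ; Rb = subst (R β) (isv (proj₁ (proj₂ (s β))) (proj₂ (proj₂ (s β)))) (proj₂ (proj₂ (s β)))
        ; Rg = proj₂ (proj₂ (s _)) ; only-a = only ; only-b = isv ; kind = inj₁ small }
        where
        same : ∀ {u w} → u ∈ₛ B → u ≢ y → w ∈ₛ B → w ≢ y → u ≡ w
        same {u} {w} u∈ nu w∈ nw with u ≟ w
        ... | yes q = q
        ... | no q with firstStep (c (x∈p∧x≢y⇒x∈p-y u∈ nu) (x∈p∧x≢y⇒x∈p-y w∈ nw)) q
        ...   | t , e , t∈ = ⊥-elim (no-triangle e (adjy (∈-remove⁻ t∈) (∈-remove-≢ t∈)) (adjy u∈ nu))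
        isv : ∀ {u} → u ∈ₛ B → R β u → u ≡ v
        isv {u} u∈ r with u ≟ y
        ... | yes refl = ⊥-elim (nβ r)
        ... | no q = same u∈ q v∈ v≢y
        small : Small (_∈ₛ B)
        small {u} {w} u∈ w∈ with u ≟ y | w ≟ y
        ... | yes refl | yes refl = inj₁ refl
        ... | yes refl | no q = inj₂ (~-sym (adjy w∈ q))
        ... | no p | yes refl = inj₂ (adjy u∈ p)
        ... | no p | no q = inj₁ (same u∈ p w∈ q)
        α≢β : α ≢ β
        α≢β refl = nβ rα
        γ' = third α≢β

      -- If the induced path from `y` to `z` sees row `γ`, it is the column. Otherwise a second path
      -- is added from `y` up to the first contact `t` with `γ`; nothing before `t` sees `γ`, so the
      -- contact is unique.
      far : ∀ {B : Sub} {y z α β} → y ∈ₛ B → z ∈ₛ B → Sp y z → Conn (_∈ₛ B) → Sees B →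
            R α y → (∀ {u} → u ∈ₛ B → R α u → u ≡ y) → R β z → (∀ {u} → u ∈ₛ B → R β u → u ≡ z) → Column R (_∈ₛ B)
      far {B} {y} {z} {α} {β} y∈ z∈ sp cB s rα onlyα rβ onlyβ = go (extract (cB y∈ z∈))
        where
        α≢β : α ≢ β
        α≢β refl = proj₁ sp (sym (onlyα z∈ rβ))
        γ : Fin 3
        γ = proj₁ (third α≢β)
        γ≢ = proj₂ (third α≢β)
        go : IPath (_∈ₛ B) y z → Column R (_∈ₛ B)
        go (ipath l i q inB) with Any.any? (λ v → R? γ v) (y ∷ l)
        ... | yes m = record
          { S = _∈ y ∷ l ; S? = _∈? (y ∷ l) ; S⊂ = inB' ; conn = Ind-conn i
          ; α = α ; β = β ; γ = γ ; α≢β = α≢β ; γ≢α = proj₁ γ≢ ; γ≢β = proj₂ γ≢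
          ; a = y ; b = z ; g = proj₁ (find m) ; Sa = here refl ; Sb = subst (_∈ y ∷ l) q (end∈ y l)
          ; Sg = proj₁ (proj₂ (find m)) ; Ra = rα ; Rb = rβ ; Rg = proj₂ (proj₂ (find m))
          ; only-a = onlyα ∘ inB' ; only-b = onlyβ ∘ inB'
          ; kind = inj₂ (sp , inj₁ (path l i q id id)) }
          where
          inB' : ∀ {v} → v ∈ y ∷ l → v ∈ₛ B
          inB' (here refl) = y∈
          inB' (there m) = inB m
        ... | no n with firstHit (R γ) (R? γ) y∈ (proj₂ (proj₂ (s γ))) (cB y∈ (proj₁ (proj₂ (s γ))))
        ...   | t , t∈ , Rt , inj₁ refl = ⊥-elim (n (here Rt))
        ...   | t , t∈ , Rt , inj₂ (_ , p , w , e , p∈ , ¬Rp) with extract w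
        ...     | ipath l' i' q' inB'' = record
          { S = S ; S? = λ v → (v ∈? (y ∷ l)) ⊎-dec ((v ∈? (y ∷ l')) ⊎-dec (v ≟ t)) ; S⊂ = S⊂ ; conn = λ u v → toy u +w revW (toy v) v
          ; α = α ; β = β ; γ = γ ; α≢β = α≢β ; γ≢α = proj₁ γ≢ ; γ≢β = proj₂ γ≢
          ; a = y ; b = z ; g = t ; Sa = inj₁ (here refl) ; Sb = inj₁ (subst (_∈ y ∷ l) q (end∈ y l))
          ; Sg = inj₂ (inj₂ refl) ; Ra = rα ; Rb = rβ ; Rg = Rt
          ; only-a = onlyα ∘ S⊂ ; only-b = onlyβ ∘ S⊂
          ; kind = inj₂ (sp , inj₂ only-t) }
          where
          S : Pred
          S v = v ∈ y ∷ l ⊎ v ∈ y ∷ l' ⊎ v ≡ t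
          S⊂ : ∀ {v} → S v → v ∈ₛ B
          S⊂ (inj₁ (here refl)) = y∈
          S⊂ (inj₁ (there m)) = inB m
          S⊂ (inj₂ (inj₁ (here refl))) = y∈
          S⊂ (inj₂ (inj₁ (there m))) = proj₁ (inB'' m)
          S⊂ (inj₂ (inj₂ refl)) = t∈
          toy : ∀ {v} → S v → Walk S v y
          toy (inj₁ m) = mapW inj₁ (Ind-conn i m (here refl))
          toy (inj₂ (inj₁ m)) = mapW (inj₂ ∘ inj₁) (Ind-conn i' m (here refl))
          toy (inj₂ (inj₂ refl)) = step (~-sym e) (inj₂ (inj₁ p∈l')) (mapW (inj₂ ∘ inj₁) (Ind-conn i' p∈l' (here refl)))
            where
            p∈l' : p ∈ y ∷ l'
            p∈l' = subst (_∈ y ∷ l') q' (end∈ y l')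
          only-t : ∀ {v} → S v → R γ v → v ≡ t
          only-t (inj₁ m) r = ⊥-elim (n (lose m r))
          only-t (inj₂ (inj₁ (here refl))) r = ⊥-elim (n (here r))
          only-t (inj₂ (inj₁ (there m))) r = ⊥-elim (proj₂ (inB'' m) r)
          only-t (inj₂ (inj₂ q)) r = q

      -- Descent on the set: a non-cut vertex whose removal loses no row is removed. When this is
      -- impossible, `star` or `far` applies.
      column : ∀ (B : Sub) → Acc _⊂ₛ_ B → Conn (_∈ₛ B) → Sees B → Column R (_∈ₛ B)
      column B (acc rec) cB s with s zero
      ... | v , v∈ , _ with any? (λ x → (x ∈ₛ? B) ×-dec ¬? (x ≟ v))
      ...   | no empty = single v∈ λ i → let (u , u∈ , r) = s i in subst (R i) (eq u∈) r
        where
        eq : ∀ {u} → u ∈ₛ B → u ≡ v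
        eq {u} u∈ with u ≟ v
        ... | yes q = q
        ... | no q = ⊥-elim (empty (u , u∈ , q))
      ...   | yes (b , b∈ , b≢v) with non-cut B ⁅ v ⁆ (⊃-wellFounded _) cB
                (λ a b → subst (λ u → Walk _ u _) (sym (x∈⁅y⁆⇒x≡y v a)) (subst (Walk _ v) (sym (x∈⁅y⁆⇒x≡y v b)) nil))
                (λ m → subst (_∈ₛ B) (sym (x∈⁅y⁆⇒x≡y v m)) v∈) (x∈⁅x⁆ v) b∈ (λ m → b≢v (x∈⁅y⁆⇒x≡y v m))
      ...     | y , y∈ , y∉ , cy with sees? (B -ₛ y)
      ...       | yes s' = weaken ∈-remove⁻ (column (B -ₛ y) (rec (x∈p⇒p-x⊂p y∈)) cy s')
      ...       | no n with private-row s n | any? (λ x → (x ∈ₛ? B) ×-dec ¬? ((x ≟ y) ⊎-dec (x ~? y)))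
      ...         | α , rα , onlyα | no empty = star y∈ v∈ (λ { refl → y∉ (x∈⁅x⁆ v) }) cB cy s rα onlyα adjy
        where
        adjy : ∀ {u} → u ∈ₛ B → u ≢ y → u ~ y
        adjy {u} u∈ n with u ~? y
        ... | yes e = e
        ... | no e = ⊥-elim (empty (u , u∈ , [ n , e ]′))
      -- Growing from the closed neighbourhood of `y` yields a second non-cut vertex `z` outside it,
      -- so `y` and `z` are separated.
      ...         | α , rα , onlyα | yes (x , x∈ , x∉) with non-cut B (comprehend N?) (⊃-wellFounded _) cB connN
                      (λ m → proj₁ (∈-comprehend⁻ N? m)) (∈-comprehend⁺ N? (y∈ , inj₁ refl)) x∈ (λ m → x∉ (proj₂ (∈-comprehend⁻ N? m)))
        where
        N? : ∀ x → Dec (x ∈ₛ B × (x ≡ y ⊎ x ~ y))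
        N? x = (x ∈ₛ? B) ×-dec ((x ≟ y) ⊎-dec (x ~? y))
        y∈N = ∈-comprehend⁺ N? (y∈ , inj₁ refl)
        toy : ∀ {u} → u ∈ₛ comprehend N? → Walk (_∈ₛ comprehend N?) u y
        toy m with ∈-comprehend⁻ N? m
        ... | _ , inj₁ refl = nil
        ... | _ , inj₂ e = edge e y∈N
        connN : Conn (_∈ₛ comprehend N?)
        connN a b = toy a +w revW (toy b) b
      ...           | z , z∈ , z∉ , cz with sees? (B -ₛ z)
      ...             | yes s' = weaken ∈-remove⁻ (column (B -ₛ z) (rec (x∈p⇒p-x⊂p z∈)) cz s')
      ...             | no n' with private-row s n'
      ...               | β , rβ , onlyβ = far y∈ z∈ sp cB s rα onlyα rβ onlyβ
        where
        sp : Sp y z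
        sp = (λ { refl → z∉ (∈-comprehend⁺ N?' (z∈ , inj₁ refl)) }) , λ e → z∉ (∈-comprehend⁺ N?' (z∈ , inj₂ (~-sym e)))
          where
          N?' : ∀ x → Dec (x ∈ₛ B × (x ≡ y ⊎ x ~ y))
          N?' x = (x ∈ₛ? B) ×-dec ((x ≟ y) ⊎-dec (x ~? y))

    module _ (noTheta : ¬ HasTheta G) where

      -- Two sets joined by three paths

      record Linkage (A A' : Pred) (Q : Fin 3 → Pred) (x y : Fin 3 → V) : Set where
        field
          x∈   : ∀ j → Q j (x j)
          y∈   : ∀ j → Q j (y j)
          walk : ∀ j → Walk (Q j) (x j) (y j)
          QQ   : ∀ {j k} → j ≢ k → Sep (Q j) (Q k)
          AA'  : Sep A A'
          AQ   : ∀ k {a v} → A a → Q k v → v ≡ x k ⊎ Sp a v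
          A'Q  : ∀ k {a v} → A' a → Q k v → v ≡ y k ⊎ Sp a v

      module _ {A A' : Pred} {Q : Fin 3 → Pred} {x y : Fin 3 → V} (ℒ : Linkage A A' Q x y)
               (C : Center (A ⊕ x) x) (C' : Center (A' ⊕ y) y) where
        open Linkage ℒ
        open Center C
        open Center C' using () renaming (c to c'; L to L'; c∉L to c'∉L'; L-sep to L'-sep; leg to leg'; end∈L to end∈L')

        private
          S : Fin 3 → Pred
          S j = L j ∪ (Q j ∪ (L' j ∪ (c' ≡_)))

          -- The one vertex of `Q k` that may touch `A` is `x k`. Unless it is the centre, it ends
          -- leg `k` and is therefore separated from leg `j`.
          L-Q : ∀ {j k} → j ≢ k → ∀ {u v} → L j u → Q k v → v ≢ c → Sp u v
          L-Q {j} {k} n l q v≢c with L-inside C l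
          ... | inj₂ refl = QQ n (x∈ j) q
          ... | inj₁ z with AQ k z q
          ...   | inj₁ refl = L-sep n l (end∈L k (v≢c ∘ sym))
          ...   | inj₂ s = s

          L'-Q : ∀ {j k} → j ≢ k → ∀ {u v} → L' j u → Q k v → v ≢ c' → Sp u v
          L'-Q {j} {k} n l q v≢c' with L-inside C' l
          ... | inj₂ refl = QQ n (y∈ j) q
          ... | inj₁ z with A'Q k z q
          ...   | inj₁ refl = L'-sep n l (end∈L' k (v≢c' ∘ sym))
          ...   | inj₂ s = s

          L-L' : ∀ {j k} → j ≢ k → ∀ {u v} → L j u → L' k v → u ≢ c' → v ≢ c → Sp u v
          L-L' {j} {k} n l l' u≢c' v≢c with L-inside C' l'
          ... | inj₂ refl = L-Q n l (y∈ k) v≢c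
          ... | inj₁ z' with L-inside C l
          ...   | inj₁ z = AA' z z'
          ...   | inj₂ refl = Sp-sym (L'-Q (n ∘ sym) l' (x∈ j) u≢c')

          sep : ∀ {j k} → j ≢ k → ∀ {u v} → S j u → S k v → u ≢ c → u ≢ c' → v ≢ c → v ≢ c' → Sp u v
          sep n (inj₁ l) (inj₁ m) _ _ _ _ = L-sep n l m
          sep n (inj₁ l) (inj₂ (inj₁ q)) _ _ d _ = L-Q n l q d
          sep n (inj₁ l) (inj₂ (inj₂ (inj₁ m))) _ b d _ = L-L' n l m b d
          sep n (inj₂ (inj₁ q)) (inj₁ l) a _ _ _ = Sp-sym (L-Q (n ∘ sym) l q a)
          sep n (inj₂ (inj₁ q)) (inj₂ (inj₁ q')) _ _ _ _ = QQ n q q'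
          sep n (inj₂ (inj₁ q)) (inj₂ (inj₂ (inj₁ l))) _ b _ _ = Sp-sym (L'-Q (n ∘ sym) l q b)
          sep n (inj₂ (inj₂ (inj₁ l))) (inj₁ m) a _ _ e = Sp-sym (L-L' (n ∘ sym) m l e a)
          sep n (inj₂ (inj₂ (inj₁ l))) (inj₂ (inj₁ q)) _ _ _ e = L'-Q n l q e
          sep n (inj₂ (inj₂ (inj₁ l))) (inj₂ (inj₂ (inj₁ m))) _ _ _ _ = L'-sep n l m
          sep n (inj₂ (inj₂ (inj₂ refl))) _ _ b _ _ = ⊥-elim (b refl)
          sep n _ (inj₂ (inj₂ (inj₂ refl))) _ _ _ e = ⊥-elim (e refl)

        -- This is the form in which the theta construction is applied: a contradiction follows as
        -- soon as the two centres are located in separated places.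
        centers-meet : c ≡ c' ⊎ c ~ c'
        centers-meet with Sp? c c'
        ... | inj₂ r = r
        ... | inj₁ s = ⊥-elim (noTheta (theta s S walks sep))
          where
          walks : ∀ j → Walk (S j) c c'
          walks j = mapW inj₁ (leg j) +w mapW (inj₂ ∘ inj₁) (walk j) +w
            revW (mapW f (leg' j)) (inj₂ (inj₂ (inj₂ refl)))
            where
            f : ∀ {v} → L' j v → S j v
            f = inj₂ ∘ inj₂ ∘ inj₁

      -- Two rows and two columns with unique contacts

      -- two legs of a claw centred at q
      record Hub (R : Pred) (q v₁ v₂ : V) : Set₁ where
        field
          L₁ L₂ : Pred
          in₁   : ∀ {v} → L₁ v → R v ⊎ v ≡ v₁
          in₂   : ∀ {v} → L₂ v → R v ⊎ v ≡ v₂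
          apart : Sep L₁ L₂
          to₁   : Walk L₁ q v₁
          to₂   : Walk L₂ q v₂
          v₁∈L  : L₁ v₁
          v₂∈L  : L₂ v₂

      hub : ∀ {R p} (C : Center (R ⊕ p) p) {j k} → j ≢ k → Center.c C ≢ p j → Center.c C ≢ p k → Hub R (Center.c C) (p j) (p k)
      hub C {j} {k} n nj nk = record
        { L₁ = L j ; L₂ = L k ; in₁ = L-inside C ; in₂ = L-inside C ; apart = L-sep n
        ; to₁ = leg j ; to₂ = leg k ; v₁∈L = end∈L j nj ; v₂∈L = end∈L k nk }
        where open Center C

      hub-swap : ∀ {R q v₁ v₂} → Hub R q v₁ v₂ → Hub R q v₂ v₁
      hub-swap h = record
        { L₁ = L₂ ; L₂ = L₁ ; in₁ = in₂ ; in₂ = in₁ ; apart = λ u v → Sp-sym (apart v u)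
        ; to₁ = to₂ ; to₂ = to₁ ; v₁∈L = v₂∈L ; v₂∈L = v₁∈L }
        where open Hub h

      -- The vertices `v₁` and `v₂` are the only contacts of row `R` with the two columns, `w₁` and
      -- `w₂` those of `R'`. The third set `C` joins the columns and may touch them anywhere.
      record Square (R R' C B₁ B₂ : Pred) (v₁ w₁ v₂ w₂ : V) : Set where
        field
          RR' : Sep R R'
          RC  : Sep R C
          R'C : Sep R' C
          BB  : Sep B₁ B₂
          cR  : Conn R
          cR' : Conn R'
          cC  : Conn C
          cB₁ : Conn B₁
          cB₂ : Conn B₂
          v₁∈ : B₁ v₁
          w₁∈ : B₁ w₁
          v₂∈ : B₂ v₂
          w₂∈ : B₂ w₂
          Rv₁ : ∃[ r ] (R r × r ~ v₁)
          Rv₂ : ∃[ r ] (R r × r ~ v₂)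
          Rw₁ : ∃[ r ] (R' r × r ~ w₁)
          Rw₂ : ∃[ r ] (R' r × r ~ w₂)
          CB₁ : ∃[ c ] ∃[ b ] (C c × B₁ b × c ~ b)
          CB₂ : ∃[ c ] ∃[ b ] (C c × B₂ b × c ~ b)
          R≢₁ : ∀ {u v} → R u → B₁ v → u ≢ v
          R≢₂ : ∀ {u v} → R u → B₂ v → u ≢ v
          S≢₁ : ∀ {u v} → R' u → B₁ v → u ≢ v
          S≢₂ : ∀ {u v} → R' u → B₂ v → u ≢ v
          C≢₁ : ∀ {u v} → C u → B₁ v → u ≢ v
          C≢₂ : ∀ {u v} → C u → B₂ v → u ≢ v
          R₁  : ∀ {u v} → R u → B₁ v → u ~ v → v ≡ v₁
          R₂  : ∀ {u v} → R u → B₂ v → u ~ v → v ≡ v₂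
          S₁  : ∀ {u v} → R' u → B₁ v → u ~ v → v ≡ w₁
          S₂  : ∀ {u v} → R' u → B₂ v → u ~ v → v ≡ w₂

      swapC : ∀ {R R' C B₁ B₂ v₁ w₁ v₂ w₂} → Square R R' C B₁ B₂ v₁ w₁ v₂ w₂ → Square R R' C B₂ B₁ v₂ w₂ v₁ w₁
      swapC s = record
        { RR' = RR' ; RC = RC ; R'C = R'C ; BB = λ u v → Sp-sym (BB v u) ; cR = cR ; cR' = cR' ; cC = cC
        ; cB₁ = cB₂ ; cB₂ = cB₁ ; v₁∈ = v₂∈ ; w₁∈ = w₂∈ ; v₂∈ = v₁∈ ; w₂∈ = w₁∈
        ; Rv₁ = Rv₂ ; Rv₂ = Rv₁ ; Rw₁ = Rw₂ ; Rw₂ = Rw₁ ; CB₁ = CB₂ ; CB₂ = CB₁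
        ; R≢₁ = R≢₂ ; R≢₂ = R≢₁ ; S≢₁ = S≢₂ ; S≢₂ = S≢₁ ; C≢₁ = C≢₂ ; C≢₂ = C≢₁
        ; R₁ = R₂ ; R₂ = R₁ ; S₁ = S₂ ; S₂ = S₁ }
        where open Square s

      swapR : ∀ {R R' C B₁ B₂ v₁ w₁ v₂ w₂} → Square R R' C B₁ B₂ v₁ w₁ v₂ w₂ → Square R' R C B₁ B₂ w₁ v₁ w₂ v₂
      swapR s = record
        { RR' = λ u v → Sp-sym (RR' v u) ; RC = R'C ; R'C = RC ; BB = BB ; cR = cR' ; cR' = cR ; cC = cC
        ; cB₁ = cB₁ ; cB₂ = cB₂ ; v₁∈ = w₁∈ ; w₁∈ = v₁∈ ; v₂∈ = w₂∈ ; w₂∈ = v₂∈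
        ; Rv₁ = Rw₁ ; Rv₂ = Rw₂ ; Rw₁ = Rv₁ ; Rw₂ = Rv₂ ; CB₁ = CB₁ ; CB₂ = CB₂
        ; R≢₁ = S≢₁ ; R≢₂ = S≢₂ ; S≢₁ = R≢₁ ; S≢₂ = R≢₂ ; C≢₁ = C≢₁ ; C≢₂ = C≢₂
        ; R₁ = S₁ ; R₂ = S₂ ; S₁ = R₁ ; S₂ = R₂ }
        where open Square s

      -- Each vertex keeps the walk that led to it. This shows that parts defined by reachability
      -- are connected.
      trackW : ∀ {P : Pred} {a b} → Walk P a b → Walk (λ v → P v × Walk P a v) a b
      trackW {P} {a} w = go nil w
        where
        go : ∀ {x b} → Walk P a x → Walk P x b → Walk (λ v → P v × Walk P a v) x b
        go u nil = nil
        go u (step e p w) = step e (p , (u +w edge e p)) (go (u +w edge e p) w)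

      -- What is left when the two centres meet at an end of the third path: `q` is this end and the
      -- centre of one claw, and `c'`, the centre of the other, is equal or adjacent to it.
      record Seat : Set₁ where
        field
          {R R' C B₁ B₂} : Pred
          {v₁ w₁ v₂ w₂ q c'} : V
          □    : Square R R' C B₁ B₂ v₁ w₁ v₂ w₂
          q₁   : ∀ {v} → B₁ v → Sp q v
          q₂   : ∀ {v} → B₂ v → Sp q v
          qC   : ∀ {v} → C v → Sp q v
          h    : Hub R q v₁ v₂
          h'   : Hub R' c' w₁ w₂
          near : c' ≡ q ⊎ (q ~ c' × (∀ v → Hub.L₁ h' v → Sp q v) × (∀ v → Hub.L₂ h' v → Sp q v) ×
                   (R' c' ⊎ ((∀ v → B₁ v → Sp c' v) × (∀ v → B₂ v → Sp c' v) × (∀ v → C v → Sp c' v) × (∀ v → R v → Sp c' v))))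

      seat-swap : Seat → Seat
      seat-swap s = record
        { □ = swapC □ ; q₁ = q₂ ; q₂ = q₁ ; qC = qC ; h = hub-swap h ; h' = hub-swap h'
        ; near = [ inj₁ , (λ { (e , a , b , inj₁ r) → inj₂ (e , b , a , inj₁ r)
                             ; (e , a , b , inj₂ (x , y , z)) → inj₂ (e , b , a , inj₂ (y , x , z)) }) ]′ near }
        where open Seat s

      module _ (s : Seat) where
        open Seat s
        open Square □
        open Hub h
        open Hub h' using () renaming (L₁ to L₁'; L₂ to L₂'; in₁ to in₁'; in₂ to in₂'; apart to apart'; to₁ to to₁'; to₂ to to₂'; v₁∈L to w₁∈L; v₂∈L to w₂∈L)

        private
          RW : ∀ {u v} → R u → B₁ v ⊎ C v ⊎ B₂ v → (v ≡ v₁ ⊎ v ≡ v₂) ⊎ Sp u v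
          RW r (inj₁ b) = [ inj₁ ∘ inj₁ , inj₂ ]′ (equal-or-Sp (R≢₁ r b) (R₁ r b))
          RW r (inj₂ (inj₁ c)) = inj₂ (RC r c)
          RW r (inj₂ (inj₂ b)) = [ inj₁ ∘ inj₂ , inj₂ ]′ (equal-or-Sp (R≢₂ r b) (R₂ r b))

          R'W : ∀ {u v} → R' u → B₁ v ⊎ C v ⊎ B₂ v → (v ≡ w₁ ⊎ v ≡ w₂) ⊎ Sp u v
          R'W r (inj₁ b) = [ inj₁ ∘ inj₁ , inj₂ ]′ (equal-or-Sp (S≢₁ r b) (S₁ r b))
          R'W r (inj₂ (inj₁ c)) = inj₂ (R'C r c)
          R'W r (inj₂ (inj₂ b)) = [ inj₁ ∘ inj₂ , inj₂ ]′ (equal-or-Sp (S≢₂ r b) (S₂ r b))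

        -- the theta joins q to the centre of a claw inside W with ends v₁, v₂, w₁
        theta-through : (W : Pred) → (∀ {v} → W v → B₁ v ⊎ C v ⊎ B₂ v) → Conn W → W v₁ → W v₂ → W w₁ →
                        (∀ {v} → W v → c' ≢ q → v ≡ w₁ ⊎ Sp c' v) → ⊥
        theta-through W W⊂ cW Wv₁ Wv₂ Ww₁ meets = noTheta (theta (Sp-sym (qW (W⊂ c∈))) S walks sep)
          where
          open Center (connected-center cW ⟨ v₁ , v₂ , w₁ ⟩ (all3 Wv₁ Wv₂ Ww₁))
          qW : ∀ {v} → B₁ v ⊎ C v ⊎ B₂ v → Sp q v
          qW = [ q₁ , [ qC , q₂ ]′ ]′
          S : Fin 3 → Pred
          S = ⟨ L 0F ∪ L₁ ∪ (q ≡_) , L 1F ∪ L₂ ∪ (q ≡_) , L 2F ∪ (L₁' ∪ (c' ≡_)) ∪ (q ≡_) ⟩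
          walks : ∀ j → Walk (S j) c q
          walks = all3 (mapW inj₁ (leg 0F) +w revW (mapW (inj₂ ∘ inj₁) to₁) (inj₂ (inj₂ refl)))
                       (mapW inj₁ (leg 1F) +w revW (mapW (inj₂ ∘ inj₁) to₂) (inj₂ (inj₂ refl)))
                       (mapW inj₁ (leg 2F) +w revW (mapW (inj₂ ∘ inj₁ ∘ inj₁) to₁') (inj₂ (inj₁ (inj₂ refl))) +w toq near)
            where
            toq : _ → Walk (S 2F) c' q
            toq (inj₁ refl) = nil
            toq (inj₂ (e , _)) = edge (~-sym e) (inj₂ (inj₂ refl))
          norm₀ : ∀ {u} → S 0F u → u ≢ c → u ≢ q → L 0F u ⊎ (L₁ u × R u)
          norm₀ (inj₁ l) a b = inj₁ l
          norm₀ (inj₂ (inj₁ l)) a b with in₁ l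
          ... | inj₁ r = inj₂ (l , r)
          ... | inj₂ refl = inj₁ (end∈L 0F (a ∘ sym))
          norm₀ (inj₂ (inj₂ refl)) a b = ⊥-elim (b refl)
          norm₁ : ∀ {u} → S 1F u → u ≢ c → u ≢ q → L 1F u ⊎ (L₂ u × R u)
          norm₁ (inj₁ l) a b = inj₁ l
          norm₁ (inj₂ (inj₁ l)) a b with in₂ l
          ... | inj₁ r = inj₂ (l , r)
          ... | inj₂ refl = inj₁ (end∈L 1F (a ∘ sym))
          norm₁ (inj₂ (inj₂ refl)) a b = ⊥-elim (b refl)
          norm₂ : ∀ {u} → S 2F u → u ≢ c → u ≢ q → L 2F u ⊎ (L₁' u × R' u) ⊎ (u ≡ c' × c' ≢ q)
          norm₂ (inj₁ l) a b = inj₁ l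
          norm₂ (inj₂ (inj₁ (inj₁ l))) a b with in₁' l
          ... | inj₁ r = inj₂ (inj₁ (l , r))
          ... | inj₂ refl = inj₁ (end∈L 2F (a ∘ sym))
          norm₂ (inj₂ (inj₁ (inj₂ refl))) a b = inj₂ (inj₂ (refl , b))
          norm₂ (inj₂ (inj₂ refl)) a b = ⊥-elim (b refl)
          LR : ∀ {j u v} → (v ≡ v₁ → Sp u v₁) → (v ≡ v₂ → Sp u v₂) → L j v → R u → Sp v u
          LR f g l r with RW r (W⊂ (L⊂ _ l))
          ... | inj₂ s = Sp-sym s
          ... | inj₁ (inj₁ refl) = Sp-sym (f refl)
          ... | inj₁ (inj₂ refl) = Sp-sym (g refl)
          -- Row `R'` meets `W` at most in `w₁`, which belongs to the third leg, and in `w₂`, which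
          -- ends the other leg of the hub and so is separated from `L₁'`.
          LR' : ∀ {j u v} → j ≢ 2F → L j v → L₁' u → R' u → Sp v u
          LR' {j} n l l' r with R'W r (W⊂ (L⊂ j l))
          ... | inj₂ s = Sp-sym s
          ... | inj₁ (inj₁ refl) = ⊥-elim (L-other n l)
          ... | inj₁ (inj₂ refl) = Sp-sym (apart' l' w₂∈L)
          Lc' : ∀ {j v} → j ≢ 2F → L j v → c' ≢ q → Sp v c'
          Lc' {j} n l ne with meets (L⊂ j l) ne
          ... | inj₁ refl = ⊥-elim (L-other n l)
          ... | inj₂ s = Sp-sym s
          Rc' : ∀ {u} → R u → c' ≢ q → Sp u c'
          Rc' r ne with near
          ... | inj₁ e = ⊥-elim (ne e)
          ... | inj₂ (_ , _ , _ , inj₁ r') = RR' r r'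
          ... | inj₂ (_ , _ , _ , inj₂ (_ , _ , _ , f)) = Sp-sym (f _ r)
          sep01 : ∀ {u v} → L 0F u ⊎ (L₁ u × R u) → L 1F v ⊎ (L₂ v × R v) → Sp u v
          sep01 (inj₁ l) (inj₁ m) = L-sep (λ ()) l m
          sep01 (inj₁ l) (inj₂ (m , r)) =
            LR (λ _ → Sp-sym (apart v₁∈L m)) (λ { refl → ⊥-elim (L-other {0F} {1F} (λ ()) l) }) l r
          sep01 (inj₂ (l , r)) (inj₁ m) =
            Sp-sym (LR (λ { refl → ⊥-elim (L-other {1F} {0F} (λ ()) m) }) (λ _ → apart l v₂∈L) m r)
          sep01 (inj₂ (l , r)) (inj₂ (m , r')) = apart l m
          sep02 : ∀ {u v} → L 0F u ⊎ (L₁ u × R u) → L 2F v ⊎ (L₁' v × R' v) ⊎ (v ≡ c' × c' ≢ q) → Sp u v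
          sep02 (inj₁ l) (inj₁ m) = L-sep (λ ()) l m
          sep02 (inj₁ l) (inj₂ (inj₁ (m , r))) = LR' (λ ()) l m r
          sep02 (inj₁ l) (inj₂ (inj₂ (refl , ne))) = Lc' {0F} (λ ()) l ne
          sep02 (inj₂ (l , r)) (inj₁ m) =
            Sp-sym (LR (λ { refl → ⊥-elim (L-other {2F} {0F} (λ ()) m) }) (λ { refl → ⊥-elim (L-other {2F} {1F} (λ ()) m) }) m r)
          sep02 (inj₂ (l , r)) (inj₂ (inj₁ (m , r'))) = RR' r r'
          sep02 (inj₂ (l , r)) (inj₂ (inj₂ (refl , ne))) = Rc' r ne
          sep12 : ∀ {u v} → L 1F u ⊎ (L₂ u × R u) → L 2F v ⊎ (L₁' v × R' v) ⊎ (v ≡ c' × c' ≢ q) → Sp u v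
          sep12 (inj₁ l) (inj₁ m) = L-sep (λ ()) l m
          sep12 (inj₁ l) (inj₂ (inj₁ (m , r))) = LR' (λ ()) l m r
          sep12 (inj₁ l) (inj₂ (inj₂ (refl , ne))) = Lc' {1F} (λ ()) l ne
          sep12 (inj₂ (l , r)) (inj₁ m) =
            Sp-sym (LR (λ { refl → ⊥-elim (L-other {2F} {0F} (λ ()) m) }) (λ { refl → ⊥-elim (L-other {2F} {1F} (λ ()) m) }) m r)
          sep12 (inj₂ (l , r)) (inj₂ (inj₁ (m , r'))) = RR' r r'
          sep12 (inj₂ (l , r)) (inj₂ (inj₂ (refl , ne))) = Rc' r ne
          sep : ∀ {j k} → j ≢ k → ∀ {u v} → S j u → S k v → u ≢ c → u ≢ q → v ≢ c → v ≢ q → Sp u v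
          sep {0F} {0F} n = ⊥-elim (n refl)
          sep {0F} {1F} n s t a b d e = sep01 (norm₀ s a b) (norm₁ t d e)
          sep {0F} {2F} n s t a b d e = sep02 (norm₀ s a b) (norm₂ t d e)
          sep {1F} {0F} n s t a b d e = Sp-sym (sep01 (norm₀ t d e) (norm₁ s a b))
          sep {1F} {1F} n = ⊥-elim (n refl)
          sep {1F} {2F} n s t a b d e = sep12 (norm₁ s a b) (norm₂ t d e)
          sep {2F} {0F} n s t a b d e = Sp-sym (sep02 (norm₀ t d e) (norm₂ s a b))
          sep {2F} {1F} n s t a b d e = Sp-sym (sep12 (norm₁ t d e) (norm₂ s a b))
          sep {2F} {2F} n = ⊥-elim (n refl)

        Whole : Pred
        Whole v = B₁ v ⊎ C v ⊎ B₂ v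

        conn-whole : Conn Whole
        conn-whole a b = toC a +w revW (toC b) b
          where
          c₀ = proj₁ CB₁
          toC : ∀ {v} → Whole v → Walk Whole v c₀
          toC (inj₁ b) with CB₁
          ... | c , b' , Cc , Bb , e = mapW inj₁ (cB₁ b Bb) +w edge (~-sym e) (inj₂ (inj₁ Cc))
          toC (inj₂ (inj₁ c)) = mapW (inj₂ ∘ inj₁) (cC c (proj₁ (proj₂ (proj₂ CB₁))))
          toC (inj₂ (inj₂ b)) with CB₂
          ... | c , b' , Cc , Bb , e = mapW (inj₂ ∘ inj₂) (cB₂ b Bb) +w step (~-sym e) (inj₂ (inj₁ Cc))
                  (mapW (inj₂ ∘ inj₁) (cC Cc (proj₁ (proj₂ (proj₂ CB₁)))))

        clean-side : (∀ {v} → Whole v → c' ≢ q → v ≡ w₁ ⊎ Sp c' v) → ⊥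
        clean-side = theta-through Whole id conn-whole (inj₁ v₁∈) (inj₂ (inj₂ v₂∈)) (inj₁ w₁∈)

        X : Pred
        X v = Whole v × v ≢ w₁ × v ≢ w₂

        -- What the third row reaches around `w₁` and `w₂`. If `v₂` is reached, a claw can do
        -- without `w₂`; if neither `v₁` nor `v₂` is reached, then `w₁` and `w₂` cut the third row
        -- off from `R`.
        Reach : Pred
        Reach v = ∃[ c ] (C c × Walk X c v)

        -- The claw is taken in `B₁`, the third row and the reached part of `B₂`. This drops `w₂`,
        -- the contact of `c'` that spoils the theta, and keeps `v₂`.
        via-C : R' c' → v₂ ≢ w₂ → Reach v₂ → ⊥
        via-C r n (c , Cc , w) = theta-through W W⊂ conn (inj₁ v₁∈) (inj₂ (inj₂ (v₂∈ , n , c , Cc , w))) (inj₁ w₁∈) meets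
          where
          W : Pred
          W v = B₁ v ⊎ C v ⊎ (B₂ v × v ≢ w₂ × Reach v)
          W⊂ : ∀ {v} → W v → Whole v
          W⊂ = [ inj₁ , [ inj₂ ∘ inj₁ , inj₂ ∘ inj₂ ∘ proj₁ ]′ ]′
          inW : ∀ {c v} → C c → X v × Walk X c v → W v
          inW Cc ((inj₁ b , _) , _) = inj₁ b
          inW Cc ((inj₂ (inj₁ c) , _) , _) = inj₂ (inj₁ c)
          inW Cc ((inj₂ (inj₂ b) , _ , n) , w) = inj₂ (inj₂ (b , n , _ , Cc , w))
          c₀ = proj₁ CB₁
          Cc₀ = proj₁ (proj₂ (proj₂ CB₁))
          toC : ∀ {v} → W v → Walk W v c₀
          toC (inj₁ b) with CB₁
          ... | c , b' , Cc , Bb , e = mapW inj₁ (cB₁ b Bb) +w edge (~-sym e) (inj₂ (inj₁ Cc))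
          toC (inj₂ (inj₁ c)) = mapW (inj₂ ∘ inj₁) (cC c Cc₀)
          toC (inj₂ (inj₂ (b , n , c , Cc , w))) =
            revW (mapW (inW Cc) (trackW w)) (inj₂ (inj₁ Cc)) +w mapW (inj₂ ∘ inj₁) (cC Cc Cc₀)
          conn : Conn W
          conn a b = toC a +w revW (toC b) b
          meets : ∀ {v} → W v → c' ≢ q → v ≡ w₁ ⊎ Sp c' v
          meets w _ with R'W r (W⊂ w) | w
          ... | inj₂ s | _ = inj₂ s
          ... | inj₁ (inj₁ e) | _ = inj₁ e
          ... | inj₁ (inj₂ refl) | inj₁ b = ⊥-elim (proj₁ (BB b w₂∈) refl)
          ... | inj₁ (inj₂ refl) | inj₂ (inj₁ c) = ⊥-elim (C≢₂ c w₂∈ refl)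
          ... | inj₁ (inj₂ refl) | inj₂ (inj₂ (_ , n , _)) = ⊥-elim (n refl)

        -- the theta joins w₁ to w₂ through c', through C and through R
        between : R' c' → c' ~ w₁ → c' ~ w₂ → ¬ (v₁ ≢ w₁ × Reach v₁) → ¬ (v₂ ≢ w₂ × Reach v₂) → ⊥
        between r' e₁ e₂ no₁ no₂ = noTheta (theta (BB w₁∈ w₂∈) S walks sep)
          where
          Side₁ Side₂ : Pred
          -- The component of `v₁` in its column without `w₁`, empty if the two coincide. The third
          -- path of the theta reaches `w₁` through it.
          Side₁ v = v₁ ≢ w₁ × (B₁ v × v ≢ w₁) × Walk (λ u → B₁ u × u ≢ w₁) v₁ v
          Side₂ v = v₂ ≢ w₂ × (B₂ v × v ≢ w₂) × Walk (λ u → B₂ u × u ≢ w₂) v₂ v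
          S : Fin 3 → Pred
          S = ⟨ (c' ≡_) ∪ (w₂ ≡_) , C ∪ (λ v → X v × Reach v) ∪ (w₂ ≡_) , R ∪ Side₁ ∪ Side₂ ∪ (w₂ ≡_) ⟩
          X₁ : ∀ {v} → B₁ v × v ≢ w₁ → X v
          X₁ (b , n) = inj₁ b , n , λ { refl → proj₁ (BB b w₂∈) refl }
          X₂ : ∀ {v} → B₂ v × v ≢ w₂ → X v
          X₂ (b , n) = inj₂ (inj₂ b) , (λ { refl → proj₁ (BB w₁∈ b) refl }) , n
          to-C : ∀ {B : Pred} {w} → Conn B → B w → (∀ {v} → B v × v ≢ w → X v) → (∃[ c ] ∃[ b ] (C c × B b × c ~ b)) →
                 ∃[ c ] (C c × Walk (C ∪ (λ v → X v × Reach v)) w c)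
          to-C {B} {w} cB w∈ f (c , b , Cc , Bb , e) with b ≟ w
          ... | yes refl = c , Cc , edge (~-sym e) (inj₁ Cc)
          ... | no n with avoid (cB Bb w∈) n
          ...   | t , u , e' , _ = c , Cc , step (~-sym e') (endIn start fwd) (revW fwd start +w edge (~-sym e) (inj₁ Cc))
            where
            start : (C ∪ (λ v → X v × Reach v)) b
            start = inj₂ (f (Bb , n) , c , Cc , edge e (f (Bb , n)))
            fwd : Walk (C ∪ (λ v → X v × Reach v)) b t
            fwd = mapW (λ (bv , wk) → inj₂ (f bv , c , Cc , (edge e (f (Bb , n)) +w mapW f wk))) (trackW u)
          to-R : ∀ {B : Pred} {v w} → Conn B → B v → B w → (∃[ r ] (R r × r ~ v)) →
                 ∃[ r ] (R r × Walk (R ∪ (λ u → v ≢ w × (B u × u ≢ w) × Walk (λ u → B u × u ≢ w) v u)) w r)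
          to-R {B} {v} {w} cB v∈ w∈ (r , Rr , e) with v ≟ w
          ... | yes refl = r , Rr , edge (~-sym e) (inj₁ Rr)
          ... | no n with avoid (cB v∈ w∈) n
          ...   | t , u , e' , _ = r , Rr , step (~-sym e') (endIn start fwd) (revW fwd start +w edge (~-sym e) (inj₁ Rr))
            where
            start = inj₂ (n , (v∈ , n) , nil)
            fwd : Walk (R ∪ (λ u → v ≢ w × (B u × u ≢ w) × Walk (λ u → B u × u ≢ w) v u)) v t
            fwd = mapW (λ (b , wk) → inj₂ (n , b , wk)) (trackW u)
          walks : ∀ j → Walk (S j) w₁ w₂
          walks 0F = step (~-sym e₁) (inj₁ refl) (edge e₂ (inj₂ refl))
          walks 1F with to-C cB₁ w₁∈ X₁ CB₁ | to-C cB₂ w₂∈ X₂ CB₂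
          ... | c , Cc , u | d , Cd , v = mapW [ inj₁ , inj₂ ∘ inj₁ ]′ u +w mapW inj₁ (cC Cc Cd) +w
                  revW (mapW [ inj₁ , inj₂ ∘ inj₁ ]′ v) (inj₂ (inj₂ refl))
          walks 2F with to-R cB₁ v₁∈ w₁∈ Rv₁ | to-R cB₂ v₂∈ w₂∈ Rv₂
          ... | c , Cc , u | d , Cd , v = mapW [ inj₁ , inj₂ ∘ inj₁ ]′ u +w mapW inj₁ (cR Cc Cd) +w
                  revW (mapW [ inj₁ , inj₂ ∘ inj₂ ∘ inj₁ ]′ v) (inj₂ (inj₂ (inj₂ refl)))
          ext : ∀ {u v} → Reach u → u ≡ v ⊎ u ~ v → X v → Reach v
          ext r (inj₁ refl) x = r
          ext (c , Cc , w) (inj₂ e) x = c , Cc , w +w edge e x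
          not₁ : ∀ {v} → Side₁ v → ¬ Reach v
          not₁ (n , b , w) (c , Cc , u) = no₁ (n , c , Cc , u +w mapW X₁ (revW w (v₁∈ , n)))
          not₂ : ∀ {v} → Side₂ v → ¬ Reach v
          not₂ (n , b , w) (c , Cc , u) = no₂ (n , c , Cc , u +w mapW X₂ (revW w (v₂∈ , n)))
          unreach : ∀ {u v} → Reach u → X v → ¬ Reach v → Sp u v
          unreach {u} {v} r x n with Sp? u v
          ... | inj₁ s = s
          ... | inj₂ e = ⊥-elim (n (ext r e x))
          reachC : ∀ {v} → C v → Reach v
          reachC c = _ , c , nil
          cX : ∀ {v} → X v → Sp c' v
          cX (wh , n₁ , n₂) with R'W r' wh
          ... | inj₁ (inj₁ e) = ⊥-elim (n₁ e)
          ... | inj₁ (inj₂ e) = ⊥-elim (n₂ e)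
          ... | inj₂ s = s
          RX : ∀ {u v} → X u × Reach u → R v → Sp u v
          RX ((wh , n₁ , n₂) , rc) r with RW r wh
          ... | inj₁ (inj₁ refl) = ⊥-elim (no₁ (n₁ , rc))
          ... | inj₁ (inj₂ refl) = ⊥-elim (no₂ (n₂ , rc))
          ... | inj₂ s = Sp-sym s
          sep01 : ∀ {u v} → u ≡ c' → C v ⊎ X v × Reach v → Sp u v
          sep01 refl (inj₁ c) = R'C r' c
          sep01 refl (inj₂ (x , _)) = cX x
          sep02 : ∀ {u v} → u ≡ c' → R v ⊎ Side₁ v ⊎ Side₂ v → Sp u v
          sep02 refl (inj₁ r) = Sp-sym (RR' r r')
          sep02 refl (inj₂ (inj₁ (_ , b , _))) = cX (X₁ b)
          sep02 refl (inj₂ (inj₂ (_ , b , _))) = cX (X₂ b)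
          sep12 : ∀ {u v} → C u ⊎ X u × Reach u → R v ⊎ Side₁ v ⊎ Side₂ v → Sp u v
          sep12 (inj₁ c) (inj₁ r) = Sp-sym (RC r c)
          sep12 (inj₁ c) (inj₂ (inj₁ s)) = unreach (reachC c) (X₁ (proj₁ (proj₂ s))) (not₁ s)
          sep12 (inj₁ c) (inj₂ (inj₂ s)) = unreach (reachC c) (X₂ (proj₁ (proj₂ s))) (not₂ s)
          sep12 (inj₂ x) (inj₁ r) = RX x r
          sep12 (inj₂ (_ , rc)) (inj₂ (inj₁ s)) = unreach rc (X₁ (proj₁ (proj₂ s))) (not₁ s)
          sep12 (inj₂ (_ , rc)) (inj₂ (inj₂ s)) = unreach rc (X₂ (proj₁ (proj₂ s))) (not₂ s)
          n0 : ∀ {u} → S 0F u → u ≢ w₂ → u ≡ c'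
          n0 (inj₁ e) n = sym e
          n0 (inj₂ refl) n = ⊥-elim (n refl)
          n1 : ∀ {u} → S 1F u → u ≢ w₂ → C u ⊎ X u × Reach u
          n1 (inj₁ c) n = inj₁ c
          n1 (inj₂ (inj₁ x)) n = inj₂ x
          n1 (inj₂ (inj₂ refl)) n = ⊥-elim (n refl)
          n2 : ∀ {u} → S 2F u → u ≢ w₂ → R u ⊎ Side₁ u ⊎ Side₂ u
          n2 (inj₁ c) n = inj₁ c
          n2 (inj₂ (inj₁ x)) n = inj₂ (inj₁ x)
          n2 (inj₂ (inj₂ (inj₁ x))) n = inj₂ (inj₂ x)
          n2 (inj₂ (inj₂ (inj₂ refl))) n = ⊥-elim (n refl)
          sep : ∀ {j k} → j ≢ k → ∀ {u v} → S j u → S k v → u ≢ w₁ → u ≢ w₂ → v ≢ w₁ → v ≢ w₂ → Sp u v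
          sep {0F} {0F} n = ⊥-elim (n refl)
          sep {0F} {1F} n s t a b d e = sep01 (n0 s b) (n1 t e)
          sep {0F} {2F} n s t a b d e = sep02 (n0 s b) (n2 t e)
          sep {1F} {0F} n s t a b d e = Sp-sym (sep01 (n0 t e) (n1 s b))
          sep {1F} {1F} n = ⊥-elim (n refl)
          sep {1F} {2F} n s t a b d e = sep12 (n1 s b) (n2 t e)
          sep {2F} {0F} n s t a b d e = Sp-sym (sep02 (n0 t e) (n2 s b))
          sep {2F} {1F} n s t a b d e = Sp-sym (sep12 (n1 t e) (n2 s b))
          sep {2F} {2F} n = ⊥-elim (n refl)

        -- With `w₂` out of sight of `c'`, the claw may be taken in both columns and the third row
        -- together.
        opposite : ¬ (c' ~ w₂) → ⊥
        opposite n = clean-side meets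
          where
          meets : ∀ {v} → Whole v → c' ≢ q → v ≡ w₁ ⊎ Sp c' v
          meets {v} wh ne with near
          ... | inj₁ e = ⊥-elim (ne e)
          ... | inj₂ (_ , _ , _ , inj₂ (f , g , h , _)) = inj₂ ([ f v , [ h v , g v ]′ ]′ wh)
          ... | inj₂ (_ , _ , _ , inj₁ r) with R'W r wh
          ...   | inj₂ s = inj₂ s
          ...   | inj₁ (inj₁ e) = inj₁ e
          ...   | inj₁ (inj₂ refl) = inj₂ (S≢₂ r w₂∈ , n)

      -- Exchanging the columns covers every case except that `c'` sees both `w₁` and `w₂`, which
      -- forces `c'` into `R'`. Then the third row reaches some `v` around the contacts of `R'`, or
      -- it reaches neither and `between` applies.
      no-seat : Seat → ⊥
      no-seat s with Seat.c' s ~? Seat.w₂ s | Seat.c' s ~? Seat.w₁ s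
      ... | no n | _ = opposite s n
      ... | yes _ | no n = opposite (seat-swap s) n
      ... | yes e₂ | yes e₁ with Seat.near s
      ...   | inj₁ refl = proj₂ (Seat.q₁ s (Square.w₁∈ (Seat.□ s))) e₁
      ...   | inj₂ (_ , _ , _ , inj₂ (f , _)) = proj₂ (f _ (Square.w₁∈ (Seat.□ s))) e₁
      ...   | inj₂ (_ , _ , _ , inj₁ r) =
        by-cases (λ (n , rc) → via-C (seat-swap s) r n (flip-reach rc)) λ n₁ →
        by-cases (λ (n , rc) → via-C s r n rc) λ n₂ →
        between s r e₁ e₂ n₁ n₂
        where
        flip-reach : ∀ {v} → Reach s v → Reach (seat-swap s) v
        flip-reach (c , Cc , w) = c , Cc , mapW (λ { (wh , n , m) → [ inj₂ ∘ inj₂ , [ inj₂ ∘ inj₁ , inj₁ ]′ ]′ wh , m , n }) w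

      -- Keeps the centres off `v` and `w`. If these are separated, a centre at one of them is
      -- neither equal nor adjacent to any possible centre on the other side; otherwise each has at
      -- most one neighbour in its row, and a centre there would need two.
      Guard : Pred → Pred → V → V → Set
      Guard R R' v w = Sp v w ⊎ ((∀ {a b} → R a → R b → v ~ a → v ~ b → a ≡ b) × (∀ {a b} → R' a → R' b → w ~ a → w ~ b → a ≡ b))

      ⊕-conn : ∀ {A p} → Conn A → (∀ j → ∃[ a ] (A a × a ~ p j)) → Conn (A ⊕ p)
      ⊕-conn {A} {p} cA att a b = go a +w revW (go b) b
        where
        base = proj₁ (att zero)
        Ab = proj₁ (proj₂ (att zero))
        go : ∀ {v} → (A ⊕ p) v → Walk (A ⊕ p) v base
        go (inj₁ x) = mapW inj₁ (cA x Ab)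
        go (inj₂ (j , refl)) with att j
        ... | a , Aa , e = step (~-sym e) (inj₁ Aa) (mapW inj₁ (cA Aa Ab))

      -- The set `Q` is the third connection between the rows, besides the two columns. Its ends `x`
      -- and `y` are the places where the guards do not exclude a centre, and `away` prepares them
      -- to serve as the `q` of a seat.
      record Bridged : Set₁ where
        field
          {R R' C B₁ B₂ Q} : Pred
          {v₁ w₁ v₂ w₂ x y} : V
          □    : Square R R' C B₁ B₂ v₁ w₁ v₂ w₂
          g₁   : Guard R R' v₁ w₁
          g₂   : Guard R R' v₂ w₂
          x∈   : Q x
          y∈   : Q y
          wQ   : Walk Q x y
          QB₁  : Sep Q B₁
          QB₂  : Sep Q B₂
          RQ   : ∀ {u v} → R u → Q v → u ≢ v × (u ~ v → v ≡ x)
          R'Q  : ∀ {u v} → R' u → Q v → u ≢ v × (u ~ v → v ≡ y)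
          Rx   : ∃[ r ] (R r × r ~ x)
          R'y  : ∃[ r ] (R' r × r ~ y)
          away : x ≡ y ⊎ x ~ y → (∀ v → C v → Sp x v) × (∀ v → C v → Sp y v)

      module _ (bridged : Bridged) where
        open Bridged bridged
        open Square □

        private
          xs ys : Fin 3 → V
          xs = ⟨ v₁ , v₂ , x ⟩
          ys = ⟨ w₁ , w₂ , y ⟩

          QS : Fin 3 → Pred
          QS = ⟨ B₁ , B₂ , Q ⟩

          QQ : ∀ {j k} → j ≢ k → Sep (QS j) (QS k)
          QQ = sep3 {R = QS} BB (λ u v → Sp-sym (QB₁ v u)) (λ u v → Sp-sym (QB₂ v u))

          X∈ : ∀ j → QS j (xs j)
          X∈ = all3 v₁∈ v₂∈ x∈
          Y∈ : ∀ j → QS j (ys j)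
          Y∈ = all3 w₁∈ w₂∈ y∈

          RQS : ∀ k {u v} → R u → QS k v → u ≢ v × (u ~ v → v ≡ xs k)
          RQS 0F r b = R≢₁ r b , R₁ r b
          RQS 1F r b = R≢₂ r b , R₂ r b
          RQS 2F r q = RQ r q
          R'QS : ∀ k {u v} → R' u → QS k v → u ≢ v × (u ~ v → v ≡ ys k)
          R'QS 0F r b = S≢₁ r b , S₁ r b
          R'QS 1F r b = S≢₂ r b , S₂ r b
          R'QS 2F r q = R'Q r q

          ℒ : Linkage R R' QS xs ys
          ℒ = record
            { x∈ = X∈ ; y∈ = Y∈ ; walk = all3 (cB₁ v₁∈ w₁∈) (cB₂ v₂∈ w₂∈) wQ
            ; QQ = QQ ; AA' = RR'
            ; AQ = λ k r q → equal-or-Sp (proj₁ (RQS k r q)) (proj₂ (RQS k r q))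
            ; A'Q = λ k r q → equal-or-Sp (proj₁ (R'QS k r q)) (proj₂ (R'QS k r q)) }

          opaque
            D : Center (R ⊕ xs) xs
            D = connected-center (⊕-conn cR (all3 Rv₁ Rv₂ Rx)) xs (λ j → inj₂ (j , refl))
            D' : Center (R' ⊕ ys) ys
            D' = connected-center (⊕-conn cR' (all3 Rw₁ Rw₂ R'y)) ys (λ j → inj₂ (j , refl))

          open Center D
          open Center D' using () renaming (c to c'; c∈ to c'∈; end∈L to end∈L'; L-sep to L'-sep)

          meet : c ≡ c' ⊎ c ~ c'
          meet = centers-meet ℒ D D'

          indX : ∀ {j k} → j ≢ k → Sp (xs j) (xs k)
          indX n = QQ n (X∈ _) (X∈ _)
          indY : ∀ {j k} → j ≢ k → Sp (ys j) (ys k)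
          indY n = QQ n (Y∈ _) (Y∈ _)

          met : ∀ {u v} → c ≡ u → c' ≡ v → Sp u v → ⊥
          met refl refl (a , b) = [ a , b ]′ meet

          not-v : ∀ j → Guard R R' (xs j) (ys j) → c ≢ xs j
          not-v j (inj₂ (leaf , _)) e with two-neighbours D indX j e
          ... | a , b , Ra , Rb , (ne , _) , ea , eb = ne (leaf Ra Rb ea eb)
          not-v j (inj₁ s) e with c'∈
          ... | inj₁ r' = met e refl ((λ q → proj₁ (R'QS j r' (X∈ j)) (sym q)) ,
                            λ a → proj₁ s (proj₂ (R'QS j r' (X∈ j)) (~-sym a)))
          ... | inj₂ (k , e') with j ≟ k
          ...   | yes refl = met e e' s
          ...   | no n = met e e' (QQ n (X∈ j) (Y∈ k))

          not-w : ∀ j → Guard R R' (xs j) (ys j) → c' ≢ ys j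
          not-w j (inj₂ (_ , leaf)) e with two-neighbours D' indY j e
          ... | a , b , Ra , Rb , (ne , _) , ea , eb = ne (leaf Ra Rb ea eb)
          not-w j (inj₁ s) e with c∈
          ... | inj₁ r = met refl e (proj₁ (RQS j r (Y∈ j)) , λ a → proj₁ s (sym (proj₂ (RQS j r (Y∈ j)) a)))
          ... | inj₂ (k , e') with k ≟ j
          ...   | yes refl = met e' e s
          ...   | no n = met e' e (QQ n (X∈ k) (Y∈ j))

          c≢v₁ = not-v 0F g₁
          c≢v₂ = not-v 1F g₂
          c'≢w₁ = not-w 0F g₁
          c'≢w₂ = not-w 1F g₂

          x₁ : ∀ {v} → B₁ v → Sp x v
          x₁ = QB₁ x∈
          x₂ : ∀ {v} → B₂ v → Sp x v
          x₂ = QB₂ x∈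
          y₁ : ∀ {v} → B₁ v → Sp y v
          y₁ = QB₁ y∈
          y₂ : ∀ {v} → B₂ v → Sp y v
          y₂ = QB₂ y∈

          H : Hub R c v₁ v₂
          H = hub D {0F} {1F} (λ ()) c≢v₁ c≢v₂
          H' : Hub R' c' w₁ w₂
          H' = hub D' {0F} {1F} (λ ()) c'≢w₁ c'≢w₂

          legs-away : ∀ {z} → c' ≢ y → z ≡ y → (∀ v → Hub.L₁ H' v → Sp z v) × (∀ v → Hub.L₂ H' v → Sp z v)
          legs-away n refl = (λ v l → L'-sep {2F} {0F} (λ ()) (end∈L' 2F n) l) , (λ v l → L'-sep {2F} {1F} (λ ()) (end∈L' 2F n) l)
          legs-away' : ∀ {z} → c ≢ x → z ≡ x → (∀ v → Hub.L₁ H v → Sp z v) × (∀ v → Hub.L₂ H v → Sp z v)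
          legs-away' n refl = (λ v l → L-sep {2F} {0F} (λ ()) (end∈L 2F n) l) , (λ v l → L-sep {2F} {1F} (λ ()) (end∈L 2F n) l)

          -- A vertex of `R'` adjacent to `x` forces `x` and `y` to coincide, `y` being the only
          -- contact of `R'` on `Q`. So the ends of `Q` are equal or adjacent whenever the centres
          -- meet here, and `away` applies.
          atx : c ≡ x → (R' c' ⊎ c' ≡ y) → ⊥
          atx e (inj₁ r') with meet
          ... | inj₁ q = proj₁ (R'Q r' x∈) (trans (sym q) e)
          ... | inj₂ q = no-seat record
            { □ = □ ; q₁ = subst (λ z → ∀ {v} → B₁ v → Sp z v) (sym e) x₁ ; q₂ = subst (λ z → ∀ {v} → B₂ v → Sp z v) (sym e) x₂
            ; qC = λ {v} Cv → subst (λ z → Sp z v) (sym e) (proj₁ (away (inj₁ x≡y)) v Cv)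
            ; h = H ; h' = H'
            ; near = inj₂ (q , proj₁ (legs-away c'≢y (trans e x≡y)) , proj₂ (legs-away c'≢y (trans e x≡y)) , inj₁ r') }
            where
            x≡y : x ≡ y
            x≡y = proj₂ (R'Q r' x∈) (~-sym (subst (_~ c') e q))
            c'≢y : c' ≢ y
            c'≢y = proj₁ (R'Q r' y∈)
          atx e (inj₂ e') with meet
          ... | inj₁ q = no-seat record
            { □ = □ ; q₁ = subst (λ z → ∀ {v} → B₁ v → Sp z v) (sym e) x₁ ; q₂ = subst (λ z → ∀ {v} → B₂ v → Sp z v) (sym e) x₂
            ; qC = λ {v} Cv → subst (λ z → Sp z v) (sym e) (proj₁ (away (inj₁ (trans (sym e) (trans q e')))) v Cv)
            ; h = H ; h' = H' ; near = inj₁ (sym q) }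
          ... | inj₂ q = no-seat record
            { □ = □ ; q₁ = subst (λ z → ∀ {v} → B₁ v → Sp z v) (sym e) x₁ ; q₂ = subst (λ z → ∀ {v} → B₂ v → Sp z v) (sym e) x₂
            ; qC = λ {v} Cv → subst (λ z → Sp z v) (sym e) (proj₁ aw v Cv)
            ; h = H ; h' = H'
            ; near = inj₂ (q , leg₁ , leg₂ , inj₂ ((λ v b → y' (y₁ b)) , (λ v b → y' (y₂ b)) , (λ v Cv → y' (proj₂ aw v Cv)) , λ v r → y' (Ry r))) }
            where
            x~y : x ~ y
            x~y = subst (_~ y) e (subst (c ~_) e' q)
            aw = away (inj₂ x~y)
            y' : ∀ {v} → Sp y v → Sp c' v
            y' {v} = subst (λ z → Sp z v) (sym e')
            Ry : ∀ {v} → R v → Sp y v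
            Ry r = (λ z → proj₁ (RQ r y∈) (sym z)) , λ a → ~⇒≢ x~y (sym (proj₂ (RQ r y∈) (~-sym a)))
            R'x : ∀ {v} → R' v → Sp c v
            R'x {v} r = subst (λ z → Sp z v) (sym e)
              ((λ z → proj₁ (R'Q r x∈) (sym z)) , λ a → ~⇒≢ x~y (proj₂ (R'Q r x∈) (~-sym a)))
            leg₁ : ∀ v → Hub.L₁ H' v → Sp c v
            leg₁ v l = [ R'x , (λ { refl → subst (λ z → Sp z v) (sym e) (x₁ w₁∈) }) ]′ (Hub.in₁ H' l)
            leg₂ : ∀ v → Hub.L₂ H' v → Sp c v
            leg₂ v l = [ R'x , (λ { refl → subst (λ z → Sp z v) (sym e) (x₂ w₂∈) }) ]′ (Hub.in₂ H' l)

          aty : c' ≡ y → R c → ⊥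
          aty e r with meet
          ... | inj₁ q = proj₁ (RQ r y∈) (trans q e)
          ... | inj₂ q = no-seat record
            { □ = swapR □ ; q₁ = subst (λ z → ∀ {v} → B₁ v → Sp z v) (sym e) y₁ ; q₂ = subst (λ z → ∀ {v} → B₂ v → Sp z v) (sym e) y₂
            ; qC = λ {v} Cv → subst (λ z → Sp z v) (sym e) (proj₂ (away (inj₁ (sym y≡x))) v Cv)
            ; h = H' ; h' = H
            ; near = inj₂ (~-sym q , proj₁ (legs-away' c≢x (trans e y≡x)) , proj₂ (legs-away' c≢x (trans e y≡x)) , inj₁ r) }
            where
            y≡x : y ≡ x
            y≡x = proj₂ (RQ r y∈) (subst (c ~_) e q)
            c≢x : c ≢ x
            c≢x = proj₁ (RQ r x∈)

        -- The rows are separated and the centres meet, so some centre is a terminal. The guards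
        -- leave `x` and `y`.
        no-square : ⊥
        no-square with c∈ | c'∈
        ... | inj₁ r | inj₁ r' = [ proj₁ (RR' r r') , proj₂ (RR' r r') ]′ meet
        ... | inj₂ (0F , e) | _ = c≢v₁ e
        ... | inj₂ (1F , e) | _ = c≢v₂ e
        ... | _ | inj₂ (0F , e) = c'≢w₁ e
        ... | _ | inj₂ (1F , e) = c'≢w₂ e
        ... | inj₂ (2F , e) | inj₁ r' = atx e (inj₁ r')
        ... | inj₂ (2F , e) | inj₂ (2F , e') = atx e (inj₂ e')
        ... | inj₁ r | inj₂ (2F , e') = aty e' r

      -- Rows and their contacts with columns

      module _ (A : Fin 3 → Pred) (A? : ∀ i v → Dec (A i v))
               (AA : ∀ {i j} → i ≢ j → Sep (A i) (A j)) (cA : ∀ i → Conn (A i)) where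

        R : Fin 3 → Pred
        R i = Nb (A i)

        R? : ∀ i v → Dec (R i v)
        R? i = Nb? (A? i)

        Off : Pred → Set
        Off B = ∀ {i u v} → A i u → B v → u ≢ v

        record Touch (S : Pred) (i : Fin 3) : Set where
          field
            t    : V
            t∈   : S t
            Rt   : R i t
            only : ∀ {v} → S v → R i v → v ≡ t

        module _ {B : Pred} (K : Column R B) where
          open Column K

          touch : ∀ i → i ≢ γ → Touch S i
          touch i n with cover α≢β γ≢α γ≢β i
          ... | inj₁ refl = record { t = a ; t∈ = Sa ; Rt = Ra ; only = only-a }
          ... | inj₂ (inj₁ refl) = record { t = b ; t∈ = Sb ; Rt = Rb ; only = only-b }
          ... | inj₂ (inj₂ e) = ⊥-elim (n e)

          sees : ∀ i → ∃[ v ] (S v × R i v)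
          sees i with cover α≢β γ≢α γ≢β i
          ... | inj₁ refl = a , Sa , Ra
          ... | inj₂ (inj₁ refl) = b , Sb , Rb
          ... | inj₂ (inj₂ refl) = g , Sg , Rg

          touch-Sp : Sp a b → ∀ {i j} → i ≢ j → ∀ (p : i ≢ γ) (q : j ≢ γ) → Sp (Touch.t (touch i p)) (Touch.t (touch j q))
          touch-Sp s {i} {j} n p q with cover α≢β γ≢α γ≢β i | cover α≢β γ≢α γ≢β j
          ... | inj₁ refl | inj₁ refl = ⊥-elim (n refl)
          ... | inj₁ refl | inj₂ (inj₁ refl) = s
          ... | inj₂ (inj₁ refl) | inj₁ refl = Sp-sym s
          ... | inj₂ (inj₁ refl) | inj₂ (inj₁ refl) = ⊥-elim (n refl)
          ... | inj₂ (inj₂ e) | _ = ⊥-elim (p e)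
          ... | _ | inj₂ (inj₂ e) = ⊥-elim (q e)

        -- A row vertex at the centre of a claw would have two nonadjacent neighbours in `S`. For
        -- leafy `S` the centre therefore falls into `S`.
        Leafy : Pred → Set
        Leafy S = ∀ {j v a b} → A j v → S a → S b → v ~ a → v ~ b → ¬ Sp a b

        Small⇒Leafy : ∀ {S} → Small S → Leafy S
        Small⇒Leafy sm _ Sa Sb _ _ (p , q) = [ p , q ]′ (sm Sa Sb)

        links-through : ∀ {S S' : Pred} → (∀ v → Dec (S v)) → (∀ v → Dec (S' v)) →
                        (∀ i → ∃[ v ] (S v × R i v)) → (∀ i → ∃[ v ] (S' v × R i v)) → ∀ i → Link (A i) (Nb S) (Nb S')
        links-through S? S'? f f' i with f i | f' i
        ... | v , Sv , a , Aa , e | v' , S'v' , a' , Aa' , e' =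
          link (Nb? S?) (Nb? S'?) Aa (v , Sv , ~-sym e) (v' , S'v' , ~-sym e') (cA i Aa Aa')

        module Through {S S' : Pred} (ℓ : ∀ i → Link (A i) (Nb S) (Nb S')) (off : Off S) (off' : Off S') (SS' : Sep S S')
                        (conn : Conn S) (conn' : Conn S') where
          private open module ℓ i = Link (ℓ i) hiding (conn)

          contact : ∀ k {a v} → S a → Q k v → v ≡ x k ⊎ Sp a v
          contact k s q = equal-or-Sp (off (Q⊂ k q) s ∘ sym) (λ e → only-x k q (_ , s , e))

          contact' : ∀ k {a v} → S' a → Q k v → v ≡ y k ⊎ Sp a v
          contact' k s q = equal-or-Sp (off' (Q⊂ k q) s ∘ sym) (λ e → only-y k q (_ , s , e))

          linkage : Linkage S S' Q x y
          linkage = record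
            { x∈ = x∈ ; y∈ = y∈ ; walk = walk ; QQ = λ n q q' → AA n (Q⊂ _ q) (Q⊂ _ q')
            ; AA' = SS' ; AQ = contact ; A'Q = contact' }

          D : Center (S ⊕ x) x
          D = connected-center (⊕-conn conn Fx) x (λ j → inj₂ (j , refl))

          D' : Center (S' ⊕ y) y
          D' = connected-center (⊕-conn conn' Ly) y (λ j → inj₂ (j , refl))

          leafless : ∀ (C : Center (S ⊕ x) x) → Leafy S → (S ⊕ x) (Center.c C) → S (Center.c C)
          leafless C lf (inj₁ s) = s
          leafless C lf (inj₂ (j , e)) with two-neighbours C (λ n → AA n (Q⊂ _ (x∈ _)) (Q⊂ _ (x∈ _))) j e
          ... | _ , _ , Sa , Sb , sp , ea , eb = ⊥-elim (lf (Q⊂ j (x∈ j)) Sa Sb ea eb sp)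

          leafless' : ∀ (C : Center (S' ⊕ y) y) → Leafy S' → (S' ⊕ y) (Center.c C) → S' (Center.c C)
          leafless' C lf (inj₁ s) = s
          leafless' C lf (inj₂ (j , e)) with two-neighbours C (λ n → AA n (Q⊂ _ (y∈ _)) (Q⊂ _ (y∈ _))) j e
          ... | _ , _ , Sa , Sb , sp , ea , eb = ⊥-elim (lf (Q⊂ j (y∈ j)) Sa Sb ea eb sp)

          two-leafy : Leafy S → Leafy S' → ⊥
          two-leafy l l' with SS' (leafless D l (Center.c∈ D)) (leafless' D' l' (Center.c∈ D'))
          ... | p , q = [ p , q ]′ (centers-meet linkage D D')

        module _ {M M' C : Pred} {α β γ : Fin 3} (α≢β : α ≢ β) (γ≢α : γ ≢ α) (γ≢β : γ ≢ β)
                 (M⊂ : ∀ {v} → M v → A α v) (M'⊂ : ∀ {v} → M' v → A β v) (cM : Conn M) (cM' : Conn M') where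

          square : ∀ {S₁ S₂ : Pred} (sep : Sep S₁ S₂) → Off S₁ → Off S₂ → Conn S₁ → Conn S₂ →
            (v₁ : ∃[ v ] (S₁ v × Nb M v × (∀ {u} → S₁ u → Nb M u → u ≡ v)))
            (w₁ : ∃[ v ] (S₁ v × Nb M' v × (∀ {u} → S₁ u → Nb M' u → u ≡ v)))
            (v₂ : ∃[ v ] (S₂ v × Nb M v × (∀ {u} → S₂ u → Nb M u → u ≡ v)))
            (w₂ : ∃[ v ] (S₂ v × Nb M' v × (∀ {u} → S₂ u → Nb M' u → u ≡ v))) →
            ∃[ v ] (S₁ v × R γ v) → ∃[ v ] (S₂ v × R γ v) →
            Square M M' (A γ) S₁ S₂ (proj₁ v₁) (proj₁ w₁) (proj₁ v₂) (proj₁ w₂)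
          square sep o₁ o₂ c₁ c₂ (v₁ , v₁∈ , Rv₁ , u₁) (w₁ , w₁∈ , Rw₁ , t₁) (v₂ , v₂∈ , Rv₂ , u₂) (w₂ , w₂∈ , Rw₂ , t₂)
                 (g₁ , g₁∈ , c , Cc , e) (g₂ , g₂∈ , c' , Cc' , e') = record
            { RR' = λ u v → AA α≢β (M⊂ u) (M'⊂ v) ; RC = λ u v → AA (γ≢α ∘ sym) (M⊂ u) v ; R'C = λ u v → AA (γ≢β ∘ sym) (M'⊂ u) v
            ; BB = sep ; cR = cM ; cR' = cM' ; cC = cA γ ; cB₁ = c₁ ; cB₂ = c₂
            ; v₁∈ = v₁∈ ; w₁∈ = w₁∈ ; v₂∈ = v₂∈ ; w₂∈ = w₂∈ ; Rv₁ = Rv₁ ; Rv₂ = Rv₂ ; Rw₁ = Rw₁ ; Rw₂ = Rw₂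
            ; CB₁ = c , g₁ , Cc , g₁∈ , e ; CB₂ = c' , g₂ , Cc' , g₂∈ , e'
            ; R≢₁ = λ r → o₁ (M⊂ r) ; R≢₂ = λ r → o₂ (M⊂ r) ; S≢₁ = λ r → o₁ (M'⊂ r) ; S≢₂ = λ r → o₂ (M'⊂ r)
            ; C≢₁ = o₁ ; C≢₂ = o₂
            ; R₁ = λ r b f → u₁ b (_ , r , f) ; R₂ = λ r b f → u₂ b (_ , r , f)
            ; S₁ = λ r b f → t₁ b (_ , r , f) ; S₂ = λ r b f → t₂ b (_ , r , f) }

        -- whether or not γ is the row whose contact with the far column S may fail to be unique
        Third : Pred → Fin 3 → Fin 3 → Fin 3 → Set
        Third S α β γ =
          (Σ (Touch S α) λ s → Σ (Touch S β) λ t → Sp (Touch.t s) (Touch.t t)) ⊎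
          (Σ (Touch S γ) λ t → (Σ (Touch S α) λ s → Sp (Touch.t s) (Touch.t t)) ⊎ (Σ (Touch S β) λ s → Sp (Touch.t s) (Touch.t t)))

        -- In the first case `x` and `y` are themselves separated, against the hypothesis. In the
        -- second, one of them is separated from the sole contact `z` of row `γ` and the other is
        -- equal or adjacent to it, so neither is `z`.
        keep-away : ∀ {S : Pred} {α β γ} → Off S → Third S α β γ → ∀ {x y} → S x → S y → R α x → R β y → x ≡ y ⊎ x ~ y →
                    (∀ v → A γ v → Sp x v) × (∀ v → A γ v → Sp y v)
        keep-away off (inj₁ (s , t , sp)) Sx Sy Rx Ry near with Touch.only s Sx Rx | Touch.only t Sy Ry
        ... | refl | refl = ⊥-elim ([ proj₁ sp , proj₂ sp ]′ near)
        keep-away {S} {γ = γ} off (inj₂ (t , q)) {x} {y} Sx Sy Rx Ry near =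
          (λ v c → not-at Sx (x≢ q near) c) , (λ v c → not-at Sy (y≢ q near) c)
          where
          open Touch t using () renaming (t to z; only to only-z)
          not-at : ∀ {w u} → S w → w ≢ z → A γ u → Sp w u
          not-at Sw m Au = (off Au Sw ∘ sym) , λ e → m (only-z Sw (_ , Au , ~-sym e))
          x≢ : _ → x ≡ y ⊎ x ~ y → x ≢ z
          x≢ (inj₁ (s , sp)) _ e = proj₁ sp (trans (sym (Touch.only s Sx Rx)) e)
          x≢ (inj₂ (s , sp)) (inj₁ refl) e = proj₁ sp (trans (sym (Touch.only s Sy Ry)) e)
          x≢ (inj₂ (s , sp)) (inj₂ a) refl = proj₂ sp (subst (_~ x) (Touch.only s Sy Ry) (~-sym a))
          y≢ : _ → x ≡ y ⊎ x ~ y → y ≢ z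
          y≢ (inj₂ (s , sp)) _ e = proj₁ sp (trans (sym (Touch.only s Sy Ry)) e)
          y≢ (inj₁ (s , sp)) (inj₁ refl) e = proj₁ sp (trans (sym (Touch.only s Sx Rx)) e)
          y≢ (inj₁ (s , sp)) (inj₂ a) refl = proj₂ sp (subst (_~ y) (Touch.only s Sx Rx) a)

        module ThreeFar {S₁ S₂ S₃ : Pred} {α β γ : Fin 3} (α≢β : α ≢ β) (γ≢α : γ ≢ α) (γ≢β : γ ≢ β)
          (o₁ : Off S₁) (o₂ : Off S₂) (o₃ : Off S₃) (c₁ : Conn S₁) (c₂ : Conn S₂)
          (s₁₂ : Sep S₁ S₂) (s₃₁ : Sep S₃ S₁) (s₃₂ : Sep S₃ S₂) where

          -- The first two columns form the square, and a link through the third is the bridge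
          -- between rows `α` and `β`.
          three-far : (p₁ : Touch S₁ α) (q₁ : Touch S₁ β) (p₂ : Touch S₂ α) (q₂ : Touch S₂ β) →
            ∃[ v ] (S₁ v × R γ v) → ∃[ v ] (S₂ v × R γ v) →
            Sp (Touch.t p₁) (Touch.t q₁) → Sp (Touch.t p₂) (Touch.t q₂) → Link S₃ (R α) (R β) → Third S₃ α β γ → ⊥
          three-far p₁ q₁ p₂ q₂ g₁ g₂ f₁ f₂ λ₃ th =
            no-square record
              { □ = square {M = A α} {M' = A β} {C = A γ} α≢β γ≢α γ≢β id id (cA α) (cA β) s₁₂ o₁ o₂ c₁ c₂
                      (ex p₁) (ex q₁) (ex p₂) (ex q₂) g₁ g₂
              ; g₁ = inj₁ f₁ ; g₂ = inj₁ f₂ ; x∈ = x∈ ; y∈ = y∈ ; wQ = walk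
              ; QB₁ = λ q b → s₃₁ (Q⊂ q) b ; QB₂ = λ q b → s₃₂ (Q⊂ q) b
              ; RQ = λ r q → o₃ r (Q⊂ q) , λ e → only-x q (_ , r , e)
              ; R'Q = λ r q → o₃ r (Q⊂ q) , λ e → only-y q (_ , r , e)
              ; Rx = Fx ; R'y = Ly ; away = keep-away o₃ th (Q⊂ x∈) (Q⊂ y∈) Fx Ly }
            where
            open Link λ₃
            ex : ∀ {S i} → Touch S i → ∃[ v ] (S v × R i v × (∀ {u} → S u → R i u → u ≡ v))
            ex t = Touch.t t , Touch.t∈ t , Touch.Rt t , Touch.only t

        third-of : ∀ {B} (K : Column R B) → Sp (Column.a K) (Column.b K) → ∀ {α β γ} → α ≢ β → γ ≢ α → γ ≢ β →
                   Third (Column.S K) α β γ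
        third-of K sp {α} {β} {γ} αβ γα γβ with γ ≟ Column.γ K
        ... | yes refl = inj₁ (touch K α (γα ∘ sym) , touch K β (γβ ∘ sym) , touch-Sp K sp αβ _ _)
        ... | no n with α ≟ Column.γ K
        ...   | no m = inj₂ (touch K γ n , inj₁ (touch K α m , touch-Sp K sp (γα ∘ sym) _ _))
        ...   | yes refl = inj₂ (touch K γ n , inj₂ (touch K β (αβ ∘ sym) , touch-Sp K sp (γβ ∘ sym) _ _))

        same-third : ∀ {B₁ B₂ B₃} (K₁ : Column R B₁) (K₂ : Column R B₂) (K₃ : Column R B₃) → Off B₁ → Off B₂ → Off B₃ →
                     Sep B₁ B₂ → Sep B₃ B₁ → Sep B₃ B₂ → Column.γ K₁ ≡ Column.γ K₂ →
                     Sp (Column.a K₁) (Column.b K₁) → Sp (Column.a K₂) (Column.b K₂) → Sp (Column.a K₃) (Column.b K₃) → ⊥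
        same-third K₁ K₂ K₃ o₁ o₂ o₃ s₁₂ s₃₁ s₃₂ same f₁ f₂ f₃ = go (sees K₃ α) (sees K₃ β)
          where
          open Column K₁ using (α; β; γ; α≢β; γ≢α; γ≢β)
          S₁ = Column.S K₁
          S₂ = Column.S K₂
          S₃ = Column.S K₃
          go : ∃[ v ] (S₃ v × R α v) → ∃[ v ] (S₃ v × R β v) → ⊥
          go (v , Sv , r) (v' , Sv' , r') = ThreeFar.three-far {S₁ = S₁} {S₂} {S₃} α≢β γ≢α γ≢β
            (λ a s → o₁ a (Column.S⊂ K₁ s)) (λ a s → o₂ a (Column.S⊂ K₂ s)) (λ a s → o₃ a (Column.S⊂ K₃ s))
            (Column.conn K₁) (Column.conn K₂)
            (λ u v → s₁₂ (Column.S⊂ K₁ u) (Column.S⊂ K₂ v)) (λ u v → s₃₁ (Column.S⊂ K₃ u) (Column.S⊂ K₁ v))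
            (λ u v → s₃₂ (Column.S⊂ K₃ u) (Column.S⊂ K₂ v))
            (touch K₁ α (γ≢α ∘ sym)) (touch K₁ β (γ≢β ∘ sym))
            (touch K₂ α (λ q → γ≢α (trans same (sym q)))) (touch K₂ β (λ q → γ≢β (trans same (sym q))))
            (sees K₁ γ) (subst (λ i → ∃[ v ] (S₂ v × R i v)) (sym same) (sees K₂ (Column.γ K₂)))
            (touch-Sp K₁ f₁ α≢β _ _) (touch-Sp K₂ f₂ α≢β _ _)
            (link (R? α) (R? β) Sv r r' (Column.conn K₃ Sv Sv')) (third-of K₃ f₃ α≢β γ≢α γ≢β)

        -- Three columns that are paths and a small one

        -- Replaces one member of a family of links, so that a result about families applies to any
        -- prescribed link in row `i`.
        at : ∀ {F L : Pred} i → Link (A i) F L → (∀ r → Link (A r) F L) → ∀ r → Link (A r) F L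
        at i new ls r with i ≟ r
        ... | yes refl = new
        ... | no _ = ls r

        at-self : ∀ {F L : Pred} i (new : Link (A i) F L) ls → at i new ls i ≡ new
        at-self i new ls with i ≟ i
        ... | yes refl = refl
        ... | no n = ⊥-elim (n refl)

        TwoOn : List V → V → Set
        TwoOn l w = ∃[ a ] ∃[ b ] (a ∈ l × b ∈ l × Sp a b × w ~ a × w ~ b)

        tail-conn : ∀ {z N} → Ind (z ∷ N) → Conn (_∈ N)
        tail-conn (cons _ _ i) = Ind-conn i

        Head-front : ∀ {p} pre {α rest} → Head p (pre ++ α ∷ rest) → Head p (pre ++ [ α ])
        Head-front [] head = head
        Head-front (x ∷ pre) head = head

        Last-snoc : ∀ pre {α} → Last α (pre ++ [ α ])
        Last-snoc [] = last
        Last-snoc (x ∷ pre) = skip (Last-snoc pre)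

        -- The first contact of `u` and a later one, with at least the vertex `y` between them.
        record Split (u : V) (l : List V) : Set where
          constructor splits
          field
            pre    : List V
            α y    : V
            mid    : List V
            β      : V
            post   : List V
            eq     : l ≡ pre ++ α ∷ y ∷ mid ++ β ∷ post
            u~α    : u ~ α
            u~β    : u ~ β
            before : ∀ {v} → v ∈ pre → ¬ (u ~ v)

        split : ∀ {u l} → Ind l → TwoOn l u → Split u l
        split {u} {l} i t2 with contacts (λ v → u ~? v) l
        split i (_ , _ , a∈ , _ , _ , ua , _) | none n = ⊥-elim (n a∈ ua)
        split {u} i (a , b , a∈ , b∈ , sp , ua , ub) | one pre c post _ n m = ⊥-elim (proj₁ sp (trans (is-c a∈ ua) (sym (is-c b∈ ub))))
          where
          is-c : ∀ {v} → v ∈ pre ++ c ∷ post → u ~ v → v ≡ c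
          is-c v∈ f with ∈-++⁻ pre v∈
          ... | inj₁ q = ⊥-elim (n q f)
          ... | inj₂ (here q) = q
          ... | inj₂ (there q) = ⊥-elim (m q f)
        split i _ | two pre a [] b post ua ub _ _ = ⊥-elim (no-triangle ua (Ind-adj pre i) ub)
        split i _ | two pre a (y ∷ mid) b post ua ub n _ = splits pre a y mid b post refl ua ub n

        -- column i is the induced path ℓ i; it meets each row r ≢ i in e i r only, and these two contacts are its ends
        record Spokes : Set₁ where
          field
            ℓ      : Fin 3 → List V
            ind    : ∀ i → Ind (ℓ i)
            hd tl  : Fin 3 → Fin 3
            hd≢    : ∀ i → hd i ≢ i
            tl≢    : ∀ i → tl i ≢ i
            hd≢tl  : ∀ i → hd i ≢ tl i
            e      : Fin 3 → Fin 3 → V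
            head-ℓ : ∀ i → Head (e i (hd i)) (ℓ i)
            last-ℓ : ∀ i → Last (e i (tl i)) (ℓ i)
            e∈     : ∀ {i r} → r ≢ i → e i r ∈ ℓ i
            eR     : ∀ {i r} → r ≢ i → R r (e i r)
            e-only : ∀ {i r} → r ≢ i → ∀ {v} → v ∈ ℓ i → R r v → v ≡ e i r
            e-far  : ∀ {i r s} → r ≢ i → s ≢ i → r ≢ s → Sp (e i r) (e i s)
            off    : ∀ i → Off (_∈ ℓ i)
            CC     : ∀ {i j} → i ≢ j → Sep (_∈ ℓ i) (_∈ ℓ j)
            seesC  : ∀ i → ∃[ v ] (v ∈ ℓ i × R i v)
            D      : Pred
            D?     : ∀ v → Dec (D v)
            cD     : Conn D
            offD   : Off D
            CD     : ∀ i → Sep (_∈ ℓ i) D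
            smD    : Small D
            seesD  : ∀ r → ∃[ v ] (D v × R r v)

        module Leftover (spokes : Spokes) where
          open Spokes spokes

          C : Fin 3 → Pred
          C i = _∈ ℓ i

          C? : ∀ i v → Dec (C i v)
          C? i v = v ∈? ℓ i

          cC : ∀ i → Conn (C i)
          cC i = Ind-conn (ind i)

          sees-C : ∀ i r → ∃[ v ] (C i v × R r v)
          sees-C i r with r ≟ i
          ... | yes refl = seesC i
          ... | no n = e i r , e∈ n , eR n

          meets-at : ∀ {i r} → r ≢ i → ∀ {v} → A r v → Nb (C i) v → e i r ~ v
          meets-at {i} {r} n Av (s , s∈ , a) = subst (_~ _) (e-only n s∈ (_ , Av , ~-sym a)) a

          sees-only : ∀ {i r} → r ≢ i → ∀ {v w} → A r v → C i w → w ~ v → w ≡ e i r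
          sees-only n Av w∈ a = e-only n w∈ (_ , Av , ~-sym a)

          opaque
            -- The rows other than `i` touch the path at its ends only. So `path-center` with `x i`
            -- attached gives a claw whose two path ends can be prolonged into these rows.
            column-center : ∀ i (x : Fin 3 → V) → (∀ r → A r (x r)) → (∀ r → Nb (C i) (x r)) →
              Σ (Center (C i ⊕ x) x) λ K → (Center.c K ≡ x i × TwoOn (ℓ i) (x i)) ⊎
                                           (C i (Center.c K) × (∀ {v} → C i v → x i ~ v → v ≡ Center.c K))
            column-center i x Ax Nx with numbering (hd≢ i) (hd≢tl i ∘ sym) (tl≢ i)
              | path-center {W = λ v → C i v ⊎ v ≡ x i} (ℓ i) (ind i) inj₁ (inj₂ refl) (λ m → off i (Ax i) m refl) (head-ℓ i) (last-ℓ i)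
                  (proj₁ (proj₂ (Nx i))) (~-sym (proj₂ (proj₂ (Nx i))))
            ... | σ , σ-inj , σh , σi , σt | K , prop =
              extend [ inj₁ , (λ { refl → inj₂ (i , refl) }) ]′ (λ j → inj₂ (j , refl)) (λ n → AA n (Ax _) (Ax _)) att
                (permute K σ σ-inj) , prop
              where
              p : Fin 3 → V
              p = ⟨ e i (hd i) , x i , e i (tl i) ⟩
              W : Pred
              W v = C i v ⊎ v ≡ x i
              prolonged : ∀ {r z} → r ≢ i → z ≡ e i r → x r ≡ z ⊎ (¬ W (x r) × z ~ x r × (∀ {w} → W w → w ~ x r → w ≡ z))
              prolonged {r} n refl = inj₂ ([ (λ m → off i (Ax r) m refl) , proj₁ (AA n (Ax r) (Ax i)) ]′ , meets-at n (Ax r) (Nx r) ,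
                λ { (inj₁ m) a → sees-only n (Ax r) m a ; (inj₂ refl) a → ⊥-elim (proj₂ (AA (n ∘ sym) (Ax i) (Ax r)) a) })
              att : ∀ r → x r ≡ p (σ r) ⊎ (¬ W (x r) × p (σ r) ~ x r × (∀ {w} → W w → w ~ x r → w ≡ p (σ r)))
              att r with cover (hd≢ i) (hd≢tl i ∘ sym) (tl≢ i) r
              ... | inj₁ refl = prolonged (hd≢ i) (cong p σh)
              ... | inj₂ (inj₁ refl) = inj₁ (sym (cong p σi))
              ... | inj₂ (inj₂ refl) = prolonged (tl≢ i) (cong p σt)

          -- As `D` is small, the claw on its side has its centre in `D`, which is separated from
          -- column `i`. The other centre must then be `x i`, and since the centres meet, `x i` sees
          -- `D` too.
          two-on-C : ∀ i (λs : ∀ r → Link (A r) (Nb (C i)) (Nb D)) → TwoOn (ℓ i) (Link.x (λs i)) × Nb D (Link.x (λs i))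
          two-on-C i λs with column-center i (λ r → Link.x (λs r)) (λ r → Link.Q⊂ (λs r) (Link.x∈ (λs r))) (λ r → Link.Fx (λs r))
          ... | K , prop = go prop (centers-meet T.linkage K T.D')
            where
            module T = Through λs (off i) offD (CD i) (cC i) cD
            c' = Center.c T.D'
            Dc' : D c'
            Dc' = T.leafless' T.D' (Small⇒Leafy smD) (Center.c∈ T.D')
            w = Link.x (λs i)
            Aw : A i w
            Aw = Link.Q⊂ (λs i) (Link.x∈ (λs i))
            go : (Center.c K ≡ w × TwoOn (ℓ i) w) ⊎ (C i (Center.c K) × _) → Center.c K ≡ c' ⊎ Center.c K ~ c' →
                 TwoOn (ℓ i) w × Nb D w
            go (inj₂ (m , _)) meet with CD i m Dc'
            ... | a , b = ⊥-elim ([ a , b ]′ meet)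
            go (inj₁ (q , _)) (inj₁ r) = ⊥-elim (offD Aw Dc' (trans (sym q) r))
            go (inj₁ (q , t)) (inj₂ r) = t , c' , Dc' , ~-sym (subst (_~ c') q r)

          links-to-D : ∀ i r → Link (A r) (Nb (C i)) (Nb D)
          links-to-D i = links-through (C? i) D? (sees-C i) seesD

          opaque
            two-on-link : ∀ i (new : Link (A i) (Nb (C i)) (Nb D)) → TwoOn (ℓ i) (Link.x new) × Nb D (Link.x new)
            two-on-link i new = subst (λ q → TwoOn (ℓ i) (Link.x q) × Nb D (Link.x q)) (at-self i new (links-to-D i))
              (two-on-C i (at i new (links-to-D i)))

          opaque
            -- The walk contains a link from column `i` to `D`, and the end of this link at the
            -- column already sees `D`. In row `i` there is thus no way from the column to `D`
            -- around the vertices seeing both.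
            on-walk : ∀ {i} {S : Pred} → (∀ {v} → S v → A i v) → ∀ {f l} → S f → Nb (C i) f → Nb D l → Walk S f l →
                      ∃[ w ] (S w × TwoOn (ℓ i) w × Nb D w)
            on-walk {i} S⊂ Sf Nf Nl w with link (Nb? (C? i)) (Nb? D?) Sf Nf Nl w
            ... | λ₀ = Link.x λ₀ , Link.Q⊂ λ₀ (Link.x∈ λ₀) , two-on-link i
              (record { x = x ; y = y ; Q = Q ; Q⊂ = S⊂ ∘ Q⊂ ; x∈ = x∈ ; y∈ = y∈ ; Fx = Fx ; Ly = Ly ; only-x = only-x ; only-y = only-y ; conn = conn })
              where open Link λ₀

          opaque
            two-on : ∀ {i w} → A i w → Nb (C i) w → Nb D w → TwoOn (ℓ i) w
            two-on {i} Aw Nw Mw = proj₁ (two-on-link i (trivial-link Aw Nw Mw))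

          -- The claws at columns `i` and `j` have adjacent centres: `a` in row `i` is one, and
          -- `e j i` in column `j` the other. The latter is then the only neighbour on column `j` of
          -- the link end in row `j`.
          record Arrow (i j : Fin 3) : Set₁ where
            field
              a      : V
              Aa     : A i a
              aC     : Nb (C i) a
              a~e    : a ~ e j i
              λ₀     : Link (A j) (Nb (C i)) (Nb (C j))
              y-only : ∀ {v} → C j v → Link.y λ₀ ~ v → v ≡ e j i

          reverse : ∀ {S F L : Pred} → Link S F L → Link S L F
          reverse q = record
            { x = y ; y = x ; Q = Q ; Q⊂ = Q⊂ ; x∈ = y∈ ; y∈ = x∈ ; Fx = Ly ; Ly = Fx ; only-x = only-y ; only-y = only-x ; conn = conn }
            where open Link q

          module _ {i j} (n : i ≢ j) (λs : ∀ r → Link (A r) (Nb (C i)) (Nb (C j))) where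
            private
              x y : Fin 3 → V
              x r = Link.x (λs r)
              y r = Link.y (λs r)
              Ax : ∀ r → A r (x r)
              Ax r = Link.Q⊂ (λs r) (Link.x∈ (λs r))
              Ay : ∀ r → A r (y r)
              Ay r = Link.Q⊂ (λs r) (Link.y∈ (λs r))

            arrow-cases : ∀ {c c'} → (c ≡ x i × TwoOn (ℓ i) (x i)) ⊎ (C i c × (∀ {v} → C i v → x i ~ v → v ≡ c)) →
                    (c' ≡ y j × TwoOn (ℓ j) (y j)) ⊎ (C j c' × (∀ {v} → C j v → y j ~ v → v ≡ c')) →
                    c ≡ c' ⊎ c ~ c' → Arrow i j ⊎ Arrow j i
            arrow-cases (inj₂ (m , _)) (inj₂ (m' , _)) meet with CC n m m'
            ... | u , v = ⊥-elim ([ u , v ]′ meet)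
            arrow-cases (inj₁ (refl , _)) (inj₁ (refl , _)) meet with AA n (Ax i) (Ay j)
            ... | u , v = ⊥-elim ([ u , v ]′ meet)
            arrow-cases (inj₁ (refl , _)) (inj₂ (m' , _)) (inj₁ r) = ⊥-elim (off j (Ax i) m' r)
            arrow-cases {_} {c'} (inj₁ (refl , _)) (inj₂ (m' , only)) (inj₂ r) = inj₁ record
              { a = x i ; Aa = Ax i ; aC = Link.Fx (λs i) ; a~e = subst (x i ~_) c'≡e r ; λ₀ = λs j
              ; y-only = λ v∈ f → trans (only v∈ f) c'≡e }
              where
              c'≡e : c' ≡ e j i
              c'≡e = sees-only n (Ax i) m' (~-sym r)
            arrow-cases (inj₂ (m , _)) (inj₁ (refl , _)) (inj₁ r) = ⊥-elim (off i (Ay j) m (sym r))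
            arrow-cases {c} (inj₂ (m , only)) (inj₁ (refl , _)) (inj₂ r) = inj₂ record
              { a = y j ; Aa = Ay j ; aC = Link.Ly (λs j) ; a~e = subst (y j ~_) c≡e (~-sym r) ; λ₀ = reverse (λs i)
              ; y-only = λ v∈ f → trans (only v∈ f) c≡e }
              where
              c≡e : c ≡ e i j
              c≡e = sees-only (n ∘ sym) (Ay j) m r

            arrow-through : Arrow i j ⊎ Arrow j i
            arrow-through = go (column-center i x Ax (λ r → Link.Fx (λs r))) (column-center j y Ay (λ r → Link.Ly (λs r)))
              where
              go : (Σ (Center (C i ⊕ x) x) λ K → (Center.c K ≡ x i × TwoOn (ℓ i) (x i)) ⊎
                                             (C i (Center.c K) × (∀ {v} → C i v → x i ~ v → v ≡ Center.c K))) →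
                   (Σ (Center (C j ⊕ y) y) λ K → (Center.c K ≡ y j × TwoOn (ℓ j) (y j)) ⊎
                                             (C j (Center.c K) × (∀ {v} → C j v → y j ~ v → v ≡ Center.c K))) → Arrow i j ⊎ Arrow j i
              go (K , p) (K' , p') = arrow-cases p p'
                (centers-meet (Through.linkage λs (off i) (off j) (CC n) (cC i) (cC j)) K K')

          opaque
            arrow : ∀ {i j} → i ≢ j → Arrow i j ⊎ Arrow j i
            arrow {i} {j} n = arrow-through n (links-through (C? i) (C? j) (sees-C i) (sees-C j))

          -- Otherwise `on-walk` finds a vertex of the link with two nonadjacent neighbours on
          -- column `j`. Only `y` sees this column, and it has a single neighbour there.
          linked-far-from-D : ∀ {i j} (α : Arrow i j) → ∀ {v} → Link.Q (Arrow.λ₀ α) v → ¬ Nb D v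
          linked-far-from-D α {v} Qv Nv with on-walk Q⊂ y∈ Ly Nv (conn y∈ Qv)
            where open Link (Arrow.λ₀ α)
          ... | w , Qw , (a , b , a∈ , b∈ , sp , wa , wb) , _ with Link.only-y (Arrow.λ₀ α) Qw (a , a∈ , ~-sym wa)
          ...   | refl = proj₁ sp (trans (Arrow.y-only α a∈ wa) (sym (Arrow.y-only α b∈ wb)))

          -- The row vertices fit for a detour around a column: they miss `D` and touch columns at
          -- their ends only, hence never an inner piece of a column.
          Good : Pred
          Good v = (∃[ r ] A r v) × ¬ Nb D v × (∀ m {u} → C m u → v ~ u → ∃[ r ] (r ≢ m × u ≡ e m r))

          linked-good : ∀ {i j} → i ≢ j → (α : Arrow i j) → ∀ {v} → Link.Q (Arrow.λ₀ α) v → Good v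
          linked-good {i} {j} n α {v} Qv = (j , Q⊂ Qv) , linked-far-from-D α Qv , at-end
            where
            open Link (Arrow.λ₀ α)
            at-end : ∀ m {u} → C m u → v ~ u → ∃[ r ] (r ≢ m × u ≡ e m r)
            at-end m {u} u∈ a with m ≟ j
            ... | no q = j , q ∘ sym , sees-only (q ∘ sym) (Q⊂ Qv) u∈ (~-sym a)
            ... | yes refl with only-y Qv (u , u∈ , ~-sym a)
            ...   | refl = i , n , Arrow.y-only α u∈ a

          Local : Fin 3 → Fin 3 → Pred
          Local i j v = Good v ⊎ v ≡ e i j ⊎ v ≡ e j i

          along-arrow : ∀ {i j} → i ≢ j → Arrow i j → Walk (Local i j) (e i j) (e j i)
          along-arrow {i} {j} n α = step (meets-at (n ∘ sym) (Q⊂ x∈) Fx) (inj₁ (linked-good n α x∈))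
            (mapW (inj₁ ∘ linked-good n α) walk +w edge y~e (inj₂ (inj₂ refl)))
            where
            open Link (Arrow.λ₀ α)
            y~e : y ~ e j i
            y~e with Ly
            ... | s , s∈ , a = subst (y ~_) (Arrow.y-only α s∈ (~-sym a)) (~-sym a)

          local : ∀ {i j} → i ≢ j → Walk (Local i j) (e i j) (e j i)
          local n with arrow n
          ... | inj₁ α = along-arrow n α
          ... | inj₂ α = revW (mapW [ inj₁ , [ inj₂ ∘ inj₂ , inj₂ ∘ inj₁ ]′ ]′ (along-arrow (n ∘ sym) α)) (inj₂ (inj₂ refl))

          Ring : Fin 3 → Pred
          Ring i v = Good v ⊎ (∃[ m ] (m ≢ i × C m v)) ⊎ (∃[ r ] (r ≢ i × v ≡ e i r))

          -- The way from one end of column `i` to the other runs along the other two columns and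
          -- changes columns through good vertices.
          ring : ∀ {i j k} → i ≢ j → k ≢ i → k ≢ j → Walk (Ring i) (e i j) (e i k)
          ring {i} {j} {k} ij ki kj =
            mapW [ inj₁ , [ (λ q → inj₂ (inj₂ (j , ij ∘ sym , q))) , (λ { refl → inC (ij ∘ sym) (e∈ ij) }) ]′ ]′ (local ij) +w
            mapW (inC (ij ∘ sym)) (cC j (e∈ ij) (e∈ kj)) +w
            mapW [ inj₁ , [ (λ { refl → inC (ij ∘ sym) (e∈ kj) }) , (λ { refl → inC ki (e∈ (kj ∘ sym)) }) ]′ ]′ (local (kj ∘ sym)) +w
            mapW (inC ki) (cC k (e∈ (kj ∘ sym)) (e∈ (ki ∘ sym))) +w
            mapW [ inj₁ , [ (λ { refl → inC ki (e∈ (ki ∘ sym)) }) , (λ q → inj₂ (inj₂ (k , ki , q))) ]′ ]′ (local ki)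
            where
            inC : ∀ {m v} → m ≢ i → C m v → Ring i v
            inC n v∈ = inj₂ (inj₁ (_ , n , v∈))

          ring-off-D : ∀ {i} → Sep D (Ring i)
          ring-off-D d (inj₁ ((_ , Av) , ¬N , _)) = (λ q → offD Av d (sym q)) , λ a → ¬N (_ , d , a)
          ring-off-D d (inj₂ (inj₁ (m , _ , v∈))) = Sp-sym (CD m v∈ d)
          ring-off-D d (inj₂ (inj₂ (r , n , refl))) = Sp-sym (CD _ (e∈ n) d)

          -- Two vertices of a row seeing both its column and D

          module _ {i} (τ : Touch D i) {u u'} (Au : A i u) (Au' : A i u') (Du : Nb D u) (Du' : Nb D u') (u≢u' : u ≢ u') where
            open Touch τ

            private
              t~ : ∀ {v} → A i v → Nb D v → t ~ v
              t~ Av (d , Dd , a) = subst (_~ _) (only Dd (_ , Av , ~-sym a)) a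

              uu' : Sp u u'
              uu' = u≢u' , λ a → no-triangle (t~ Au Du) a (t~ Au' Du')

            -- linking the initial segment P of column i to D through u, u' and the row meeting the head of P
            module Initial {P α} (iP : Ind P) (P⊂ : ∀ {v} → v ∈ P → C i v) (h : Head (e i (hd i)) P) (l : Last α P)
              (u'~α : u' ~ α) (only-α : ∀ {v} → v ∈ P → u' ~ v → v ≡ α)
              (λ₀ : Link (A (hd i)) (Nb (C i)) (Nb D)) where

              private
                open Link λ₀ renaming (x to s; y to w)
                j = hd i
                As : A j s
                As = Q⊂ x∈
                xs ys : Fin 3 → V
                xs = ⟨ s , u , u' ⟩
                ys = ⟨ w , u , u' ⟩
                QS : Fin 3 → Pred
                QS = ⟨ Q , u ≡_ , u' ≡_ ⟩
                QQ : ∀ {j k} → j ≢ k → Sep (QS j) (QS k)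
                QQ = sep3 {R = QS} (λ { q refl → AA (hd≢ i) (Q⊂ q) Au }) (λ { q refl → AA (hd≢ i) (Q⊂ q) Au' }) (λ { refl refl → uu' })
                X∈ : ∀ k → QS k (xs k)
                X∈ = all3 x∈ refl refl
                Y∈ : ∀ k → QS k (ys k)
                Y∈ = all3 y∈ refl refl
                PQ : ∀ k {a v} → a ∈ P → QS k v → v ≡ xs k ⊎ Sp a v
                PQ 0F a∈ q = equal-or-Sp (off i (Q⊂ q) (P⊂ a∈) ∘ sym) (λ f → only-x q (_ , P⊂ a∈ , f))
                PQ 1F a∈ refl = inj₁ refl
                PQ 2F a∈ refl = inj₁ refl
                DQ : ∀ k {a v} → D a → QS k v → v ≡ ys k ⊎ Sp a v
                DQ 0F a∈ q = equal-or-Sp (offD (Q⊂ q) a∈ ∘ sym) (λ f → only-y q (_ , a∈ , f))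
                DQ 1F a∈ refl = inj₁ refl
                DQ 2F a∈ refl = inj₁ refl
                ℒ : Linkage (_∈ P) D QS xs ys
                ℒ = record
                  { x∈ = X∈ ; y∈ = Y∈ ; walk = all3 walk nil nil ; QQ = QQ
                  ; AA' = λ a d → CD i (P⊂ a) d ; AQ = PQ ; A'Q = DQ }
                opaque
                  K' : Center (D ⊕ ys) ys
                  K' = connected-center (⊕-conn cD (all3 Ly Du Du')) ys (λ k → inj₂ (k , refl))
                c'∈D : D (Center.c K')
                c'∈D with Center.c∈ K'
                ... | inj₁ d = d
                ... | inj₂ (k , q) with two-neighbours K' (λ n → QQ n (Y∈ _) (Y∈ _)) k q
                ...   | a , b , Da , Db , (p , p') , _ = ⊥-elim ([ p , p' ]′ (smD Da Db))
                W : Pred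
                W v = v ∈ P ⊎ v ≡ u
                p : Fin 3 → V
                p = ⟨ e i j , u , α ⟩
                att : ∀ k → xs k ≡ p k ⊎ (¬ W (xs k) × p k ~ xs k × (∀ {v} → W v → v ~ xs k → v ≡ p k))
                att 0F = inj₂ ([ (λ m → off i As (P⊂ m) refl) , proj₁ (AA (hd≢ i) As Au) ]′ , meets-at (hd≢ i) As Fx ,
                  λ { (inj₁ m) a → sees-only (hd≢ i) As (P⊂ m) a ; (inj₂ refl) a → ⊥-elim (proj₂ (AA (hd≢ i) As Au) (~-sym a)) })
                att 1F = inj₁ refl
                att 2F = inj₂ ([ (λ m → off i Au' (P⊂ m) refl) , u≢u' ∘ sym ]′ , ~-sym u'~α ,
                  λ { (inj₁ m) a → only-α m (~-sym a) ; (inj₂ refl) a → ⊥-elim (proj₂ uu' a) })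
                extended : Center W p → Center ((_∈ P) ⊕ xs) xs
                extended = extend [ inj₁ , (λ { refl → inj₂ (1F , refl) }) ]′ (λ k → inj₂ (k , refl)) (λ n → QQ n (X∈ _) (X∈ _)) att
                cases : ∀ {c c'} → (c ≡ u × TwoOn P u) ⊎ (c ∈ P × (∀ {v} → v ∈ P → u ~ v → v ≡ c)) →
                        D c' → c ≡ c' ⊎ c ~ c' → TwoOn P u
                cases (inj₁ (_ , contact)) _ _ = contact
                cases (inj₂ (m , _)) d meet with CD i (P⊂ m) d
                ... | a , b = ⊥-elim ([ a , b ]′ meet)

              opaque
                -- The claw on the other side has its centre in `D`, which is separated from `P`. So
                -- the centre on this side is not on `P` and must be `u`.
                left-two : ∀ {w} → w ∈ P → u ~ w → TwoOn P u
                left-two w∈ u~w = go (path-center {W = W} P iP inj₁ (inj₂ refl) (λ m → off i Au (P⊂ m) refl) h l w∈ u~w)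
                 where
                 go : Σ (Center W p) (λ K → (Center.c K ≡ u × TwoOn P u) ⊎
                        (Center.c K ∈ P × (∀ {v} → v ∈ P → u ~ v → v ≡ Center.c K))) → TwoOn P u
                 go (K , prop) = cases prop c'∈D (centers-meet ℒ (extended K) K')

            -- the theta joins u to u' through D, through inner, and through front, the ring and rear
            module Around {a₁ φ z m₁ s b₁ α y mid β post} (eq : ℓ i ≡ (a₁ ++ φ ∷ (z ∷ m₁) ++ s ∷ b₁) ++ y ∷ mid ++ β ∷ post)
              (iP : Ind (a₁ ++ φ ∷ (z ∷ m₁) ++ s ∷ b₁)) (h : Head (e i (hd i)) (a₁ ++ φ ∷ (z ∷ m₁) ++ s ∷ b₁))
              (l : Last α (a₁ ++ φ ∷ (z ∷ m₁) ++ s ∷ b₁))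
              (u'~α : u' ~ α) (u'~β : u' ~ β) (u~φ : u ~ φ) (u~s : u ~ s) where

              private
                P front inner rear : List V
                P = a₁ ++ φ ∷ (z ∷ m₁) ++ s ∷ b₁
                front = a₁ ++ [ φ ]
                inner = m₁ ++ s ∷ b₁
                rear = β ∷ post

                iℓ : Ind (P ++ y ∷ mid ++ rear)
                iℓ = subst Ind eq (ind i)

                eP : P ≡ front ++ z ∷ inner
                eP = sym (++-assoc a₁ [ φ ] (z ∷ inner))

                iP' : Ind (front ++ z ∷ inner)
                iP' = subst Ind eP iP

                eq' : ℓ i ≡ (P ++ y ∷ mid) ++ rear
                eq' = trans eq (sym (++-assoc P (y ∷ mid) rear))

                P⊂ : ∀ {v} → v ∈ P → C i v
                P⊂ m = subst (_ ∈_) (sym eq) (∈-++⁺ˡ m)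
                front⊂ : ∀ {v} → v ∈ front → v ∈ P
                front⊂ m = subst (_ ∈_) (sym eP) (∈-++⁺ˡ m)
                inner⊂ : ∀ {v} → v ∈ inner → v ∈ P
                inner⊂ m = subst (_ ∈_) (sym eP) (∈-++⁺ʳ front (there m))
                rear⊂ : ∀ {v} → v ∈ rear → C i v
                rear⊂ m = subst (_ ∈_) (sym eq') (∈-++⁺ʳ (P ++ y ∷ mid) m)

                front-inner : Sep (_∈ front) (_∈ inner)
                front-inner = Ind-gap front iP'
                inner-rear : Sep (_∈ inner) (_∈ rear)
                inner-rear m m' = Ind-gap P iℓ (inner⊂ m) (∈-++⁺ʳ mid m')

                head∈ : e i (hd i) ∈ front
                head∈ = Head-∈ a₁ h
                last∈ : e i (tl i) ∈ rear
                last∈ = Last-∈ (P ++ y ∷ mid) (subst (Last _) eq' (last-ℓ i))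
                α∈ : α ∈ inner
                α∈ = ∈-++⁺ʳ m₁ (Last-∈ (a₁ ++ φ ∷ z ∷ m₁) (subst (Last α) (sym (++-assoc a₁ (φ ∷ z ∷ m₁) (s ∷ b₁))) l))

                c-front : Conn (_∈ front)
                c-front = Ind-conn (Ind-prefix a₁ iP)
                c-inner : Conn (_∈ inner)
                c-inner = tail-conn (Ind-suffix front iP')
                c-rear : Conn (_∈ rear)
                c-rear = Ind-conn (Ind-suffix (P ++ y ∷ mid) (subst Ind eq' (ind i)))

                end∉ : ∀ {r v} → r ≢ i → v ∈ inner → Sp v (e i r)
                end∉ {r} n m with cover (hd≢ i) (hd≢tl i ∘ sym) (tl≢ i) r
                ... | inj₁ refl = Sp-sym (front-inner head∈ m)
                ... | inj₂ (inj₁ q) = ⊥-elim (n q)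
                ... | inj₂ (inj₂ refl) = inner-rear m last∈

                inner-ring : Sep (_∈ inner) (Ring i)
                inner-ring m (inj₁ ((r , Av) , _ , ends)) = (λ q → off i Av (P⊂ (inner⊂ m)) (sym q)) , λ a → bad (ends i (P⊂ (inner⊂ m)) (~-sym a))
                  where
                  bad : ∃[ r ] (r ≢ i × _ ≡ e i r) → ⊥
                  bad (r , n , q) = proj₁ (end∉ n m) q
                inner-ring m (inj₂ (inj₁ (k , n , v∈))) = CC (n ∘ sym) (P⊂ (inner⊂ m)) v∈
                inner-ring m (inj₂ (inj₂ (r , n , refl))) = end∉ n m

                Outer : Pred
                Outer v = v ∈ front ⊎ Ring i v ⊎ v ∈ rear

                D-outer : Sep D Outer
                D-outer d (inj₁ m) = Sp-sym (CD i (P⊂ (front⊂ m)) d)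
                D-outer d (inj₂ (inj₁ r)) = ring-off-D d r
                D-outer d (inj₂ (inj₂ m)) = Sp-sym (CD i (rear⊂ m) d)

                inner-outer : Sep (_∈ inner) Outer
                inner-outer m (inj₁ m') = Sp-sym (front-inner m' m)
                inner-outer m (inj₂ (inj₁ r)) = inner-ring m r
                inner-outer m (inj₂ (inj₂ m')) = inner-rear m m'

                S : Fin 3 → Pred
                S = ⟨ D , _∈ inner , Outer ⟩

                S-sep : ∀ {j k} → j ≢ k → Sep (S j) (S k)
                S-sep = sep3 {R = S} (λ d m → Sp-sym (CD i (P⊂ (inner⊂ m)) d)) D-outer inner-outer

                walks : ∀ j → Walk (S j ∪ (_≡ u')) u u'
                walks = all3
                  (step (~-sym (t~ Au Du)) (inj₁ t∈) (edge (t~ Au' Du') (inj₂ refl)))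
                  (step u~s (inj₁ s∈) (mapW inj₁ (c-inner s∈ α∈) +w edge (~-sym u'~α) (inj₂ refl)))
                  (step u~φ (inj₁ (inj₁ φ∈)) (mapW (inj₁ ∘ inj₁) (c-front φ∈ head∈) +w
                    mapW (inj₁ ∘ inj₂ ∘ inj₁) (ring (hd≢ i ∘ sym) (tl≢ i) (hd≢tl i ∘ sym)) +w
                    mapW (inj₁ ∘ inj₂ ∘ inj₂) (c-rear last∈ (here refl)) +w edge (~-sym u'~β) (inj₂ refl)))
                  where
                  s∈ : s ∈ inner
                  s∈ = ∈-++⁺ʳ m₁ (here refl)
                  φ∈ : φ ∈ front
                  φ∈ = ∈-++⁺ʳ a₁ (here refl)

              around : ⊥
              around = noTheta (theta uu' (λ j → S j ∪ (_≡ u')) walks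
                λ { n (inj₁ p) (inj₁ q) _ _ _ _ → S-sep n p q
                  ; n (inj₂ p) _ _ b _ _ → ⊥-elim (b p)
                  ; n _ (inj₂ q) _ _ _ d → ⊥-elim (d q) })

            -- The initial segment ends at the first contact `α` of `u'`. A contact of `u` with it
            -- entails two nonadjacent ones, at which the segment is cut into the front and inner
            -- pieces of the theta.
            outer-hole : ∀ pre {α y mid β post} → ℓ i ≡ pre ++ α ∷ y ∷ mid ++ β ∷ post → u' ~ α → u' ~ β →
                         (∀ {v} → v ∈ pre → ¬ (u' ~ v)) → ∀ {w} → w ∈ pre ++ [ α ] → u ~ w → ⊥
            outer-hole pre {α} {y} {mid} {β} {post} eq u'~α u'~β before w∈ u~w =
              go (trans eq (sym (++-assoc pre [ α ] (y ∷ mid ++ β ∷ post)))) (Ind-prefix pre (subst Ind eq (ind i)))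
                (Head-front pre (subst (Head _) eq (head-ℓ i))) (Last-snoc pre) only-α w∈ u~w
              where
              only-α : ∀ {v} → v ∈ pre ++ [ α ] → u' ~ v → v ≡ α
              only-α m f with ∈-++⁻ pre m
              ... | inj₁ q = ⊥-elim (before q f)
              ... | inj₂ (here q) = q
              go : ∀ {P} → ℓ i ≡ P ++ y ∷ mid ++ β ∷ post → Ind P → Head (e i (hd i)) P → Last α P →
                   (∀ {v} → v ∈ P → u' ~ v → v ≡ α) → ∀ {w} → w ∈ P → u ~ w → ⊥
              go {P} eq iP h l only-α w∈ u~w
                with split iP (Initial.left-two iP (λ m → subst (_ ∈_) (sym eq) (∈-++⁺ˡ m)) h l u'~α only-α (links-to-D i (hd i)) w∈ u~w)
              ... | splits a₁ φ z m₁ s b₁ refl uφ us _ = Around.around {a₁} {φ} {z} {m₁} {s} {b₁} eq iP h l u'~α u'~β uφ us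

          -- The vertex whose first contact with the column comes later takes the part of `u'` in
          -- `outer-hole`.
          hole : ∀ {i} → Touch D i → ∀ {u u'} → A i u → A i u' → Nb (C i) u → Nb (C i) u' → Nb D u → Nb D u' → u ≢ u' → ⊥
          hole {i} τ {u} {u'} Au Au' Cu Cu' Du Du' ne with split (ind i) (two-on Au' Cu' Du')
          ... | splits pre α y mid β post eq u'α u'β before with Any.any? (λ v → u ~? v) (pre ++ [ α ])
          ...   | yes m = outer-hole τ Au Au' Du Du' ne pre eq u'α u'β before (proj₁ (proj₂ (find m))) (proj₂ (proj₂ (find m)))
          ...   | no none-front with split (Ind-suffix (pre ++ [ α ]) (subst Ind eq' (ind i))) (rest (two-on Au Cu Du))
            where
            eq' : ℓ i ≡ (pre ++ [ α ]) ++ y ∷ mid ++ β ∷ post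
            eq' = trans eq (sym (++-assoc pre [ α ] _))
            back : ∀ {v} → u ~ v → C i v → v ∈ y ∷ mid ++ β ∷ post
            back f m with ∈-++⁻ (pre ++ [ α ]) (subst (_ ∈_) eq' m)
            ... | inj₁ q = ⊥-elim (none-front (lose q f))
            ... | inj₂ q = q
            rest : TwoOn (ℓ i) u → TwoOn (y ∷ mid ++ β ∷ post) u
            rest (a , b , a∈ , b∈ , sp , ua , ub) = a , b , back ua a∈ , back ub b∈ , sp , ua , ub
          ...     | splits pre' α' y' mid' β' post' eq'' uα uβ before' =
            outer-hole τ Au' Au Du' Du (ne ∘ sym) ((pre ++ [ α ]) ++ pre')
              (trans eq (trans (sym (++-assoc pre [ α ] _)) (trans (cong ((pre ++ [ α ]) ++_) eq'') (sym (++-assoc (pre ++ [ α ]) pre' _)))))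
              uα uβ none-before (∈-++⁺ˡ (∈-++⁺ˡ (∈-++⁺ʳ pre (here refl)))) u'α
            where
            none-before : ∀ {v} → v ∈ (pre ++ [ α ]) ++ pre' → ¬ (u ~ v)
            none-before m f with ∈-++⁻ (pre ++ [ α ]) m
            ... | inj₁ q = none-front (lose q f)
            ... | inj₂ q = before' q f

          -- row i without all but one of its neighbours of D
          record Trimmed (i : Fin 3) : Set₁ where
            field
              M      : Pred
              M⊂     : ∀ {v} → M v → A i v
              cM     : Conn M
              u      : V
              Mu     : M u
              Du     : Nb D u
              only-u : ∀ {v} → M v → Nb D v → v ≡ u
              hasC   : ∀ {v} → A i v → Nb (C i) v → M v
              sees-e : ∀ {j} → j ≢ i → Nb M (e j i)

          -- A vertex `u` seeing both column `i` and `D` exists by `on-walk` and is unique by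
          -- `hole`. The trimmed row is what can be reached from it through vertices that miss `D`.
          trimmed : ∀ i → Touch D i → Trimmed i
          trimmed i τ with sees-C i i | seesD i
          ... | s , s∈ , a , Aa , a~s | d , Dd , b , Ab , b~d with on-walk id Aa (s , s∈ , ~-sym a~s) (d , Dd , ~-sym b~d) (cA i Aa Ab)
          ...   | u , Au , (p , _ , p∈ , _ , _ , up , _) , Du = record
            { M = M ; M⊂ = endIn Au ∘ mapW proj₁ ; cM = λ m m' → revW (inM m) nil +w inM m' ; u = u ; Mu = nil ; Du = Du
            ; only-u = only-u ; hasC = hasC ; sees-e = λ n → sees-e n (arrow (n ∘ sym)) }
            where
            Free : Pred
            Free v = A i v × ¬ Nb D v
            M : Pred
            M v = Walk Free u v
            inM : ∀ {v} → M v → Walk M u v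
            inM m = mapW proj₂ (trackW m)
            Cu : Nb (C i) u
            Cu = p , p∈ , ~-sym up
            same : ∀ {v} → A i v → Nb (C i) v → Nb D v → v ≡ u
            same {v} Av Cv Dv with v ≟ u
            ... | yes q = q
            ... | no n = ⊥-elim (hole τ Av Au Cv Cu Dv Du n)
            only-u : ∀ {v} → M v → Nb D v → v ≡ u
            only-u {v} m Dv with v ≟ u
            ... | yes q = q
            ... | no n = ⊥-elim (proj₂ (endW m (n ∘ sym)) Dv)
            -- On the way from `v` to `u`, let `t` be the first vertex that sees `D`. By `on-walk`
            -- some vertex up to `t` sees both `D` and column `i`; it can only be `t`, and by
            -- uniqueness it is `u`.
            hasC : ∀ {v} → A i v → Nb (C i) v → M v
            hasC {v} Av Cv with firstHit (Nb D) (Nb? D?) Av Du (cA i Av Au)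
            ... | t , At , Dt , inj₁ refl = subst M (sym (same Av Cv Dt)) nil
            ... | t , At , Dt , inj₂ (¬Dv , q , w , q~t , Aq , ¬Dq) = back
              (on-walk {S = λ v → Free v ⊎ v ≡ t} [ proj₁ , (λ { refl → At }) ]′ (inj₁ (Av , ¬Dv)) Cv Dt (mapW inj₁ w +w edge q~t (inj₂ refl)))
              where
              back : ∃[ w ] ((Free w ⊎ w ≡ t) × TwoOn (ℓ i) w × Nb D w) → M v
              back (w' , inj₁ (_ , ¬D) , _ , D') = ⊥-elim (¬D D')
              back (w' , inj₂ refl , (x , _ , x∈ , _ , _ , tx , _) , _) =
                subst (λ z → Walk Free z v) (same At (x , x∈ , ~-sym tx) Dt) (step (~-sym q~t) (Aq , ¬Dq) (revW w (Av , ¬Dv)))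
            -- In one direction the arrow supplies a neighbour `a` of `e j i` that sees column `i`.
            -- In the other, its link runs in row `i`, misses `D`, and leads from a vertex seeing
            -- column `i` to a neighbour of `e j i`.
            sees-e : ∀ {j} → j ≢ i → Arrow i j ⊎ Arrow j i → Nb M (e j i)
            sees-e n (inj₁ α) = Arrow.a α , hasC (Arrow.Aa α) (Arrow.aC α) , Arrow.a~e α
            sees-e n (inj₂ α) = x , hasC (Q⊂ y∈) Ly +w revW (mapW free walk) (free x∈) , ~-sym (meets-at (n ∘ sym) (Q⊂ x∈) Fx)
              where
              open Link (Arrow.λ₀ α)
              free : ∀ {v} → Q v → Free v
              free q = Q⊂ q , linked-far-from-D α q

          -- Column `y` and `D` form the square, column `x` is the bridge. The contacts of `D` may
          -- be equal or adjacent, so their guard is that each has only one neighbour in its trimmed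
          -- row.
          no-leftover : ∀ {x y z} → x ≢ z → y ≢ x → y ≢ z → Touch D x → Touch D z → ⊥
          no-leftover {x} {y} {z} xz yx yz τx τz = go (trimmed x τx) (trimmed z τz)
            (link (R? x) (R? z) (proj₁ (proj₂ fx)) (proj₂ (proj₂ fx)) (eR (xz ∘ sym)) (cC x (proj₁ (proj₂ fx)) (e∈ (xz ∘ sym))))
            where
            fx = sees-C x x
            go : Trimmed x → Trimmed z → Link (C x) (R x) (R z) → ⊥
            go X Z λ₀ = no-square record
              { □ = square {M = X.M} {M' = Z.M} {C = A y} xz yx yz X.M⊂ Z.M⊂ X.cM Z.cM (CD y) (off y) offD (cC y) cD
                (e y x , e∈ (yx ∘ sym) , X.sees-e yx , λ { m (r , Mr , f) → e-only (yx ∘ sym) m (r , X.M⊂ Mr , f) })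
                (e y z , e∈ (yz ∘ sym) , Z.sees-e yz , λ { m (r , Mr , f) → e-only (yz ∘ sym) m (r , Z.M⊂ Mr , f) })
                (at-D τx X) (at-D τz Z) (sees-C y y) (seesD y)
              ; g₁ = inj₁ (e-far (yx ∘ sym) (yz ∘ sym) xz)
              ; g₂ = inj₂ ((λ Ma Mb f g → trans (leaf τx X Ma f) (sym (leaf τx X Mb g))) , λ Ma Mb f g → trans (leaf τz Z Ma f) (sym (leaf τz Z Mb g)))
              ; x∈ = x∈ ; y∈ = y∈ ; wQ = walk ; QB₁ = λ q b → CC (yx ∘ sym) (Q⊂ q) b ; QB₂ = λ q b → CD x (Q⊂ q) b
              ; RQ = λ m q → off x (X.M⊂ m) (Q⊂ q) , λ f → only-x q (_ , X.M⊂ m , f)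
              ; R'Q = λ m q → off x (Z.M⊂ m) (Q⊂ q) , λ f → only-y q (_ , Z.M⊂ m , f)
              ; Rx = first Fx ; R'y = subst (Nb Z.M) (sym (e-only (xz ∘ sym) (Q⊂ y∈) Ly)) (Z.sees-e xz)
              ; away = keep-away {S = C x} {x} {z} {y} (off x) (inj₂ (at-e yx , inj₂ (at-e (xz ∘ sym) , e-far (xz ∘ sym) yx (yz ∘ sym)))) (Q⊂ x∈) (Q⊂ y∈) Fx Ly }
              where
              module X = Trimmed X
              module Z = Trimmed Z
              open Link λ₀ hiding (conn) renaming (x to x₀; y to y₀)
              at-e : ∀ {i r} → r ≢ i → Touch (C i) r
              at-e n = record { t = e _ _ ; t∈ = e∈ n ; Rt = eR n ; only = e-only n }
              -- Trimming removes no row vertex that sees column `x`, so the contact survives.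
              first : R x x₀ → Nb X.M x₀
              first (a , Aa , f) = a , X.hasC Aa (x₀ , Q⊂ x∈ , ~-sym f) , f
              at-D : ∀ {i} (τ : Touch D i) (X : Trimmed i) → ∃[ v ] (D v × Nb (Trimmed.M X) v × (∀ {u} → D u → Nb (Trimmed.M X) u → u ≡ v))
              at-D τ X with Trimmed.Du X
              ... | d , Dd , f = d , Dd , (u , Mu , ~-sym f) , λ { Du (r , Mr , g) → trans (only Du (r , M⊂ Mr , g)) (sym (only Dd (u , M⊂ Mu , ~-sym f))) }
                where
                open Trimmed X hiding (Du)
                open Touch τ
              leaf : ∀ {i} (τ : Touch D i) (X : Trimmed i) → ∀ {v} → Trimmed.M X v → proj₁ (at-D τ X) ~ v → v ≡ Trimmed.u X
              leaf τ X Mv f = Trimmed.only-u X Mv (_ , proj₁ (proj₂ (at-D τ X)) , f)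

        -- Four columns

        module _ (B : Fin 3 → Pred) (K : ∀ i → Column R (B i)) (γ≡ : ∀ i → Column.γ (K i) ≡ i)
                 (sp : ∀ i → Sp (Column.a (K i)) (Column.b (K i)))
                 (shape : ∀ i → Shape (Column.S (K i)) (R (Column.γ (K i))) (Column.a (K i)) (Column.b (K i)))
                 (offB : ∀ i → Off (B i)) (BB : ∀ {i j} → i ≢ j → Sep (B i) (B j))
                 {BD : Pred} (KD : Column R BD) (offBD : Off BD) (BBD : ∀ i → Sep (B i) BD) (smD : Small (Column.S KD)) where

          private
            module K i = Column (K i)
            module D = Column KD

            ℓ : Fin 3 → List V
            ℓ i = K.a i ∷ Shape.ℓ (shape i)

            -- The value at `r ≡ i` is a filler: the laws required of spokes all assume `r ≢ i`.
            e : Fin 3 → Fin 3 → V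
            e i r with r ≟ K.α i
            ... | yes _ = K.a i
            ... | no _ = K.b i

            e-α : ∀ i → e i (K.α i) ≡ K.a i
            e-α i with K.α i ≟ K.α i
            ... | yes _ = refl
            ... | no n = ⊥-elim (n refl)

            e-β : ∀ i → e i (K.β i) ≡ K.b i
            e-β i with K.β i ≟ K.α i
            ... | yes q = ⊥-elim (K.α≢β i (sym q))
            ... | no _ = refl

            two-ends : ∀ {i r} → r ≢ i → r ≡ K.α i ⊎ r ≡ K.β i
            two-ends {i} {r} n with cover (K.α≢β i) (K.γ≢α i) (K.γ≢β i) r
            ... | inj₁ q = inj₁ q
            ... | inj₂ (inj₁ q) = inj₂ q
            ... | inj₂ (inj₂ q) = ⊥-elim (n (trans q (γ≡ i)))

            ℓ⊂ : ∀ i {v} → v ∈ ℓ i → B i v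
            ℓ⊂ i m = K.S⊂ i (Shape.ℓ⇒S (shape i) m)

            e∈ : ∀ {i r} → r ≢ i → e i r ∈ ℓ i
            e∈ {i} n with two-ends n
            ... | inj₁ refl = subst (_∈ ℓ i) (sym (e-α i)) (here refl)
            ... | inj₂ refl = subst (_∈ ℓ i) (sym (e-β i)) (Shape.S⇒ℓ (shape i) (K.Sb i))

            eR : ∀ {i r} → r ≢ i → R r (e i r)
            eR {i} n with two-ends n
            ... | inj₁ refl = subst (R (K.α i)) (sym (e-α i)) (K.Ra i)
            ... | inj₂ refl = subst (R (K.β i)) (sym (e-β i)) (K.Rb i)

            e-only : ∀ {i r} → r ≢ i → ∀ {v} → v ∈ ℓ i → R r v → v ≡ e i r
            e-only {i} n m rv with two-ends n
            ... | inj₁ refl = trans (K.only-a i (Shape.ℓ⇒S (shape i) m) rv) (sym (e-α i))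
            ... | inj₂ refl = trans (K.only-b i (Shape.ℓ⇒S (shape i) m) rv) (sym (e-β i))

            e-far : ∀ {i r s} → r ≢ i → s ≢ i → r ≢ s → Sp (e i r) (e i s)
            e-far {i} n m d with two-ends n | two-ends m
            ... | inj₁ refl | inj₁ refl = ⊥-elim (d refl)
            ... | inj₁ refl | inj₂ refl = subst (λ x → Sp x (e i (K.β i))) (sym (e-α i)) (subst (Sp (K.a i)) (sym (e-β i)) (sp i))
            ... | inj₂ refl | inj₁ refl = subst (λ x → Sp x (e i (K.α i))) (sym (e-β i)) (subst (Sp (K.b i)) (sym (e-α i)) (Sp-sym (sp i)))
            ... | inj₂ refl | inj₂ refl = ⊥-elim (d refl)

            sees-own : ∀ i → ∃[ v ] (v ∈ ℓ i × R i v)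
            sees-own i with sees (K i) i
            ... | v , Sv , r = v , Shape.S⇒ℓ (shape i) Sv , r

            last-ℓ : ∀ i → Last (e i (K.β i)) (ℓ i)
            last-ℓ i = subst (λ z → Last z (ℓ i)) (trans (Shape.endℓ (shape i)) (sym (e-β i))) (end-Last _ _)

            head-ℓ : ∀ i → Head (e i (K.α i)) (ℓ i)
            head-ℓ i = subst (λ z → Head z (ℓ i)) (sym (e-α i)) head

          three-paths-and-small : ⊥
          three-paths-and-small = Leftover.no-leftover spokes
            D.α≢β D.γ≢α D.γ≢β (touch KD D.α (D.γ≢α ∘ sym)) (touch KD D.β (D.γ≢β ∘ sym))
            where
            spokes : Spokes
            spokes = record
              { ℓ = ℓ ; ind = λ i → Shape.indℓ (shape i) ; hd = K.α ; tl = K.β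
              ; hd≢ = λ i q → K.γ≢α i (trans (γ≡ i) (sym q)) ; tl≢ = λ i q → K.γ≢β i (trans (γ≡ i) (sym q)) ; hd≢tl = K.α≢β
              ; e = e ; head-ℓ = head-ℓ ; last-ℓ = last-ℓ ; e∈ = e∈ ; eR = eR ; e-only = e-only ; e-far = e-far
              ; off = λ i Av m → offB i Av (ℓ⊂ i m) ; CC = λ n m m' → BB n (ℓ⊂ _ m) (ℓ⊂ _ m') ; seesC = sees-own
              ; D = D.S ; D? = D.S? ; cD = D.conn ; offD = λ Av d → offBD Av (D.S⊂ d) ; CD = λ i m d → BBD i (ℓ⊂ i m) (D.S⊂ d)
              ; smD = smD ; seesD = sees KD }

        Unique-third : ∀ {B} → Column R B → Set
        Unique-third K = ∀ {v} → Column.S K v → R (Column.γ K) v → v ≡ Column.g K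

        Unique-third⇒Leafy : ∀ {B} → Off B → (K : Column R B) → Unique-third K → Leafy (Column.S K)
        Unique-third⇒Leafy off K only-g {j} Av Sa Sb va vb (a≢b , _)
          with cover (Column.α≢β K) (Column.γ≢α K) (Column.γ≢β K) j
        ... | inj₁ refl = a≢b (trans (Column.only-a K Sa (_ , Av , va)) (sym (Column.only-a K Sb (_ , Av , vb))))
        ... | inj₂ (inj₁ refl) = a≢b (trans (Column.only-b K Sa (_ , Av , va)) (sym (Column.only-b K Sb (_ , Av , vb))))
        ... | inj₂ (inj₂ refl) = a≢b (trans (only-g Sa (_ , Av , va)) (sym (only-g Sb (_ , Av , vb))))

        not-two-leafy : ∀ {B B'} → Off B → Off B' → Sep B B' → (K : Column R B) (K' : Column R B') →
                        Leafy (Column.S K) → Leafy (Column.S K') → ⊥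
        not-two-leafy off off' BB' K K' = Through.two-leafy (links-through K.S? K'.S? (sees K) (sees K'))
          (λ Av s → off Av (K.S⊂ s)) (λ Av s → off' Av (K'.S⊂ s)) (λ s s' → BB' (K.S⊂ s) (K'.S⊂ s')) K.conn K'.conn
          where
          module K = Column K
          module K' = Column K'

        module _ (B : Fin 4 → Pred) (K : ∀ k → Column R (B k)) (offB : ∀ k → Off (B k)) (BB : ∀ {k l} → k ≢ l → Sep (B k) (B l)) where

          private
            module K k = Column (K k)

            Far : Fin 4 → Set
            Far k = Sp (K.a k) (K.b k)

            distinct-thirds : ∀ {k l m} → k ≢ l → m ≢ k → m ≢ l → Far k → Far l → Far m → K.γ k ≢ K.γ l
            distinct-thirds kl mk ml fk fl fm q =
              same-third (K _) (K _) (K _) (offB _) (offB _) (offB _) (BB kl) (BB mk) (BB ml) q fk fl fm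

            opaque
              other : ∀ (k l : Fin 4) → ∃[ m ] (m ≢ k × m ≢ l)
              other = toWitness {a? = all? λ (k : Fin 4) → all? λ (l : Fin 4) → any? λ m → ¬? (m ≟ k) ×-dec ¬? (m ≟ l)} _

            not-all-far : (∀ k → Far k) → ⊥
            not-all-far f with pigeonhole (s≤s (s≤s (s≤s (s≤s z≤n)))) K.γ
            ... | k , l , k<l , q with other k l
            ...   | m , mk , ml = distinct-thirds (<⇒≢ k<l) mk ml (f k) (f l) (f m) q

            module _ (k : Fin 4) (sm : Small (K.S k)) where

              opaque
                -- Small columns and far columns with three single contacts are leafy, and two leafy
                -- columns cannot coexist. The path remains.
                far-path : ∀ {l} → l ≢ k → Far l × Shape (K.S l) (R (K.γ l)) (K.a l) (K.b l)
                far-path {l} n with K.kind l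
                ... | inj₁ sm' = ⊥-elim (not-two-leafy (offB l) (offB k) (BB n) (K l) (K k) (Small⇒Leafy sm') (Small⇒Leafy sm))
                ... | inj₂ (sp , inj₁ s) = sp , s
                ... | inj₂ (sp , inj₂ u) =
                  ⊥-elim (not-two-leafy (offB l) (offB k) (BB n) (K l) (K k) (Unique-third⇒Leafy (offB l) (K l) u) (Small⇒Leafy sm))

              p : Fin 3 → Fin 4
              p = punchIn k

              p≢ : ∀ j → p j ≢ k
              p≢ j = punchInᵢ≢i k j

              opaque
                γ-inj : ∀ {i j} → i ≢ j → K.γ (p i) ≢ K.γ (p j)
                γ-inj {i} {j} n with third n
                ... | m , mi , mj = distinct-thirds (n ∘ punchIn-injective k i j) (mi ∘ punchIn-injective k m i) (mj ∘ punchIn-injective k m j)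
                  (proj₁ (far-path (p≢ i))) (proj₁ (far-path (p≢ j))) (proj₁ (far-path (p≢ m)))

              -- Three columns with pairwise distinct third rows exhaust the rows, so the columns
              -- can be indexed by their third rows.
              column-of : ∀ i → ∃[ j ] (K.γ (p j) ≡ i)
              column-of i with cover (γ-inj {0F} {1F} (λ ())) (γ-inj {2F} {0F} (λ ())) (γ-inj {2F} {1F} (λ ())) i
              ... | inj₁ q = 0F , sym q
              ... | inj₂ (inj₁ q) = 1F , sym q
              ... | inj₂ (inj₂ q) = 2F , sym q

              col : Fin 3 → Fin 4
              col i = p (proj₁ (column-of i))

              col-inj : ∀ {i j} → i ≢ j → col i ≢ col j
              col-inj {i} {j} n q = n (trans (sym (proj₂ (column-of i))) (trans (cong K.γ q) (proj₂ (column-of j))))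

              no-small : ⊥
              no-small = three-paths-and-small (B ∘ col) (K ∘ col) (λ i → proj₂ (column-of i))
                (λ i → proj₁ (far-path (p≢ _))) (λ i → proj₂ (far-path (p≢ _))) (offB ∘ col) (λ n → BB (col-inj n))
                (K k) (offB k) (λ i → BB (p≢ _)) sm

          no-four-columns : ⊥
          no-four-columns = not-all-far all-far
            where
            all-far : ∀ k → Far k
            all-far k with K.kind k
            ... | inj₁ sm = ⊥-elim (no-small k sm)
            ... | inj₂ (sp , _) = sp

      -- From a model of the bipartite graph to four columns

      module _ {H : Graph} (M : Model H G) (iso : H ≅ K 3 4) where

        open Model M

        private
          module F = Inverse (proj₁ iso)

          -- Branch sets are addressed through the isomorphism, so that the first three indices are
          -- the rows and the last four the columns.
          Class : Fin 7 → Pred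
          Class a v = lab v ≡ just (F.from a)

          Class? : ∀ a v → Dec (Class a v)
          Class? a v = ≡-dec _≟_ (lab v) (just (F.from a))

          from-injective : ∀ {a b} → F.from a ≡ F.from b → a ≡ b
          from-injective {a} {b} q = trans (sym (F.strictlyInverseˡ a)) (trans (cong F.to q) (F.strictlyInverseˡ b))

          adj-from : ∀ a b → adj H (F.from a) (F.from b) ≡ adj (K 3 4) a b
          adj-from a b = trans (sym (proj₂ iso _ _)) (cong₂ (adj (K 3 4)) (F.strictlyInverseˡ a) (F.strictlyInverseˡ b))

          disjoint : ∀ {a b} → a ≢ b → ∀ {u v} → Class a u → Class b v → u ≢ v
          disjoint n p q refl = n (from-injective (just-injective (trans (sym p) q)))

          separated : ∀ {a b} → a ≢ b → adj (K 3 4) a b ≡ false → Sep (Class a) (Class b)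
          separated {a} {b} n f p q = disjoint n p q , λ e →
            case-false (trans (sym f) (trans (sym (adj-from a b)) (edge⁻ p q (n ∘ from-injective) e)))
            where
            case-false : false ≡ true → ⊥
            case-false ()

          touching : ∀ {a b} → adj (K 3 4) a b ≡ true → ∃[ v ] (Class b v × ∃[ u ] (Class a u × u ~ v))
          touching {a} {b} f with edge⁺ (trans (adj-from a b) f)
          ... | u , v , p , q , e = v , q , u , p , e

          row : Fin 3 → Fin 7
          row i = i ↑ˡ 4

          col : Fin 4 → Fin 7
          col k = 3 ↑ʳ k

          row-side : ∀ i → (toℕ (row i) <ᵇ 3) ≡ true
          row-side 0F = refl
          row-side 1F = refl
          row-side 2F = refl

          row≢row : ∀ {i j} → i ≢ j → row i ≢ row j
          row≢row n q = n (↑ˡ-injective 4 _ _ q)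

          row≢col : ∀ i k → row i ≢ col k
          row≢col 0F k ()
          row≢col 1F k ()
          row≢col 2F k ()

          A : Fin 3 → Pred
          A i = Class (row i)

          B : Fin 4 → Subset (size (graph G))
          B k = comprehend (Class? (col k))

          B⇒ : ∀ {k v} → v ∈ₛ B k → Class (col k) v
          B⇒ {k} = ∈-comprehend⁻ (Class? (col k))

          ⇒B : ∀ {k v} → Class (col k) v → v ∈ₛ B k
          ⇒B {k} = ∈-comprehend⁺ (Class? (col k))

          AA : ∀ {i j} → i ≢ j → Sep (A i) (A j)
          AA {i} {j} n = separated (row≢row n) (cong₂ _xor_ (row-side i) (row-side j))

          columns : ∀ k → Column (λ i → Nb (A i)) (_∈ₛ B k)
          columns k = column (λ i → Nb? (Class? (row i))) (B k) (⊂-wellFounded (B k))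
            (λ p q → mapW ⇒B (conn _ (B⇒ p) (B⇒ q)))
            (λ i → let (v , v∈ , s) = touching {row i} {col k} (cong (_xor false) (row-side i)) in v , ⇒B v∈ , s)

        no-K₃₄-model : ⊥
        no-K₃₄-model = no-four-columns A (λ i → Class? (row i)) AA (λ i → conn _) (λ k → _∈ₛ B k) columns
          (λ k p q → disjoint (row≢col _ k) p (B⇒ q))
          (λ n p q → separated (n ∘ ↑ʳ-injective 3 _ _) refl (B⇒ p) (B⇒ q))

theorem1p3 : (G : SimpleGraph) → InducedMinor (K 3 4) (graph G) →
  HasTriangle G ⊎ HasTheta G
theorem1p3 G (H , p , iso) = by-contradiction G λ noTri noTheta →
  no-K₃₄-model G noTri noTheta (model (SimpleGraph.sym G) (irrefl G) p) iso
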